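{- Let $w \in \mathfrak{S}_n$ be a smooth permutation, i.e. $w$ avoids the patterns $3412$ and $4231$. Then \[ \max_{u \in P^w_1} \operatorname{udeg}_w(u) \leq \max_{u \in P^w_{\ell(w)-1}} \operatorname{ddeg}_w(u), \] with equality if and only if the interval $[e,w]$ in Bruhat order is self-dual.
   Context: $\mathfrak{S}_n$ is the symmetric group, viewed as a Coxeter group with simple generators $s_i=(i\ i+1)$, $1\le i\le n-1$. For $w\in\mathfrak{S}_n$, $\ell(w)$ is the number of inversions of $w$ (pairs $i<j$ with $w(i)>w(j)$). Bruhat order is the transitive closure of the relations $w < wt$ for transpositions $t$ with $\ell(wt)>\ell(w)$; $e$ is the identity and $[e,w]=\{u: u\le w\}$. For $0\le k\le \ell(w)$, $P^w_k=\{u\le w:\ell(u)=k\}$. For $u\in[e,w]$, $\operatorname{udeg}_w(u)$ is the number of $v\in[e,w]$ covering $u$, and $\operatorname{ddeg}_w(u)$ is the number of elements of $[e,w]$ covered by $u$. For $\pi\in\mathfrak{S}_m$, $w\in\mathfrak{S}_n$ avoids $\pi$ if there are no indices $i_1<\dots<i_m$ with $w(i_1),\dots,w(i_m)$ in the same relative order as $\pi(1),\dots,\pi(m)$. A poset is self-dual if it is isomorphic to the poset on the same set with the order reversed. -}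

module Defs where

open import Data.Nat using (ℕ; zero; suc; _∸_) renaming (_<_ to _<ℕ_; _≤_ to _≤ℕ_)
open import Data.Fin using (Fin; _<_; _<?_; #_)
open import Data.Vec using (Vec; []; _∷_; lookup; tabulate; sum; _[_]≔_)
open import Data.Bool using (if_then_else_; _∧_)
open import Data.Product using (Σ; ∃; _×_; _,_)
open import Data.Sum using (_⊎_)
open import Function using (id)
open import Relation.Nullary using (¬_; does)
open import Relation.Binary.PropositionalEquality using (_≡_; _≢_)
open import Relation.Binary.Construct.Closure.ReflexiveTransitive using (Star)

-- A permutation w ∈ 𝔖ₙ in one-line notation: the vector (w(1),…,w(n)),
-- with values in Fin n (0-based).  Only vectors satisfying IsPerm are permutations.
Word : ℕ → Set
Word n = Vec (Fin n) n

IsPerm : ∀ {n} → Word n → Set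
IsPerm {n} w = ∀ (i j : Fin n) → lookup w i ≡ lookup w j → i ≡ j

e : ∀ {n} → Word n
e = tabulate id

len : ∀ {n} → Word n → ℕ
len {n} w = sum (tabulate λ i → sum (tabulate λ j →
  if does (i <? j) ∧ does (lookup w j <? lookup w i) then 1 else 0))

swapPos : ∀ {n} → Word n → Fin n → Fin n → Word n
swapPos w i j = (w [ i ]≔ lookup w j) [ j ]≔ lookup w i

BStep : ∀ {n} → Word n → Word n → Set
BStep {n} w v = Σ (Fin n) λ i → Σ (Fin n) λ j →
  (i < j) × (v ≡ swapPos w i j) × (len w <ℕ len v)

_≤B_ : ∀ {n} → Word n → Word n → Set
_≤B_ = Star BStep

InI : ∀ {n} → Word n → Word n → Set
InI w u = (e ≤B u) × (u ≤B w)

Covers : ∀ {n} → Word n → Word n → Set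
Covers u v = (u ≤B v) × (u ≢ v) ×
  (∀ z → u ≤B z → z ≤B v → (z ≡ u) ⊎ (z ≡ v))

HasSize : ∀ {A : Set} → (A → Set) → ℕ → Set
HasSize {A} P k = Σ (Fin k → A) λ f →
  (∀ i j → f i ≡ f j → i ≡ j) × (∀ i → P (f i)) × (∀ x → P x → ∃ λ i → f i ≡ x)

UDeg : ∀ {n} → Word n → Word n → ℕ → Set
UDeg w u k = HasSize (λ v → InI w v × Covers u v) k

DDeg : ∀ {n} → Word n → Word n → ℕ → Set
DDeg w u k = HasSize (λ v → InI w v × Covers v u) k

InP : ∀ {n} → Word n → ℕ → Word n → Set
InP w k u = InI w u × (len u ≡ k)

IsMaxOver : ∀ {A : Set} → (A → Set) → (A → ℕ → Set) → ℕ → Set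
IsMaxOver P f m = (∃ λ a → P a × f a m) × (∀ a k → P a → f a k → k ≤ℕ m)

Avoids : ∀ {n m} → Word n → Word m → Set
Avoids {n} {m} w π = ¬ (Σ (Fin m → Fin n) λ ι →
  (∀ a b → a < b → ι a < ι b) ×
  (∀ a b → (lookup w (ι a) < lookup w (ι b) → lookup π a < lookup π b)
         × (lookup π a < lookup π b → lookup w (ι a) < lookup w (ι b))))

p3412 : Word 4
p3412 = # 2 ∷ # 3 ∷ # 0 ∷ # 1 ∷ []

p4231 : Word 4
p4231 = # 3 ∷ # 1 ∷ # 2 ∷ # 0 ∷ []

Smooth : ∀ {n} → Word n → Set
Smooth w = Avoids w p3412 × Avoids w p4231

SelfDual : ∀ {n} → Word n → Set
SelfDual {n} w = Σ (Word n → Word n) λ f → Σ (Word n → Word n) λ g →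
  (∀ x → InI w x → InI w (f x)) × (∀ x → InI w x → InI w (g x)) ×
  (∀ x → InI w x → g (f x) ≡ x) × (∀ x → InI w x → f (g x) ≡ x) ×
  (∀ x y → InI w x → InI w y → (x ≤B y → f y ≤B f x) × (f y ≤B f x → x ≤B y))

{-# OPTIONS --safe #-}

-- Covers in Bruhat order correspond to minimal inversions, so the down-degree of a coatom v is the number of
-- minimal inversions of v.  Every cut j crossed by v carries a canonical minimal inversion, and different cuts
-- carry different ones; the minimal inversions 3..2 of a 3412 or 2..1 of a 4231 are never canonical.  The
-- up-degree of s_i counts the other letters j of w, plus the neighbours j of i for which both s_i s_j and s_j s_i
-- lie below w.  When w is smooth and m (0, 1 or 2) such neighbours exist, w contains 321 if m = 1 and one of
-- 4321, 3421, 4312 if m = 2, and swapping a suitable minimal inversion of the pattern gives a coatom with the same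
-- letters and m - 1 non-canonical minimal inversions; hence the inequality.  If w contains 34521, 54123, 45321
-- or 54312, some coatom even has two non-canonical ones, and the inequality is strict.
--
-- A smooth w avoiding these four patterns is, up to inversion, y w₀(P) or y s_a w₀(P), where P is a final window
-- of positions and y lives on the earlier positions, sharing no letter or only s_a with P.  The maps x z ↦ x′ z′ and
-- x z ↦ x′ s_a z w₀(P), with x ↦ x′ an antiautomorphism of [e, y], are then antiautomorphisms of [e, w].
-- Conversely an antiautomorphism exchanges atoms and coatoms together with their degrees.

module Submission where

open import Defs
open import Data.Bool using (if_then_else_; _∧_)
open import Data.Empty using (⊥; ⊥-elim)
open import Data.Fin as Fin using (Fin; toℕ; fromℕ<)
import Data.Fin.Properties as Finₚ
open import Data.Nat
open import Data.Nat.Properties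
open import Data.Nat.Solver using (module +-*-Solver)
open import Data.Product
open import Data.Sum
open import Data.Vec as Vec using (Vec; lookup; tabulate; []; _∷_)
import Data.Vec.Properties as Vecₚ
open import Function using (_∘_; id)
open import Function.Bundles using (_⇔_; mk⇔)
open import Relation.Binary using (Tri; tri<; tri≈; tri>)
open import Relation.Binary.Construct.Closure.ReflexiveTransitive using (ε; _◅_; _◅◅_)
open import Relation.Binary.PropositionalEquality hiding ([_]; J)
open import Relation.Nullary
open import Relation.Nullary.Decidable using (_×-dec_; dec-true; dec-false)
open import Relation.Unary using (Decidable)

-- Permutations of ℕ

-- The count leaves one place free. Among the covers of s_i, every other letter takes the canonical
-- inversion at its own cut, so the cut i itself can serve one neighbour with both products below w.
-- For self-duality the obstacle is that x z does not determine x and z when the factors share s_a.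
-- The antiautomorphism is therefore built as a relation, and the one on the earlier positions has
-- to commute with right multiplication by s_a. This is proved only for the y that arise by
-- splitting off a window, as a second statement carried through the same induction; passing to
-- inverses turns the left compatibility of one gluing into the right compatibility needed by the
-- next.

infixl 9 _·_
infixr 8 _∘ₚ_
infix 4 _≈_ _⇝_

-- Acting on all of ℕ lets factors supported on windows of different sizes be composed without
-- reindexing. Both directions are stored so that inverses compute.
record Perm : Set where
  field
    to from : ℕ → ℕ
    from-to : ∀ i → from (to i) ≡ i
    to-from : ∀ i → to (from i) ≡ i

open Perm using (from-to; to-from)

_·_ : Perm → ℕ → ℕ
_·_ = Perm.to

_≈_ : Perm → Perm → Set
u ≈ v = ∀ i → u · i ≡ v · i

idₚ : Perm
idₚ = record { to = λ i → i ; from = λ i → i ; from-to = λ _ → refl ; to-from = λ _ → refl }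

_∘ₚ_ : Perm → Perm → Perm
u ∘ₚ v = record
  { to      = λ i → u · (v · i)
  ; from    = λ i → Perm.from v (Perm.from u i)
  ; from-to = λ i → trans (cong (Perm.from v) (from-to u _)) (from-to v i)
  ; to-from = λ i → trans (cong (u ·_) (to-from v _)) (to-from u i)
  }

_⁻¹ : Perm → Perm
u ⁻¹ = record { to = Perm.from u ; from = Perm.to u ; from-to = to-from u ; to-from = from-to u }

inj : ∀ u {i j} → u · i ≡ u · j → i ≡ j
inj u {i} {j} eq = trans (sym (from-to u i)) (trans (cong (Perm.from u) eq) (from-to u j))

inj≢ : ∀ u {i j} → i ≢ j → u · i ≢ u · j
inj≢ u i≢j eq = i≢j (inj u eq)

⁻¹-swap : ∀ u {i j} → u · i ≡ j → u ⁻¹ · j ≡ i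
⁻¹-swap u {i} refl = from-to u i

⁻¹-cong : ∀ {u v} → u ≈ v → u ⁻¹ ≈ v ⁻¹
⁻¹-cong {u} {v} u≈v i = inj v (trans (sym (u≈v _)) (trans (to-from u i) (sym (to-from v i))))

<-cases : ∀ {i j} → i ≢ j → i < j ⊎ j < i
<-cases {i} {j} i≢j with <-cmp i j
... | tri< p _ _ = inj₁ p
... | tri≈ _ p _ = ⊥-elim (i≢j p)
... | tri> _ _ p = inj₂ p

-- Acts on positions when composed on the right, so u ∘ₚ tr i j swaps the entries of u at i and j.
trTo : ℕ → ℕ → ℕ → ℕ
trTo i j k with k ≟ i | k ≟ j
... | yes _ | _     = j
... | no _  | yes _ = i
... | no _  | no _  = k

trTo-l : ∀ i j → trTo i j i ≡ j
trTo-l i j with i ≟ i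
... | yes _ = refl
... | no p  = ⊥-elim (p refl)

trTo-r : ∀ i j → trTo i j j ≡ i
trTo-r i j with j ≟ i | j ≟ j
... | yes p | _     = p
... | no _  | yes _ = refl
... | no _  | no p  = ⊥-elim (p refl)

trTo-o : ∀ i j {k} → k ≢ i → k ≢ j → trTo i j k ≡ k
trTo-o i j {k} p q with k ≟ i | k ≟ j
... | yes r | _     = ⊥-elim (p r)
... | no _  | yes r = ⊥-elim (q r)
... | no _  | no _  = refl

data TrView (i j : ℕ) : ℕ → ℕ → Set where
  at-l : TrView i j i j
  at-r : TrView i j j i
  off  : ∀ {k} → k ≢ i → k ≢ j → TrView i j k k

trView : ∀ i j k → TrView i j k (trTo i j k)
trView i j k with k ≟ i | k ≟ j
... | yes refl | _        = at-l
... | no _     | yes refl = at-r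
... | no p     | no q     = off p q

trTo-inv : ∀ i j k → trTo i j (trTo i j k) ≡ k
trTo-inv i j k with trTo i j k | trView i j k
... | _ | at-l    = trTo-r i j
... | _ | at-r    = trTo-l i j
... | _ | off p q = trTo-o i j p q

tr : ℕ → ℕ → Perm
tr i j = record { to = trTo i j ; from = trTo i j ; from-to = trTo-inv i j ; to-from = trTo-inv i j }

tr-conj : ∀ u i j k → u · (tr i j · k) ≡ tr (u · i) (u · j) · (u · k)
tr-conj u i j k with trTo i j k | trView i j k
... | _ | at-l    = sym (trTo-l (u · i) (u · j))
... | _ | at-r    = sym (trTo-r (u · i) (u · j))
... | _ | off p q = sym (trTo-o (u · i) (u · j) (inj≢ u p) (inj≢ u q))

tr-comm : ∀ i j → tr i j ≈ tr j i
tr-comm i j k with trTo i j k | trView i j k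
... | _ | at-l    = sym (trTo-r j i)
... | _ | at-r    = sym (trTo-l j i)
... | _ | off p q = sym (trTo-o j i q p)

tr-unique : ∀ {a b i j} → a < b → i < j → tr a b ≈ tr i j → a ≡ i × b ≡ j
tr-unique {a} {b} {i} {j} a<b i<j eq with trTo i j a | trView i j a | eq a
... | _ | at-l    | p = refl , trans (sym (trTo-l a b)) p
... | _ | at-r    | p = ⊥-elim (<-asym a<b (subst (_< a) (sym (trans (sym (trTo-l a b)) p)) i<j))
... | _ | off _ _ | p = ⊥-elim (<-irrefl (sym (trans (sym (trTo-l a b)) p)) a<b)

-- Bruhat steps, with the length condition replaced by the equivalent local one u i < u j.
_⇝_ : Perm → Perm → Set
u ⇝ v = ∃₂ λ i j → i < j × u · i < u · j × v ≈ u ∘ₚ tr i j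

⇝-resp : ∀ {u v u₁ v₁} → u ≈ u₁ → v ≈ v₁ → u ⇝ v → u₁ ⇝ v₁
⇝-resp p q (i , j , i<j , lt , eq) =
  i , j , i<j , subst₂ _<_ (p i) (p j) lt , λ k → trans (sym (q k)) (trans (eq k) (p _))

⇝-swap : ∀ v {i j} → i < j → v · j < v · i → v ∘ₚ tr i j ⇝ v
⇝-swap v {i} {j} i<j lt = i , j , i<j
  , subst₂ _<_ (cong (v ·_) (sym (trTo-l i j))) (cong (v ·_) (sym (trTo-r i j))) lt
  , λ k → cong (v ·_) (sym (trTo-inv i j k))

⇝-lower : ∀ {u v} → u ⇝ v → ∃₂ λ i j → i < j × v · j < v · i × u ≈ v ∘ₚ tr i j
⇝-lower {u} {v} (i , j , i<j , lt , eq) = i , j , i<j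
  , subst₂ _<_ (sym (trans (eq j) (cong (u ·_) (trTo-r i j)))) (sym (trans (eq i) (cong (u ·_) (trTo-l i j)))) lt
  , λ k → trans (cong (u ·_) (sym (trTo-inv i j k))) (sym (eq _))

⇝-⁻¹ : ∀ {u v} → u ⇝ v → u ⁻¹ ⇝ v ⁻¹
⇝-⁻¹ {u} {v} (i , j , i<j , lt , eq) = u · i , u · j , lt
  , subst₂ _<_ (sym (from-to u i)) (sym (from-to u j)) i<j
  , λ k → ⁻¹-swap v (trans (eq _) (trans (tr-conj u i j _)
      (trans (cong (trTo (u · i) (u · j)) (to-from u _)) (trTo-inv (u · i) (u · j) k))))

-- Membership in the parabolic subgroup generated by s_a, ..., s_{m-2}. The windows [0, 1 + a) and
-- [a, m) share a position but no generator.
record Supp (a m : ℕ) (u : Perm) : Set where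
  constructor supp
  field fix : ∀ i → (i < a ⊎ m ≤ i) → u · i ≡ i

open Supp public

module _ {a m u} (S : Supp a m u) where

  supp-⁻¹ : Supp a m (u ⁻¹)
  supp-⁻¹ = supp λ i p → ⁻¹-swap u (fix S i p)

  supp-lo : ∀ {i} → a ≤ i → a ≤ u · i
  supp-lo {i} a≤i with u · i <? a
  ... | no p  = ≮⇒≥ p
  ... | yes p = ⊥-elim (<⇒≱ p (subst (a ≤_) (sym (inj u (fix S (u · i) (inj₁ p)))) a≤i))

  supp-hi : ∀ {i} → i < m → u · i < m
  supp-hi {i} i<m with u · i <? m
  ... | yes p = p
  ... | no p  = ⊥-elim (p (subst (_< m) (sym (inj u (fix S (u · i) (inj₂ (≮⇒≥ p))))) i<m))

  -- Outside the window u is the identity, and inside it stays inside, so a position outside takes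
  -- part in no inversion. This is what bounds every later search.
  supp-inversion : ∀ {i j} → i < j → u · j < u · i → a ≤ i × j < m
  supp-inversion {i} {j} i<j lt = left , right
    where
    left : a ≤ i
    left with i <? a
    ... | no p  = ≮⇒≥ p
    ... | yes p = ⊥-elim (<-asym i<j (subst₂ _<_ (inj u (fix S (u · j) (inj₁ (<-trans lt ui<a)))) (fix S i (inj₁ p)) lt))
      where
      ui<a : u · i < a
      ui<a = subst (_< a) (sym (fix S i (inj₁ p))) p
    right : j < m
    right with j <? m
    ... | yes p = p
    ... | no p  = ⊥-elim (<-asym i<j (subst₂ _<_ (fix S j (inj₂ (≮⇒≥ p)))
                    (inj u (fix S (u · i) (inj₂ (<⇒≤ (≤-<-trans (≮⇒≥ p) (subst (_< u · i) (fix S j (inj₂ (≮⇒≥ p))) lt)))))) lt))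

supp-∘ : ∀ {a m u v} → Supp a m u → Supp a m v → Supp a m (u ∘ₚ v)
supp-∘ {u = u} p q = supp λ i r → trans (cong (u ·_) (fix q i r)) (fix p i r)

supp-weaken : ∀ {a b m n u} → b ≤ a → m ≤ n → Supp a m u → Supp b n u
supp-weaken p q S = supp λ i → [ (λ r → fix S i (inj₁ (<-≤-trans r p))) , (λ r → fix S i (inj₂ (≤-trans q r))) ]

supp-≈ : ∀ {a m u v} → u ≈ v → Supp a m u → Supp a m v
supp-≈ u≈v S = supp λ i p → trans (sym (u≈v i)) (fix S i p)

supp-tr : ∀ {a m i j} → a ≤ i → a ≤ j → i < m → j < m → Supp a m (tr i j)
supp-tr {i = i} {j} p q r s = supp λ k →
  [ (λ t → trTo-o i j (λ e → <⇒≱ (subst (_< _) e t) p) (λ e → <⇒≱ (subst (_< _) e t) q))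
  , (λ t → trTo-o i j (λ e → <⇒≱ r (subst (_ ≤_) e t)) (λ e → <⇒≱ s (subst (_ ≤_) e t))) ]

-- The longest element of the window [a, m), extended by the identity.
rev : ℕ → ℕ → ℕ → ℕ
rev a m i with a ≤? i | i <? m
... | yes _ | yes _ = a + m ∸ suc i
... | yes _ | no _  = i
... | no _  | _     = i

rev-in : ∀ {a m i} → a ≤ i → i < m → rev a m i ≡ a + m ∸ suc i
rev-in {a} {m} {i} p q with a ≤? i | i <? m
... | yes _ | yes _ = refl
... | yes _ | no r  = ⊥-elim (r q)
... | no r  | _     = ⊥-elim (r p)

rev-out : ∀ {a m} i → (i < a ⊎ m ≤ i) → rev a m i ≡ i
rev-out {a} {m} i p with a ≤? i | i <? m
... | yes r | yes s = ⊥-elim ([ (λ q → <⇒≱ q r) , <⇒≱ s ] p)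
... | yes _ | no _  = refl
... | no _  | _     = refl

rev-lo : ∀ {a m i} → a ≤ i → i < m → a ≤ a + m ∸ suc i
rev-lo {a} {m} {i} p q = subst (a ≤_) (sym (+-∸-assoc a q)) (m≤m+n a _)

rev-hi : ∀ {a m i} → a ≤ i → i < m → a + m ∸ suc i < m
rev-hi {a} {m} {i} p q = subst (_≤ m) (+-∸-assoc 1 {a + m} {suc i} (≤-trans q (m≤n+m m a)))
  (subst (a + m ∸ i ≤_) (m+n∸m≡n a m) (∸-monoʳ-≤ (a + m) p))

rev-inv : ∀ a m i → rev a m (rev a m i) ≡ i
rev-inv a m i with a ≤? i | i <? m
... | yes p | yes q = trans (rev-in (rev-lo p q) (rev-hi p q))
                        (trans (cong (a + m ∸_) (sym (+-∸-assoc 1 {a + m} {suc i} (≤-trans q (m≤n+m m a)))))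
                          (m∸[m∸n]≡n (≤-trans (<⇒≤ q) (m≤n+m m a))))
... | yes _ | no q  = rev-out {a} {m} i (inj₂ (≮⇒≥ q))
... | no p  | _     = rev-out {a} {m} i (inj₁ (≰⇒> p))

w₀ : ℕ → ℕ → Perm
w₀ a m = record { to = rev a m ; from = rev a m ; from-to = rev-inv a m ; to-from = rev-inv a m }

supp-w₀ : ∀ a m → Supp a m (w₀ a m)
supp-w₀ a m = supp rev-out

w₀-anti : ∀ {a m i j} → a ≤ i → i < j → j < m → rev a m j < rev a m i
w₀-anti {a} {m} {i} {j} p q r =
  subst₂ _<_ (sym (rev-in (≤-trans p (<⇒≤ q)) r)) (sym (rev-in p (<-trans q r)))
    (∸-monoʳ-< (s≤s q) (≤-trans r (m≤n+m m a)))

-- Order-reversing involutions of lower intervals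

-- Right multiplication by ρ changes only where the two swapped values stand, so the order of their
-- new positions is the one thing to check.
⇝-push : ∀ {x y} ρ {k l} → ρ ⁻¹ · k < ρ ⁻¹ · l → x · k < x · l → y ≈ x ∘ₚ tr k l → x ∘ₚ ρ ⇝ y ∘ₚ ρ
⇝-push {x} {y} ρ {k} {l} kl lt eq = ρ ⁻¹ · k , ρ ⁻¹ · l , kl
  , subst₂ (λ p q → x · p < x · q) (sym (to-from ρ k)) (sym (to-from ρ l)) lt
  , λ t → trans (eq _) (cong (x ·_) (trans (cong₂ (λ p q → trTo p q (ρ · t)) (sym (to-from ρ k)) (sym (to-from ρ l)))
            (sym (tr-conj ρ (ρ ⁻¹ · k) (ρ ⁻¹ · l) t))))

step-supp : ∀ {a m x y k l} → Supp a m y → k < l → x · k < x · l → y ≈ x ∘ₚ tr k l → a ≤ k × l < m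
step-supp {x = x} {k = k} {l} S kl lt eq = supp-inversion S kl
  (subst₂ _<_ (sym (trans (eq l) (cong (x ·_) (trTo-r k l)))) (sym (trans (eq k) (cong (x ·_) (trTo-l k l)))) lt)

swap-supp : ∀ {a m x i j} → Supp a m x → i < j → x · j < x · i → Supp a m (x ∘ₚ tr i j)
swap-supp {x = x} S i<j lt with supp-inversion S i<j lt
... | p , q = supp-∘ {u = x} {v = tr _ _} S (supp-tr p (≤-trans p (<⇒≤ i<j)) (<-trans i<j q) q)

tr-commute : ∀ x i j → x · i ≡ i → x · j ≡ j → ∀ k → x · (tr i j · k) ≡ tr i j · (x · k)
tr-commute x i j p q k = trans (tr-conj x i j k) (cong₂ (λ s t → trTo s t (x · k)) p q)

-- The graph of an order-reversing involution of [e, w].  R-down propagates a pair downwards from (w, e), so it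
-- gives both that the graph is total on [e, w] and that it reverses the order.
record AntiRel (lo hi : ℕ) (w : Perm) : Set₁ where
  field
    R       : Perm → Perm → Set
    R-start : R idₚ w
    R-sym   : ∀ {u v} → R u v → R v u
    R-resp  : ∀ {u u′ v v′} → u ≈ v → u′ ≈ v′ → R u u′ → R v v′
    R-fun   : ∀ {u u′ v v′} → R u u′ → R v v′ → u ≈ v → u′ ≈ v′
    R-supp  : ∀ {u u′} → R u u′ → Supp lo hi u
    R-down  : ∀ {u v v′} → R v v′ → u ⇝ v → ∃ λ u′ → R u u′ × v′ ⇝ u′

open AntiRel

-- Compatibility with multiplication by s_k, which makes the image of x z independent of the factorisation when
-- the supports of x and z share the letter s_k.
EquivR EquivL : ∀ {lo hi w} → AntiRel lo hi w → ℕ → Set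
EquivR A k = ∀ {u u′} → R A u u′ → R A (u ∘ₚ tr k (suc k)) (u′ ∘ₚ tr k (suc k))
EquivL A k = ∀ {u u′} → R A u u′ → R A (tr k (suc k) ∘ₚ u) (tr k (suc k) ∘ₚ u′)

respᴬ : ∀ {lo hi w v} → w ≈ v → AntiRel lo hi w → AntiRel lo hi v
respᴬ eq A = record
  { R = R A ; R-start = R-resp A (λ _ → refl) eq (R-start A) ; R-sym = R-sym A ; R-resp = R-resp A
  ; R-fun = R-fun A ; R-supp = R-supp A ; R-down = R-down A }

weakenᴬ : ∀ {lo hi hi′ w} → hi ≤ hi′ → AntiRel lo hi w → AntiRel lo hi′ w
weakenᴬ le A = record
  { R = R A ; R-start = R-start A ; R-sym = R-sym A ; R-resp = R-resp A
  ; R-fun = R-fun A ; R-supp = λ r → supp-weaken ≤-refl le (R-supp A r) ; R-down = R-down A }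

-- Inversion preserves Bruhat steps and hence carries the graph over; left and right multiplication
-- trade places.
invᴬ : ∀ {lo hi w} → AntiRel lo hi w → AntiRel lo hi (w ⁻¹)
invᴬ A = record
  { R       = λ u u′ → R A (u ⁻¹) (u′ ⁻¹)
  ; R-start = R-start A
  ; R-sym   = R-sym A
  ; R-resp  = λ {u} {u′} {v} {v′} p q → R-resp A (⁻¹-cong {u} {v} p) (⁻¹-cong {u′} {v′} q)
  ; R-fun   = λ {u} {u′} {v} {v′} r s eq → ⁻¹-cong {u′ ⁻¹} {v′ ⁻¹} (R-fun A r s (⁻¹-cong {u} {v} eq))
  ; R-supp  = λ {u} r → supp-⁻¹ {u = u ⁻¹} (R-supp A r)
  ; R-down  = λ {u} {v} {v′} r s → let (x , r′ , s′) = R-down A r (⇝-⁻¹ {u} {v} s) in x ⁻¹ , r′ , ⇝-⁻¹ {v′ ⁻¹} {x} s′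
  }

EquivL⇒R : ∀ {lo hi w k} (A : AntiRel lo hi w) → EquivL A k → EquivR (invᴬ A) k
EquivL⇒R A E r = R-resp A (λ _ → refl) (λ _ → refl) (E r)

EquivR⇒L : ∀ {lo hi w k} (A : AntiRel lo hi w) → EquivR A k → EquivL (invᴬ A) k
EquivR⇒L A E r = R-resp A (λ _ → refl) (λ _ → refl) (E r)

leftW₀ : ∀ a m → AntiRel a m (w₀ a m)
leftW₀ a m = record
  { R       = λ z z′ → Supp a m z × z′ ≈ w₀ a m ∘ₚ z
  ; R-start = supp (λ _ _ → refl) , λ _ → refl
  ; R-sym   = λ {u} {v} (S , eq) → supp-≈ {u = w₀ a m ∘ₚ u} {v = v} (λ i → sym (eq i)) (supp-∘ {u = w₀ a m} {v = u} (supp-w₀ a m) S)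
      , λ i → trans (sym (rev-inv a m (u · i))) (cong (rev a m) (sym (eq i)))
  ; R-resp  = λ {u} {u′} {v} {v′} p q (S , eq) → supp-≈ {u = u} {v = v} p S
      , λ i → trans (sym (q i)) (trans (eq i) (cong (rev a m) (p i)))
  ; R-fun   = λ {u} {u′} {v} {v′} (_ , p) (_ , q) eq i → trans (p i) (trans (cong (rev a m) (eq i)) (sym (q i)))
  ; R-supp  = proj₁
  ; R-down  = λ {u} {v} {v′} → down {u} {v} {v′}
  }
  where
  down : ∀ {u v v′} → Supp a m v × v′ ≈ w₀ a m ∘ₚ v → u ⇝ v →
         ∃ λ u′ → (Supp a m u × u′ ≈ w₀ a m ∘ₚ u) × v′ ⇝ u′
  down {u} {v} {v′} (S , eq) st with ⇝-lower {u} {v} st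
  ... | i , j , i<j , lt , e with supp-inversion S i<j lt
  ... | p , q = w₀ a m ∘ₚ u , (supp-≈ {u = v ∘ₚ tr i j} {v = u} (λ k → sym (e k)) (swap-supp {x = v} S i<j lt) , λ _ → refl)
      , (i , j , i<j , subst₂ _<_ (sym (eq i)) (sym (eq j))
            (w₀-anti (supp-lo S (≤-trans p (<⇒≤ i<j))) lt (supp-hi S (<-trans i<j q)))
        , λ k → trans (cong (rev a m) (e k)) (sym (eq _)))

-- The longest element is an involution, so z ↦ z w₀ belongs to the same interval as z ↦ w₀ z. The
-- two differ in the side on which they commute with simple reflections, and each gluing picks the
-- side that it needs.
rightW₀ : ∀ a m → AntiRel a m (w₀ a m)
rightW₀ a m = respᴬ {w = w₀ a m ⁻¹} (λ _ → refl) (invᴬ (leftW₀ a m))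

leftW₀-EquivR : ∀ {a m k} → a ≤ k → suc k < m → EquivR (leftW₀ a m) k
leftW₀-EquivR p q {u} (S , eq) =
  supp-∘ {u = u} {v = tr _ _} S (supp-tr p (m≤n⇒m≤1+n p) (<-trans (n<1+n _) q) q) , λ i → eq _

rightW₀-EquivL : ∀ {a m k} → a ≤ k → suc k < m → EquivL (rightW₀ a m) k
rightW₀-EquivL {a} {m} {k} p q {u} {u′} = EquivR⇒L (leftW₀ a m) (λ {v} {v′} → leftW₀-EquivR p q {v} {v′}) {u} {u′}

-- An inversion i < j of x ∘ z with i < a comes from the inversion i < z j of x, since z fixes i.
lower-left : ∀ {a m x z i j} → Supp a m z → i < j → i < a → x · (z · j) < x · (z · i) →
             i < z · j × x ∘ₚ tr i (z · j) ⇝ x × ((x ∘ₚ z) ∘ₚ tr i j ≈ (x ∘ₚ tr i (z · j)) ∘ₚ z)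
lower-left {a} {x = x} {z} {i} {j} S i<j i<a lt = i<zj , ⇝-swap x i<zj (subst (λ s → x · (z · j) < x · s) zi lt)
  , λ k → cong (x ·_) (trans (tr-conj z i j k) (cong (λ s → trTo s (z · j) (z · k)) zi))
  where
  zi = fix S i (inj₁ i<a)
  i<zj : i < z · j
  i<zj with j <? a
  ... | yes p = subst (i <_) (sym (fix S j (inj₁ p))) i<j
  ... | no p  = <-≤-trans i<a (supp-lo S (≮⇒≥ p))

-- Supports without a common letter: x z ↦ x′ z′.
module Glue₀ {a m y z₀} (a<m : a < m) (A : AntiRel 0 (suc a) y) (B : AntiRel a m z₀) where

  R₀ : Perm → Perm → Set
  R₀ u u′ = ∃₂ λ x x′ → ∃₂ λ z z′ → R A x x′ × R B z z′ × u ≈ x ∘ₚ z × u′ ≈ x′ ∘ₚ z′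

  -- The product determines both factors. Below `a` the second factor is the identity, beyond `a`
  -- the first one is, and x₂⁻¹ x₁ = z₂ z₁⁻¹ sends `a` to a position that is at most `a` by the left
  -- side and at least `a` by the right side.
  fun : ∀ {u u′ v v′} → R₀ u u′ → R₀ v v′ → u ≈ v → u′ ≈ v′
  fun {u} {u′} {v} {v′} (x₁ , x₁′ , z₁ , z₁′ , r₁ , s₁ , p₁ , q₁) (x₂ , x₂′ , z₂ , z₂′ , r₂ , s₂ , p₂ , q₂) eq i =
    trans (q₁ i) (trans (R-fun A r₁ r₂ x≈ _) (trans (cong (x₂′ ·_) (R-fun B s₁ s₂ z≈ i)) (sym (q₂ i))))
    where
    xz : ∀ i → x₁ · (z₁ · i) ≡ x₂ · (z₂ · i)
    xz i = trans (sym (p₁ i)) (trans (eq i) (p₂ i))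
    x≈ : x₁ ≈ x₂
    x≈ i with i <? a
    ... | yes p = trans (cong (x₁ ·_) (sym (fix (R-supp B s₁) i (inj₁ p)))) (trans (xz i) (cong (x₂ ·_) (fix (R-supp B s₂) i (inj₁ p))))
    ... | no p with m≤n⇒m<n∨m≡n (≮⇒≥ p)
    ... | inj₁ q = trans (fix (R-supp A r₁) i (inj₂ q)) (sym (fix (R-supp A r₂) i (inj₂ q)))
    ... | inj₂ refl = trans (sym (to-from x₂ _)) (cong (x₂ ·_) (≤-antisym (≤-pred lt) ge))
      where
      lt : x₂ ⁻¹ · (x₁ · a) < suc a
      lt = supp-hi (supp-⁻¹ (R-supp A r₂)) (supp-hi (R-supp A r₁) (n<1+n a))
      ge : a ≤ x₂ ⁻¹ · (x₁ · a)
      ge = subst (a ≤_) (trans (sym (⁻¹-swap x₂ {z₂ · (z₁ ⁻¹ · a)} refl)) (cong (x₂ ⁻¹ ·_) (trans (sym (xz _)) (cong (x₁ ·_) (to-from z₁ a)))))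
             (supp-lo (R-supp B s₂) (supp-lo (supp-⁻¹ (R-supp B s₁)) ≤-refl))
    z≈ : z₁ ≈ z₂
    z≈ i = inj x₂ (trans (sym (x≈ _)) (xz i))

  -- A swap that starts left of `a` comes from a swap in x. One that starts at `a` or later comes
  -- from z, since x is increasing on [a, ∞): it sends `a` to at most `a` and fixes everything
  -- beyond.
  down : ∀ {u v v′} → R₀ v v′ → u ⇝ v → ∃ λ u′ → R₀ u u′ × v′ ⇝ u′
  down {u} {v} {v′} (x , x′ , z , z′ , r , s , p , q) st with ⇝-lower {u} {v} st
  ... | i , j , i<j , lt , e with subst₂ _<_ (p j) (p i) lt | i <? a
  ... | lt′ | yes i<a with lower-left {x = x} {z} (R-supp B s) i<j i<a lt′
  ... | i<zj , st′ , eq with R-down A {x ∘ₚ tr i (z · j)} r st′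
  ... | x″ , r″ , (k , l , k<l , lt″ , e″) with step-supp {x = x′} (R-supp A (R-sym A r″)) k<l lt″ e″
  ... | _ , l<1+a = x″ ∘ₚ z′ , (_ , x″ , z , z′ , r″ , s , (λ t → trans (e t) (trans (p _) (eq t))) , λ _ → refl)
      , ⇝-resp {x′ ∘ₚ z′} {x″ ∘ₚ z′} {v′} {x″ ∘ₚ z′} (λ t → sym (q t)) (λ _ → refl) (⇝-push {x′} {x″} z′ kl lt″ e″)
    where
    S⁻ = supp-⁻¹ (R-supp B (R-sym B s))
    k<a : k < a
    k<a = <-≤-trans k<l (≤-pred l<1+a)
    kl : z′ ⁻¹ · k < z′ ⁻¹ · l
    kl with l <? a
    ... | yes l<a = subst₂ _<_ (sym (fix S⁻ k (inj₁ k<a))) (sym (fix S⁻ l (inj₁ l<a))) k<l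
    ... | no l≮a  = subst (_< z′ ⁻¹ · l) (sym (fix S⁻ k (inj₁ k<a))) (<-≤-trans k<a (supp-lo S⁻ (≮⇒≥ l≮a)))
  down {u} {v} {v′} (x , x′ , z , z′ , r , s , p , q) st | i , j , i<j , lt , e | lt′ | no i≮a =
    go (R-down B s (⇝-swap z i<j zj<zi))
    where
    a≤i = ≮⇒≥ i≮a
    zi≥ : a ≤ z · i
    zi≥ = supp-lo (R-supp B s) a≤i
    x-mono : ∀ {x x′} → R A x x′ → ∀ {k l} → a ≤ k → k < l → x · k < x · l
    x-mono {x} r {k} {l} a≤k k<l with m≤n⇒m<n∨m≡n a≤k
    ... | inj₁ a<k = subst₂ _<_ (sym (fix (R-supp A r) k (inj₂ a<k))) (sym (fix (R-supp A r) l (inj₂ (<-trans a<k k<l)))) k<l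
    ... | inj₂ refl = <-≤-trans (supp-hi (R-supp A r) (n<1+n a)) (subst (suc a ≤_) (sym (fix (R-supp A r) l (inj₂ k<l))) k<l)
    zj<zi : z · j < z · i
    zj<zi with <-cases {z · i} {z · j} (λ t → <-irrefl (inj z t) i<j)
    ... | inj₂ t = t
    ... | inj₁ t = ⊥-elim (<-asym lt′ (x-mono r zi≥ t))
    go : (∃ λ z″ → R B (z ∘ₚ tr i j) z″ × z′ ⇝ z″) → ∃ λ u′ → R₀ u u′ × v′ ⇝ u′
    go (z″ , s″ , (k , l , k<l , lt″ , e″)) with step-supp {x = z′} (R-supp B (R-sym B s″)) k<l lt″ e″
    ... | a≤k , _ = x′ ∘ₚ z″ , (x , x′ , z ∘ₚ tr i j , z″ , r , s″ , (λ t → trans (e t) (p _)) , λ _ → refl)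
        , (k , l , k<l , subst₂ _<_ (sym (q k)) (sym (q l)) (x-mono (R-sym A r) (supp-lo (R-supp B (R-sym B s)) a≤k) lt″)
          , λ t → trans (cong (x′ ·_) (e″ t)) (sym (q _)))

  glue : AntiRel 0 m (y ∘ₚ z₀)
  glue = record
    { R       = R₀
    ; R-start = idₚ , y , idₚ , z₀ , R-start A , R-start B , (λ _ → refl) , λ _ → refl
    ; R-sym   = λ (x , x′ , z , z′ , r , s , p , q) → x′ , x , z′ , z , R-sym A r , R-sym B s , q , p
    ; R-resp  = λ t₁ t₂ (x , x′ , z , z′ , r , s , p , q) →
        x , x′ , z , z′ , r , s , (λ i → trans (sym (t₁ i)) (p i)) , λ i → trans (sym (t₂ i)) (q i)
    ; R-fun   = λ {u} {u′} {v} {v′} → fun {u} {u′} {v} {v′}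
    ; R-supp  = λ {u} (x , x′ , z , z′ , r , s , p , q) → supp-≈ {u = x ∘ₚ z} {v = u} (λ i → sym (p i))
        (supp-∘ {u = x} {v = z} (supp-weaken {u = x} z≤n a<m (R-supp A r)) (supp-weaken {u = z} z≤n ≤-refl (R-supp B s)))
    ; R-down  = λ {u} {v} {v′} → down {u} {v} {v′}
    }

  glue-EquivR : ∀ {k} → EquivR B k → EquivR glue k
  glue-EquivR E (x , x′ , z , z′ , r , s , p , q) =
    x , x′ , z ∘ₚ tr _ _ , z′ ∘ₚ tr _ _ , r , E s , (λ i → p _) , λ i → q _

  glue-EquivL : ∀ {k} → a < k → EquivL B k → EquivL glue k
  glue-EquivL {k} a<k E {u} {u′} (x , x′ , z , z′ , r , s , p , q) =
    x , x′ , tr k (suc k) ∘ₚ z , tr k (suc k) ∘ₚ z′ , r , E s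
    , (λ i → trans (cong (trTo k (suc k)) (p i)) (sym (comm x (R-supp A r) _)))
    , λ i → trans (cong (trTo k (suc k)) (q i)) (sym (comm x′ (R-supp A (R-sym A r)) _))
    where
    comm : ∀ x → Supp 0 (suc a) x → ∀ i → x · (tr k (suc k) · i) ≡ tr k (suc k) · (x · i)
    comm x S = tr-commute x k (suc k) (fix S k (inj₂ a<k)) (fix S (suc k) (inj₂ (m≤n⇒m≤1+n a<k)))

glue₀ : ∀ {a m w} y z₀ → a < m → y ∘ₚ z₀ ≈ w → AntiRel 0 (suc a) y → (B : AntiRel a m z₀) →
        Σ (AntiRel 0 m w) λ C → (∀ k → EquivR B k → EquivR C k) × (∀ k → a < k → EquivL B k → EquivL C k)
glue₀ {a} {m} {w} y z₀ lt eq A B = respᴬ {0} {m} {y ∘ₚ z₀} {w} eq (Glue₀.glue {a} {m} {y} {z₀} lt A B)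
  , (λ k E {u} {u′} → Glue₀.glue-EquivR {a} {m} {y} {z₀} lt A B E {u} {u′})
  , λ k p E {u} {u′} → Glue₀.glue-EquivL {a} {m} {y} {z₀} lt A B p E {u} {u′}

-- Separates the two positions moved by the shared letter s_a from the later ones, which both x and
-- s_a fix.
data AtLeast (a : ℕ) : ℕ → Set where
  at₀  : AtLeast a a
  at₁ : AtLeast a (suc a)
  beyond : ∀ {p} → 2 + a ≤ p → AtLeast a p

atLeast : ∀ {a p} → a ≤ p → AtLeast a p
atLeast a≤p with m≤n⇒m<n∨m≡n a≤p
... | inj₂ refl = at₀
... | inj₁ a<p with m≤n⇒m<n∨m≡n a<p
... | inj₂ refl = at₁
... | inj₁ q = beyond q

-- Supports sharing the letter s = s_a: x z ↦ x′ s z w₀, which the substitution (x, z) ↦ (x s, s z) leaves unchanged.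
module Glue₁ {a m y} (2+a≤m : 2 + a ≤ m) (A : AntiRel 0 (2 + a) y) (E : EquivR A a) where

  s : Perm
  s = tr a (suc a)

  W : Perm
  W = w₀ a m

  s-inv : ∀ i → s · (s · i) ≡ i
  s-inv = trTo-inv a (suc a)

  W-inv : ∀ i → W · (W · i) ≡ i
  W-inv = rev-inv a m

  supp-s : Supp a m s
  supp-s = supp-tr ≤-refl (n≤1+n a) (<-trans (n<1+n a) 2+a≤m) 2+a≤m

  R₁ : Perm → Perm → Set
  R₁ u u′ = ∃₂ λ x x′ → ∃ λ z → R A x x′ × Supp a m z × u ≈ x ∘ₚ z × u′ ≈ x′ ∘ₚ s ∘ₚ z ∘ₚ W

  -- The step from x s up to x is sent to a step from x′ up to the partner of x s. Compatibility
  -- with s makes this partner x′ s, so the step can only be the swap of a and 1 + a.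
  desc : ∀ {x x′} → R A x x′ → x · suc a < x · a → x′ · a < x′ · suc a
  desc {x} {x′} r lt with R-down A {x ∘ₚ s} r (⇝-swap x (n<1+n a) lt)
  ... | x₃ , r₃ , (k , l , k<l , lt′ , eq)
    with tr-unique (n<1+n a) k<l (λ i → inj x′ (trans (sym (R-fun A r₃ (E r) (λ _ → refl) i)) (eq i)))
  ... | refl , refl = lt′

  asc : ∀ {x x′} → R A x x′ → x · a < x · suc a → x′ · suc a < x′ · a
  asc {x} {x′} r lt with <-cases {x′ · a} {x′ · suc a} (inj≢ x′ (<⇒≢ (n<1+n a)))
  ... | inj₂ p = p
  ... | inj₁ p = ⊥-elim (<-asym lt (subst₂ (λ k l → x · k < x · l) (trTo-l a (suc a)) (trTo-r a (suc a))
      (desc (E (R-sym A r)) (subst₂ (λ k l → x′ · k < x′ · l) (sym (trTo-r a (suc a))) (sym (trTo-l a (suc a))) p))))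

  s-beyond : ∀ {p} → 2 + a ≤ p → s · p ≡ p
  s-beyond le = trTo-o a (suc a) (λ e → <⇒≢ (<-trans (n<1+n a) le) (sym e)) (λ e → <⇒≢ le (sym e))

  -- On [a, ∞) the permutations x and x′ s induce the same order: beyond 1 + a nothing moves, and at
  -- a, 1 + a the order is reversed once in passing to x′ and once by s.
  order : ∀ {x x′} → R A x x′ → ∀ {p q} → a ≤ p → a ≤ q → x · q < x · p → x′ · (s · q) < x′ · (s · p)
  order {x} {x′} r {p} {q} a≤p a≤q lt = go (atLeast a≤p) (atLeast a≤q)
    where
    S = R-supp A r
    S′ = R-supp A (R-sym A r)
    small : ∀ {k} → k < 2 + a → 2 + a ≤ p → x′ · k < x′ · (s · p)
    small {k} k< le = subst (x′ · k <_) (sym (trans (cong (x′ ·_) (s-beyond le)) (fix S′ _ (inj₂ le)))) (<-≤-trans (supp-hi S′ k<) le)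
    large : p < 2 + a → 2 + a ≤ q → ⊥
    large p< le = <-asym lt (subst (x · p <_) (sym (fix S _ (inj₂ le))) (<-≤-trans (supp-hi S p<) le))
    go : AtLeast a p → AtLeast a q → x′ · (s · q) < x′ · (s · p)
    go (beyond u) (beyond v) = subst₂ _<_ (sym (trans (cong (x′ ·_) (s-beyond v)) (fix S′ _ (inj₂ v))))
        (sym (trans (cong (x′ ·_) (s-beyond u)) (fix S′ _ (inj₂ u)))) (subst₂ _<_ (fix S _ (inj₂ v)) (fix S _ (inj₂ u)) lt)
    go (beyond u) at₀  = small (subst (_< 2 + a) (sym (trTo-l a (suc a))) (n<1+n _)) u
    go (beyond u) at₁ = small (subst (_< 2 + a) (sym (trTo-r a (suc a))) (m≤n⇒m≤1+n (n<1+n a))) u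
    go at₀  (beyond v) = ⊥-elim (large (m≤n⇒m≤1+n (n<1+n a)) v)
    go at₁ (beyond v) = ⊥-elim (large (n<1+n _) v)
    go at₀  at₀  = ⊥-elim (<-irrefl refl lt)
    go at₁ at₁ = ⊥-elim (<-irrefl refl lt)
    go at₀  at₁ = subst₂ (λ k l → x′ · k < x′ · l) (sym (trTo-r a (suc a))) (sym (trTo-l a (suc a))) (desc r lt)
    go at₁ at₀  = subst₂ (λ k l → x′ · k < x′ · l) (sym (trTo-l a (suc a))) (sym (trTo-r a (suc a))) (asc r lt)

  -- Here τ = x₂⁻¹ x₁ = z₂ z₁⁻¹ lies in both windows, so it is the identity or s. In the second case
  -- `E` turns x₂ into x₂ s, and the extra s cancels in the image.
  fun : ∀ {u u′ v v′} → R₁ u u′ → R₁ v v′ → u ≈ v → u′ ≈ v′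
  fun {u} {u′} {v} {v′} (x₁ , x₁′ , z₁ , r₁ , s₁ , p₁ , q₁) (x₂ , x₂′ , z₂ , r₂ , s₂ , p₂ , q₂) eq i =
    trans (q₁ i) (trans (main i) (sym (q₂ i)))
    where
    xz : ∀ i → x₁ · (z₁ · i) ≡ x₂ · (z₂ · i)
    xz i = trans (sym (p₁ i)) (trans (eq i) (p₂ i))
    τ : Perm
    τ = x₂ ⁻¹ ∘ₚ x₁
    τz : ∀ i → τ · (z₁ · i) ≡ z₂ · i
    τz i = ⁻¹-swap x₂ (sym (xz i))
    Sτ : Supp 0 (2 + a) τ
    Sτ = supp-∘ {u = x₂ ⁻¹} {v = x₁} (supp-⁻¹ (R-supp A r₂)) (R-supp A r₁)
    τ-lo : ∀ {i} → i < a → τ · i ≡ i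
    τ-lo {i} p = trans (cong (τ ·_) (sym (fix s₁ i (inj₁ p)))) (trans (τz i) (fix s₂ i (inj₁ p)))
    τ-win : ∀ {i} → a ≤ i → a ≤ τ · i
    τ-win = supp-lo {m = 2 + a} {u = τ} (supp λ i → [ τ-lo , (λ p → fix Sτ i (inj₂ p)) ])
    main : x₁′ ∘ₚ s ∘ₚ z₁ ∘ₚ W ≈ x₂′ ∘ₚ s ∘ₚ z₂ ∘ₚ W
    main i = cases (atLeast (τ-win ≤-refl)) (atLeast (τ-win (n≤1+n a))) refl refl
      where
      cases : ∀ {b c} → AtLeast a b → AtLeast a c → τ · a ≡ b → τ · suc a ≡ c →
              x₁′ · (s · (z₁ · (W · i))) ≡ x₂′ · (s · (z₂ · (W · i)))
      cases (beyond b≥) _ ea _ = ⊥-elim (<⇒≱ (subst (_< 2 + a) ea (supp-hi Sτ (m≤n⇒m≤1+n (n<1+n a)))) b≥)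
      cases _ (beyond c≥) _ ec = ⊥-elim (<⇒≱ (subst (_< 2 + a) ec (supp-hi Sτ (n<1+n _))) c≥)
      cases at₀ at₀ ea ec = ⊥-elim (inj≢ τ (<⇒≢ (n<1+n a)) (trans ea (sym ec)))
      cases at₁ at₁ ea ec = ⊥-elim (inj≢ τ (<⇒≢ (n<1+n a)) (trans ea (sym ec)))
      cases at₀ at₁ ea ec =
        trans (R-fun A r₁ r₂ x≈ _) (cong (λ t → x₂′ · (s · t)) (trans (sym (τ-id _)) (τz _)))
        where
        τ-id : ∀ i → τ · i ≡ i
        τ-id i with i <? a
        ... | yes p = τ-lo p
        ... | no p with atLeast (≮⇒≥ p)
        ... | at₀ = ea
        ... | at₁ = ec
        ... | beyond q = fix Sτ i (inj₂ q)
        x≈ : x₁ ≈ x₂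
        x≈ i = trans (sym (to-from x₂ _)) (cong (x₂ ·_) (τ-id i))
      cases at₁ at₀ ea ec =
        trans (R-fun A r₁ (E r₂) x≈ (s · (z₁ · (W · i))))
          (cong (λ t → x₂′ · (s · t)) (trans (sym (τ-s (z₁ · (W · i)))) (τz (W · i))))
        where
        τ-s : ∀ i → τ · i ≡ s · i
        τ-s i with i <? a
        ... | yes p = trans (τ-lo p) (sym (fix supp-s i (inj₁ p)))
        ... | no p with atLeast (≮⇒≥ p)
        ... | at₀ = trans ea (sym (trTo-l a (suc a)))
        ... | at₁ = trans ec (sym (trTo-r a (suc a)))
        ... | beyond q = trans (fix Sτ i (inj₂ q)) (sym (s-beyond q))
        x≈ : x₁ ≈ x₂ ∘ₚ s
        x≈ i = trans (sym (to-from x₂ _)) (cong (x₂ ·_) (τ-s i))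

  down : ∀ {u v v′} → Supp 0 m v → R₁ v v′ → u ⇝ v → ∃ λ u′ → R₁ u u′ × v′ ⇝ u′
  down {u} {v} {v′} Sv (x , x′ , z , r , S , p , q) st with ⇝-lower {u} {v} st
  ... | i , j , i<j , lt , e with subst₂ _<_ (p j) (p i) lt | i <? a
  ... | lt′ | no i≮a = x′ ∘ₚ s ∘ₚ z ∘ₚ tr i j ∘ₚ W
      , (x , x′ , z ∘ₚ tr i j , r
          , supp-∘ {u = z} {v = tr i j} S (supp-tr a≤i a≤j (<-trans i<j j<m) j<m)
          , (λ t → trans (e t) (p _)) , λ _ → refl)
      -- The factor W reverses the window, so the entries formerly at i < j now stand at W j < W i.
      , (W · j , W · i , w₀-anti a≤i i<j j<m
        , subst₂ _<_ (sym (at j)) (sym (at i)) (order r (supp-lo S a≤i) (supp-lo S a≤j) lt′)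
        , λ t → trans (cong (λ k → x′ · (s · (z · k))) (eq t)) (sym (q _)))
    where
    a≤i = ≮⇒≥ i≮a
    a≤j = ≤-trans a≤i (<⇒≤ i<j)
    j<m : j < m
    j<m = proj₂ (supp-inversion Sv i<j lt)
    at : ∀ k → v′ · (W · k) ≡ x′ · (s · (z · k))
    at k = trans (q _) (cong (λ l → x′ · (s · (z · l))) (W-inv k))
    eq : ∀ t → tr i j · (W · t) ≡ W · (tr (W · j) (W · i) · t)
    eq t = trans (cong (λ k → trTo i j (W · k)) (sym (W-inv t)))
         (trans (cong (trTo i j) (W-inv _)) (trans (tr-comm i j (W · t)) (trans (sym (W-inv _))
           (cong (W ·_) (trans (tr-conj W j i (W · t)) (cong (trTo (W · j) (W · i)) (W-inv t)))))))
  ... | lt′ | yes i<a with lower-left {x = x} {z} S i<j i<a lt′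
  ... | i<zj , st′ , eq with R-down A {x ∘ₚ tr i (z · j)} r st′
  ... | x″ , r″ , (k , l , k<l , lt″ , e″) with step-supp {x = x′} (R-supp A (R-sym A r″)) k<l lt″ e″
  ... | _ , l<2+a = x″ ∘ₚ s ∘ₚ z ∘ₚ W , (_ , x″ , z , r″ , S , (λ t → trans (e t) (trans (p _) (eq t))) , λ _ → refl)
      , ⇝-resp {x′ ∘ₚ ρ} {x″ ∘ₚ ρ} {v′} {x″ ∘ₚ ρ} (λ t → sym (q t)) (λ _ → refl) (⇝-push {x′} {x″} ρ kl lt″ e″)
    where
    ρ = s ∘ₚ z ∘ₚ W
    S⁻ : Supp a m (ρ ⁻¹)
    S⁻ = supp-⁻¹ (supp-∘ {u = s} {v = z ∘ₚ W} supp-s (supp-∘ {u = z} {v = W} S (supp-w₀ a m)))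
    k<a : k < a
    k<a with k <? a
    ... | yes t = t
    -- Otherwise the image step swaps a and 1 + a, so it is multiplication by s. By `E` the original
    -- step is then multiplication by s as well, which contradicts i < a.
    ... | no t with tr-unique i<zj (n<1+n a) (λ t → inj x (R-fun A (R-sym A r″) (E (R-sym A r)) x″≈ t))
      where
      k≡a : k ≡ a
      k≡a = ≤-antisym (≤-pred (<-≤-trans k<l (≤-pred l<2+a))) (≮⇒≥ t)
      l≡1+a : l ≡ suc a
      l≡1+a = ≤-antisym (≤-pred l<2+a) (subst (_< l) k≡a k<l)
      x″≈ : x″ ≈ x′ ∘ₚ s
      x″≈ t = trans (e″ t) (cong₂ (λ b c → x′ · trTo b c t) k≡a l≡1+a)
    ... | i≡a , _ = ⊥-elim (<-irrefl i≡a i<a)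
    kl : ρ ⁻¹ · k < ρ ⁻¹ · l
    kl with l <? a
    ... | yes l<a = subst₂ _<_ (sym (fix S⁻ k (inj₁ k<a))) (sym (fix S⁻ l (inj₁ l<a))) k<l
    ... | no l≮a  = subst (_< ρ ⁻¹ · l) (sym (fix S⁻ k (inj₁ k<a))) (<-≤-trans k<a (supp-lo S⁻ (≮⇒≥ l≮a)))

  R₁-supp : ∀ {u u′} → R₁ u u′ → Supp 0 m u
  R₁-supp {u} (x , x′ , z , r , S , p , q) = supp-≈ {u = x ∘ₚ z} {v = u} (λ i → sym (p i))
    (supp-∘ {u = x} {v = z} (supp-weaken {u = x} z≤n 2+a≤m (R-supp A r)) (supp-weaken {u = z} z≤n ≤-refl S))

  glue : AntiRel 0 m (y ∘ₚ tr a (suc a) ∘ₚ w₀ a m)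
  glue = record
    { R       = R₁
    ; R-start = idₚ , y , idₚ , R-start A , supp (λ _ _ → refl) , (λ _ → refl) , λ _ → refl
    ; R-sym   = λ (x , x′ , z , r , S , p , q) → x′ , x , s ∘ₚ z ∘ₚ W , R-sym A r
        , supp-∘ {u = s} {v = z ∘ₚ W} supp-s (supp-∘ {u = z} {v = W} S (supp-w₀ a m)) , q
        , λ i → trans (p i) (cong (x ·_) (trans (cong (z ·_) (sym (W-inv i))) (sym (s-inv _))))
    ; R-resp  = λ t₁ t₂ (x , x′ , z , r , S , p , q) →
        x , x′ , z , r , S , (λ i → trans (sym (t₁ i)) (p i)) , λ i → trans (sym (t₂ i)) (q i)
    ; R-fun   = λ {u} {u′} {v} {v′} → fun {u} {u′} {v} {v′}
    ; R-supp  = λ {u} {u′} → R₁-supp {u} {u′}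
    ; R-down  = λ {u} {v} {v′} r → down {u} {v} {v′} (R₁-supp {v} {v′} r) r
    }

  glue-EquivL : ∀ {k} → 2 + a ≤ k → suc k < m → EquivL glue k
  glue-EquivL {k} le k<m (x , x′ , z , r , S , p , q) =
    x , x′ , σ ∘ₚ z , r , supp-∘ {u = σ} {v = z} (supp-tr a≤k (m≤n⇒m≤1+n a≤k) (<-trans (n<1+n k) k<m) k<m) S
    , (λ i → trans (cong (σ ·_) (p i)) (sym (comm x (R-supp A r) _)))
    , λ i → trans (cong (σ ·_) (q i)) (trans (sym (comm x′ (R-supp A (R-sym A r)) (s · (z · (W · i)))))
        (cong (x′ ·_) (sym (tr-commute s k (suc k) (s-beyond le) (s-beyond (m≤n⇒m≤1+n le)) (z · (W · i))))))
    where
    σ = tr k (suc k)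
    a≤k : a ≤ k
    a≤k = ≤-trans (m≤n+m a 2) le
    comm : ∀ x → Supp 0 (2 + a) x → ∀ i → x · (σ · i) ≡ σ · (x · i)
    comm x S = tr-commute x k (suc k) (fix S k (inj₂ le)) (fix S (suc k) (inj₂ (m≤n⇒m≤1+n le)))

glue₁ : ∀ {a m w} y → 2 + a ≤ m → y ∘ₚ tr a (suc a) ∘ₚ w₀ a m ≈ w → (A : AntiRel 0 (2 + a) y) → EquivR A a →
        Σ (AntiRel 0 m w) λ B → ∀ k → 2 + a ≤ k → suc k < m → EquivL B k
glue₁ {a} {m} {w} y le eq A E = respᴬ {0} {m} {y ∘ₚ tr a (suc a) ∘ₚ w₀ a m} {w} eq (Glue₁.glue {a} {m} {y} le A E)
  , λ k p q {u} {u′} → Glue₁.glue-EquivL {a} {m} {y} le A E p q {u} {u′}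

-- Polished permutations

record Polished (w : Perm) : Set where
  field
    no3412  : ∀ {i j k l} → i < j → j < k → k < l →
             w · k < w · l → w · l < w · i → w · i < w · j → ⊥
    no4231  : ∀ {i j k l} → i < j → j < k → k < l →
             w · l < w · j → w · j < w · k → w · k < w · i → ⊥
    no34521 : ∀ {i j k l m} → i < j → j < k → k < l → l < m →
             w · m < w · l → w · l < w · i → w · i < w · j → w · j < w · k → ⊥
    no54123 : ∀ {i j k l m} → i < j → j < k → k < l → l < m →
             w · k < w · l → w · l < w · m → w · m < w · j → w · j < w · i → ⊥
    no45321 : ∀ {i j k l m} → i < j → j < k → k < l → l < m →
             w · m < w · l → w · l < w · k → w · k < w · i → w · i < w · j → ⊥
    no54312 : ∀ {i j k l m} → i < j → j < k → k < l → l < m →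
             w · l < w · m → w · m < w · k → w · k < w · j → w · j < w · i → ⊥

open Polished

-- The patterns 3412 and 4231 are involutions; inversion exchanges 34521 with 54123 and 45321 with
-- 54312.
polished-⁻¹ : ∀ {w} → Polished w → Polished (w ⁻¹)
polished-⁻¹ {w} V = record
  { no3412  = λ p q r s t u → no3412 V s t u (val p) (val q) (val r)
  ; no4231  = λ p q r s t u → no4231 V s t u (val p) (val q) (val r)
  ; no34521 = λ p q r s t u x y → no54123 V t u x y (val p) (val q) (val r) (val s)
  ; no54123 = λ p q r s t u x y → no34521 V t u x y (val p) (val q) (val r) (val s)
  ; no45321 = λ p q r s t u x y → no54312 V t u x y (val p) (val q) (val r) (val s)
  ; no54312 = λ p q r s t u x y → no45321 V t u x y (val p) (val q) (val r) (val s)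
  }
  where
  val : ∀ {i j} → i < j → w · (w ⁻¹ · i) < w · (w ⁻¹ · j)
  val {i} {j} = subst₂ _<_ (sym (to-from w i)) (sym (to-from w j))

-- ι carries a pattern of w ∘ ι to the same pattern of w. It has to be increasing only on [0, b),
-- because the last position of each of the six patterns ends an inversion and therefore lies below
-- b.
polished-embed : ∀ {w ι b} → Polished w → (∀ {i j} → i < j → j < b → ι · i < ι · j) →
                 Supp 0 b (w ∘ₚ ι) → Polished (w ∘ₚ ι)
polished-embed {w} {ι} {b} V mono S = record
  { no3412  = λ p q r s t u → let l< = bd (<-trans (<-trans p q) r) t ; k< = <-trans r l< ; j< = <-trans q k< in
             no3412 V (mono p j<) (mono q k<) (mono r l<) s t u
  ; no4231  = λ p q r s t u → let l< = bd (<-trans q r) s ; k< = <-trans r l< ; j< = <-trans q k< in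
             no4231 V (mono p j<) (mono q k<) (mono r l<) s t u
  ; no34521 = λ p q r o s t u x → let m< = bd o s ; l< = <-trans o m< ; k< = <-trans r l< ; j< = <-trans q k< in
             no34521 V (mono p j<) (mono q k<) (mono r l<) (mono o m<) s t u x
  ; no54123 = λ p q r o s t u x → let m< = bd (<-trans q (<-trans r o)) u ; l< = <-trans o m< ; k< = <-trans r l< ; j< = <-trans q k< in
             no54123 V (mono p j<) (mono q k<) (mono r l<) (mono o m<) s t u x
  ; no45321 = λ p q r o s t u x → let m< = bd o s ; l< = <-trans o m< ; k< = <-trans r l< ; j< = <-trans q k< in
             no45321 V (mono p j<) (mono q k<) (mono r l<) (mono o m<) s t u x
  ; no54312 = λ p q r o s t u x → let m< = bd (<-trans r o) t ; l< = <-trans o m< ; k< = <-trans r l< ; j< = <-trans q k< in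
             no54312 V (mono p j<) (mono q k<) (mono r l<) (mono o m<) s t u x
  }
  where
  bd : ∀ {i j} → i < j → w · (ι · j) < w · (ι · i) → j < b
  bd p q = proj₂ (supp-inversion S p q)

-- The values at positions w⁻¹ M, …, M stay above w M; together with the absence of 4231 they then decrease.
TailAbove : Perm → ℕ → Set
TailAbove w M = ∀ i → w ⁻¹ · M < i → i < M → w · M < w · i

-- Suppose that some entry at i, between the positions w⁻¹ M and M, lies below w M. A value c
-- between w M and M standing before w⁻¹ M would then form 3412 at w⁻¹ c, w⁻¹ M, i, M, so the
-- inverse has the property instead.
tail-dichotomy : ∀ {w M} → Polished w → w · M ≢ M → w ⁻¹ · M < M → TailAbove w M ⊎ TailAbove (w ⁻¹) M
tail-dichotomy {w} {M} V wM≢ a<M with anyUpTo? (λ i → (w ⁻¹ · M <? i) ×-dec (w · i <? w · M)) M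
... | no ¬p = inj₁ above
  where
  above : TailAbove w M
  above i a<i i<M with <-cases {w · M} {w · i} (inj≢ w (λ e → <⇒≢ i<M (sym e)))
  ... | inj₁ p = p
  ... | inj₂ p = ⊥-elim (¬p (i , i<M , a<i , p))
... | yes (i , i<M , a<i , wi<) = inj₂ above
  where
  above : TailAbove (w ⁻¹) M
  above c b<c c<M with <-cases {w ⁻¹ · M} {w ⁻¹ · c} (inj≢ (w ⁻¹) (λ e → <⇒≢ c<M (sym e)))
  ... | inj₁ p = p
  ... | inj₂ p = ⊥-elim (no3412 V p a<i i<M wi< (subst (w · M <_) (sym (to-from w c)) b<c)
                   (subst₂ _<_ (sym (to-from w c)) (sym (to-from w M)) c<M))

module Tail {w M′} (S : Supp 0 (2 + M′) w) (V : Polished w) (wM≢ : w · suc M′ ≢ suc M′)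
            (above : TailAbove w (suc M′)) where

  M : ℕ
  M = suc M′

  a : ℕ
  a = w ⁻¹ · M

  wa : w · a ≡ M
  wa = to-from w M

  a<M : a < M
  a<M = ≤∧≢⇒< (≤-pred (supp-hi (supp-⁻¹ S) (n<1+n M))) (λ e → wM≢ (trans (cong (w ·_) (sym e)) wa))

  a≤M′ : a ≤ M′
  a≤M′ = ≤-pred a<M

  below-top : ∀ {i} → i ≢ a → i ≤ M → w · i < M
  below-top {i} i≢a i≤M = ≤∧≢⇒< (≤-pred (supp-hi S (s≤s i≤M))) (λ e → i≢a (inj w (trans e (sym wa))))

  decreasing : ∀ {i j} → a ≤ i → i < j → j ≤ M → w · j < w · i
  decreasing {i} {j} a≤i i<j j≤M with m≤n⇒m<n∨m≡n a≤i
  ... | inj₂ refl = subst (w · j <_) (sym wa) (below-top (λ e → <⇒≢ i<j (sym e)) j≤M)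
  ... | inj₁ a<i with m≤n⇒m<n∨m≡n j≤M
  ... | inj₂ refl = above _ a<i i<j
  ... | inj₁ j<M with <-cases {w · i} {w · j} (inj≢ w (<⇒≢ i<j))
  ... | inj₂ p = p
  ... | inj₁ p = ⊥-elim (no4231 V a<i i<j j<M (above _ a<i (<-trans i<j j<M)) p
                   (subst (w · j <_) (sym wa) (below-top (λ e → <⇒≢ (<-trans a<i i<j) (sym e)) j≤M)))

  -- A missing value c in the run M, M-1, … starting at a sits before a and completes a 45321.
  ladder : ∀ d → a + d < M′ → w · (a + d) + d ≡ M
  ladder zero _ = trans (+-identityʳ _) (trans (cong (w ·_) (+-identityʳ a)) wa)
  ladder (suc d) i<M′ = conclude (m≤n⇒m<n∨m≡n wi<)
    where
    i c x : ℕ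
    i = a + suc d
    c = suc (w · i)
    x = w ⁻¹ · c
    wx : w · x ≡ c
    wx = to-from w c
    i≡ : i ≡ suc (a + d)
    i≡ = +-suc a d
    a<i : a < i
    a<i = subst (a <_) (sym i≡) (s≤s (m≤m+n a d))
    wi< : c ≤ w · (a + d)
    wi< = decreasing (m≤m+n a d) (subst (a + d <_) (sym i≡) (n<1+n _)) (<⇒≤ (<-trans i<M′ (n<1+n M′)))
    IH : w · (a + d) + d ≡ M
    IH = ladder d (<-trans (subst (a + d <_) (sym i≡) (n<1+n _)) i<M′)
    impossible : c < w · (a + d) → ⊥
    impossible c< with x <? a
    ... | yes x<a = no45321 V x<a a<i i<M′ (n<1+n M′)
            (decreasing a≤M′ (n<1+n M′) ≤-refl)
            (decreasing (<⇒≤ a<i) i<M′ (n≤1+n M′))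
            (subst (w · i <_) (sym wx) (n<1+n _))
            (subst₂ _<_ (sym wx) (sym wa) (<-≤-trans c< (m+n≤o⇒m≤o (w · (a + d)) (≤-reflexive IH))))
    ... | no x≮a with <-cmp x i
    ... | tri≈ _ e _ = <⇒≢ (n<1+n (w · i)) (trans (cong (w ·_) (sym e)) wx)
    ... | tri> _ _ i<x = <-asym (n<1+n (w · i)) (subst (_< w · i) wx (decreasing (<⇒≤ a<i) i<x x≤M))
      where
      x≤M : x ≤ M
      x≤M = ≤-pred (supp-hi (supp-⁻¹ S) (<-trans c< (supp-hi S (<-trans (subst (a + d <_) (sym i≡) (n<1+n _)) (<-trans i<M′ (<-trans (n<1+n _) (n<1+n _)))))))
    ... | tri< x<i _ _ with m≤n⇒m<n∨m≡n (≤-pred (subst (x <_) i≡ x<i))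
    ... | inj₂ e = <⇒≢ c< (trans (sym wx) (cong (w ·_) e))
    ... | inj₁ x< = <-asym c< (subst (w · (a + d) <_) wx (decreasing (≮⇒≥ x≮a) x< (<⇒≤ (<-trans (subst (a + d <_) (sym i≡) (n<1+n _)) (<-trans i<M′ (n<1+n M′))))))
    conclude : c < w · (a + d) ⊎ c ≡ w · (a + d) → w · i + suc d ≡ M
    conclude (inj₁ p) = ⊥-elim (impossible p)
    conclude (inj₂ e) = trans (+-suc (w · i) d) (trans (cong (_+ d) e) IH)

  ladder′ : ∀ {i} → a ≤ i → i < M′ → w · i + i ≡ a + M
  ladder′ {i} a≤i i<M′ = trans (cong (w · i +_) (sym a+d≡i)) (trans (cong (_+ (a + d)) (cong (w ·_) (sym a+d≡i)))
      (trans (cong (w · (a + d) +_) (+-comm a d)) (trans (sym (+-assoc _ d a)) (trans (cong (_+ a) (ladder d (subst (_< M′) (sym a+d≡i) i<M′))) (+-comm M a)))))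
    where
    d = i ∸ a
    a+d≡i : a + d ≡ i
    a+d≡i = m+[n∸m]≡n a≤i

  W : Perm
  W = w₀ a (suc M)

  s : Perm
  s = tr a (suc a)

  W-sum : ∀ {i} → a ≤ i → i ≤ M → W · i + i ≡ a + M
  W-sum {i} a≤i i≤M = suc-injective (trans (sym (+-suc (W · i) i)) (trans (cong (_+ suc i) (rev-in a≤i (s≤s i≤M)))
      (trans (m∸n+n≡m (≤-trans (s≤s i≤M) (m≤n+m (suc M) a))) (+-suc a M))))

  W-a : W · a ≡ M
  W-a = +-cancelʳ-≡ a (W · a) M (trans (W-sum ≤-refl (<⇒≤ a<M)) (+-comm a M))

  W-1+a : W · suc a ≡ M′
  W-1+a = +-cancelʳ-≡ (suc a) (W · suc a) M′ (trans (W-sum (n≤1+n a) a<M) (trans (+-suc a M′) (trans (cong suc (+-comm a M′)) (sym (+-suc M′ a)))))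

  W-undo : w ∘ₚ W ∘ₚ W ≈ w
  W-undo i = cong (w ·_) (rev-inv a (suc M) i)

  -- The hypothesis prolongs the run of consecutive values to M′, so w agrees with the involution W
  -- on [a, M). W maps (a, M] into that range.
  fits₁ : w · M′ ≡ suc a → Supp 0 (suc a) (w ∘ₚ W)
  fits₁ e = supp fixes
    where
    full : ∀ {i} → a ≤ i → i < M → w · i + i ≡ a + M
    full {i} a≤i i<M with m≤n⇒m<n∨m≡n (≤-pred i<M)
    ... | inj₁ p = ladder′ a≤i p
    ... | inj₂ refl = trans (cong (_+ M′) e) (sym (+-suc a M′))
    fixes : ∀ i → (i < 0 ⊎ suc a ≤ i) → w · (W · i) ≡ i
    fixes i (inj₂ a<i) with i ≤? M
    ... | no p = trans (cong (w ·_) (rev-out {a} {suc M} i (inj₂ (≰⇒> p)))) (fix S i (inj₂ (≰⇒> p)))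
    ... | yes i≤M = +-cancelʳ-≡ (W · i) _ _ (trans (full W≥ W<) (trans (sym (W-sum (<⇒≤ a<i) i≤M)) (+-comm _ i)))
      where
      W≥ : a ≤ W · i
      W≥ = supp-lo (supp-w₀ a (suc M)) (<⇒≤ a<i)
      W< : W · i < M
      W< = subst (W · i <_) W-a (w₀-anti ≤-refl a<i (s≤s i≤M))

  -- W carries the positions 0, ..., a to 0, ..., a - 1, M, so w ∘ W shows the entries of w at these
  -- positions in their old order and inherits all avoidances.
  mono₁ : ∀ {i j} → i < j → j < suc a → W · i < W · j
  mono₁ {i} {j} i<j j≤a = subst (_< W · j) (sym (rev-out i (inj₁ i<a))) (go (m≤n⇒m<n∨m≡n (≤-pred j≤a)))
    where
    i<a = <-≤-trans i<j (≤-pred j≤a)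
    go : j < a ⊎ j ≡ a → i < W · j
    go (inj₁ j<a) = subst (i <_) (sym (rev-out j (inj₁ j<a))) i<j
    go (inj₂ refl) = subst (i <_) (sym W-a) (<-trans i<a a<M)

  module _ (e : w · M′ ≢ suc a) where

    a<M′ : a < M′
    a<M′ = ≤∧≢⇒< a≤M′ (λ p → e (trans (cong (w ·_) (sym p)) (trans wa (cong suc (sym p)))))

    -- In w ∘ W the positions a, 1 + a carry w M, w M′. The factor s restores their order in w, so y
    -- again consists of entries of w in increasing positions, now 0, ..., a - 1, M′, M.
    y : Perm
    y = w ∘ₚ W ∘ₚ s

    y-a : y · a ≡ w · M′
    y-a = cong (w ·_) (trans (cong (W ·_) (trTo-l a (suc a))) W-1+a)

    y-1+a : y · suc a ≡ w · M
    y-1+a = cong (w ·_) (trans (cong (W ·_) (trTo-r a (suc a))) W-a)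

    y-low : ∀ {i} → i < a → y · i ≡ w · i
    y-low {i} i<a = cong (w ·_) (trans (cong (W ·_) (trTo-o a (suc a) (<⇒≢ i<a) (<⇒≢ (m≤n⇒m≤1+n i<a)))) (rev-out i (inj₁ i<a)))

    undo₂ : y ∘ₚ s ∘ₚ W ≈ w
    undo₂ i = trans (cong (λ t → w · (W · t)) (trTo-inv a (suc a) (W · i))) (W-undo i)

    fits₂ : Supp 0 (2 + a) y
    fits₂ = supp fixes
      where
      fixes : ∀ i → (i < 0 ⊎ 2 + a ≤ i) → y · i ≡ i
      fixes i (inj₂ le) with i ≤? M | trTo-o a (suc a) {i} (λ e → <⇒≢ (<-trans (n<1+n a) le) (sym e)) (λ e → <⇒≢ le (sym e))
      ... | no p | si = trans (cong (λ t → w · (W · t)) si) (trans (cong (w ·_) (rev-out {a} {suc M} i (inj₂ (≰⇒> p)))) (fix S i (inj₂ (≰⇒> p))))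
      ... | yes i≤M | si = trans (cong (λ t → w · (W · t)) si)
              (+-cancelʳ-≡ (W · i) _ _ (trans (ladder′ W≥ W<) (trans (sym (W-sum a≤i i≤M)) (+-comm _ i))))
        where
        a≤i = ≤-trans (m≤n+m a 2) le
        W≥ : a ≤ W · i
        W≥ = supp-lo (supp-w₀ a (suc M)) a≤i
        W< : W · i < M′
        W< = subst (W · i <_) W-1+a (w₀-anti (n≤1+n a) le (s≤s i≤M))

    mono₂ : ∀ {i j} → i < j → j < 2 + a → (W ∘ₚ s) · i < (W ∘ₚ s) · j
    mono₂ {i} {j} i<j j< with i <? a
    ... | no p = subst₂ (λ k l → (W ∘ₚ s) · k < (W ∘ₚ s) · l) (sym i≡) (sym j≡)
             (subst₂ _<_ (sym (trans (cong (W ·_) (trTo-l a (suc a))) W-1+a)) (sym (trans (cong (W ·_) (trTo-r a (suc a))) W-a)) (n<1+n M′))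
      where
      i≡ : i ≡ a
      i≡ = ≤-antisym (≤-pred (<-≤-trans i<j (≤-pred j<))) (≮⇒≥ p)
      j≡ : j ≡ suc a
      j≡ = ≤-antisym (≤-pred j<) (subst (_< j) i≡ i<j)
    ... | yes i<a = subst (_< (W ∘ₚ s) · j) (sym (trans (cong (W ·_) (trTo-o a (suc a) (<⇒≢ i<a) (<⇒≢ (m≤n⇒m≤1+n i<a)))) (rev-out i (inj₁ i<a)))) (go (j <? a))
      where
      go : Dec (j < a) → i < (W ∘ₚ s) · j
      go (yes j<a) = subst (i <_) (sym (trans (cong (W ·_) (trTo-o a (suc a) (<⇒≢ j<a) (<⇒≢ (m≤n⇒m≤1+n j<a)))) (rev-out j (inj₁ j<a)))) i<j
      go (no j≮a) = <-≤-trans i<a (supp-lo (supp-∘ {u = W} {v = s} (supp-w₀ a (suc M)) (supp-tr ≤-refl (n≤1+n a) (s≤s (<⇒≤ a<M)) (s≤s a<M))) (≮⇒≥ j≮a))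

    descent₂ : y · suc a < y · a
    descent₂ = subst₂ _<_ (sym y-1+a) (sym y-a) (decreasing a≤M′ (n<1+n M′) ≤-refl)

    not-fixed₂ : y · a ≢ suc a
    not-fixed₂ p = e (trans (sym y-a) p)

    -- Since w a = M exceeds the entries at i and j while w M lies below w M′ = y a, the positions
    -- i, j, a, M′, M would carry 34521.
    no-342₂ : ∀ {i j} → i < j → j < a → y · a < y · i → y · i < y · j → ⊥
    no-342₂ {i} {j} i<j j<a p q = no34521 V i<j j<a a<M′ (n<1+n M′)
      (decreasing a≤M′ (n<1+n M′) ≤-refl)
      (subst₂ _<_ y-a (y-low (<-trans i<j j<a)) p)
      (subst₂ _<_ (y-low (<-trans i<j j<a)) (y-low j<a) q)
      (subst (w · j <_) (sym wa) (below-top (<⇒≢ j<a) (<⇒≤ (<-trans j<a a<M))))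

    -- The positions a, ..., M′ - 1 carry the values from M down to 2 + a. The position M′ does not
    -- carry 1 + a by hypothesis, and neither does M, because w M lies below w M′, which is at most
    -- 1 + a.
    gap : w ⁻¹ · suc a < a
    gap with w ⁻¹ · suc a <? a
    ... | yes p = p
    ... | no p = ⊥-elim (go (<-cmp (w ⁻¹ · suc a) M′))
      where
      x = w ⁻¹ · suc a
      wx : w · x ≡ suc a
      wx = to-from w (suc a)
      wM′< : w · M′ < 2 + a
      wM′< = subst (_< 2 + a) y-a (supp-hi fits₂ (m≤n⇒m≤1+n (n<1+n a)))
      go : Tri (x < M′) (x ≡ M′) (M′ < x) → ⊥
      go (tri< x<M′ _ _) = <⇒≢ x<M′ (+-cancelˡ-≡ (suc a) _ _ (trans (cong (_+ x) (sym wx)) (trans (ladder′ (≮⇒≥ p) x<M′) (+-suc a M′))))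
      go (tri≈ _ q _) = e (trans (cong (w ·_) (sym q)) wx)
      go (tri> _ _ q) = <-irrefl refl (<-≤-trans (subst (_< w · M′) wx (decreasing a≤M′ q x≤M)) (≤-pred wM′<))
        where
        x≤M : x ≤ M
        x≤M = ≤-pred (supp-hi (supp-⁻¹ S) (s≤s a<M))

-- Gluing windows by induction on the size of the support

⁻¹-below : ∀ {M w} → Supp 0 (suc M) w → w · M ≢ M → w ⁻¹ · M < M
⁻¹-below {M} {w} S ne = ≤∧≢⇒< (≤-pred (supp-hi (supp-⁻¹ S) (n<1+n M))) (λ e → ne (⁻¹-swap (w ⁻¹) e))

⁻¹-moves : ∀ {M w} → w · M ≢ M → w ⁻¹ · M ≢ M
⁻¹-moves {w = w} ne e = ne (⁻¹-swap (w ⁻¹) e)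

-- EquivDualisable is needed when a further window is glued at k: then (.. n .. y k, y (1 + k)) still avoids 34521,
-- which is the last hypothesis on y.
Dualisable EquivDualisable : ℕ → Set₁
Dualisable f = ∀ m w → m ≤ f → Supp 0 m w → Polished w → AntiRel 0 m w
EquivDualisable f = ∀ k y → 2 + k ≤ f → Supp 0 (2 + k) y → Polished y → y · suc k < y · k → y · k ≢ suc k →
  (∀ {i j} → i < j → j < k → y · k < y · i → y · i < y · j → ⊥) →
  Σ (AntiRel 0 (2 + k) y) λ A → EquivR A k

module _ {f} (D : Dualisable f) (ED : EquivDualisable f) where

  -- Whether the earlier factor shares a letter with the window depends on whether the run of
  -- consecutive values reaches M′. Left multiplication by s_k has to commute with the earlier
  -- factor, which moves positions up to a if no letter is shared and up to 1 + a otherwise; the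
  -- last condition on k reflects this.
  fromTail : ∀ M′ w → suc M′ ≤ f → Supp 0 (2 + M′) w → Polished w → w · suc M′ ≢ suc M′ → TailAbove w (suc M′) →
             Σ (AntiRel 0 (2 + M′) w) λ A → ∀ {k} → w ⁻¹ · suc M′ < k → suc k < 2 + M′ →
               (w · M′ ≢ suc (w ⁻¹ · suc M′) → 2 + w ⁻¹ · suc M′ ≤ k) → EquivL A k
  fromTail M′ w le S V ne t with w · M′ ≟ suc (w ⁻¹ · suc M′)
  ... | yes e = proj₁ C , λ {k} a<k k< _ {u} {u′} → proj₂ (proj₂ C) k a<k
        (λ {z} {z′} → rightW₀-EquivL {Tail.a S V ne t} {2 + M′} {k} (<⇒≤ a<k) k< {z} {z′}) {u} {u′}
    where
    open Tail S V ne t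
    C = glue₀ {w = w} (w ∘ₚ W) W (m≤n⇒m≤1+n a<M) W-undo
          (D _ (w ∘ₚ W) (≤-trans a<M le) (fits₁ e) (polished-embed {w} {W} V mono₁ (fits₁ e))) (rightW₀ a (2 + M′))
  ... | no e = proj₁ C , λ {k} _ k< h {u} {u′} → proj₂ C k (h e) k< {u} {u′}
    where
    open Tail S V ne t
    Rᵧ : Σ (AntiRel 0 (2 + a) (y e)) λ A → EquivR A a
    Rᵧ = ED a (y e) (≤-trans (s≤s (a<M′ e)) le) (fits₂ e) (polished-embed {w} {W ∘ₚ s} V (mono₂ e) (fits₂ e))
          (descent₂ e) (not-fixed₂ e) (no-342₂ e)
    C = glue₁ {w = w} (y e) (s≤s a<M) (undo₂ e) (proj₁ Rᵧ) (proj₂ Rᵧ)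

  dualisable-suc : Dualisable (suc f)
  dualisable-suc zero w _ S _ =
    respᴬ {w = w₀ 0 0} {v = w} (λ i → trans (rev-out {0} {0} i (inj₂ z≤n)) (sym (fix S i (inj₂ z≤n)))) (leftW₀ 0 0)
  dualisable-suc (suc M) w (s≤s le) S V with w · M ≟ M
  ... | yes e = weakenᴬ (n≤1+n M) (D M w le (supp fixes) V)
    where
    fixes : ∀ i → (i < 0 ⊎ M ≤ i) → w · i ≡ i
    fixes i (inj₂ q) with m≤n⇒m<n∨m≡n q
    ... | inj₁ p = fix S i (inj₂ p)
    ... | inj₂ refl = e
  dualisable-suc (suc zero) w (s≤s le) S V | no ne = ⊥-elim (ne (n<1⇒n≡0 (supp-hi S (s≤s z≤n))))
  dualisable-suc (suc (suc M′)) w (s≤s le) S V | no ne =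
    [ (λ t → proj₁ (fromTail M′ w le S V ne t))
    , (λ t → invᴬ {w = w ⁻¹} (proj₁ (fromTail M′ (w ⁻¹) le (supp-⁻¹ S) (polished-⁻¹ V) (⁻¹-moves {w = w} ne) t))) ]
    (tail-dichotomy V ne (⁻¹-below S ne))

  equivDualisable-suc : EquivDualisable (suc f)
  equivDualisable-suc k y (s≤s le) S V desc nf no342 = [ ptail , vtail ] (tail-dichotomy V ne (⁻¹-below S ne))
    where
    yk<2+k : y · k < 2 + k
    yk<2+k = supp-hi S (m≤n⇒m≤1+n (n<1+n k))
    yk≤k : y · k ≤ k
    yk≤k = ≤-pred (≤∧≢⇒< (≤-pred yk<2+k) nf)
    ne : y · suc k ≢ suc k
    ne e = <⇒≱ desc (≤-trans (≤-pred yk<2+k) (≤-reflexive (sym e)))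
    ptail : TailAbove y (suc k) → Σ (AntiRel 0 (2 + k) y) λ A → EquivR A k
    ptail t with y · k ≟ suc (y ⁻¹ · suc k)
    -- The window is the right factor and contains k and 1 + k; `leftW₀` is taken there because it
    -- commutes with right multiplication.
    ... | yes e = proj₁ C , λ {u} {u′} → proj₁ (proj₂ C) k
        (λ {z} {z′} → leftW₀-EquivR {Tail.a S V ne t} {2 + k} {k} a≤M′ (n<1+n (suc k)) {z} {z′}) {u} {u′}
      where
      open Tail S V ne t hiding (y)
      C = glue₀ {w = y} (y ∘ₚ W) W (m≤n⇒m≤1+n a<M) W-undo
            (D _ (y ∘ₚ W) (≤-trans a<M le) (fits₁ e) (polished-embed {y} {W} V mono₁ (fits₁ e))) (leftW₀ a (2 + k))
    -- Here y k lies below 1 + a. The values 1 + a and 1 + k stand, in this order, before position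
    -- k, which is the configuration that was excluded.
    ... | no e = ⊥-elim (no342 (gap e) (a<M′ e)
        (subst (y · k <_) (sym (to-from y (suc a))) (≤∧≢⇒< (≤-pred (subst (_< 2 + a) (y-a e) (supp-hi (fits₂ e) (m≤n⇒m≤1+n (n<1+n a))))) e))
        (subst₂ _<_ (sym (to-from y (suc a))) (sym wa) (s≤s (a<M′ e))))
      where
      open Tail S V ne t hiding (y)
    vtail : TailAbove (y ⁻¹) (suc k) → Σ (AntiRel 0 (2 + k) y) λ A → EquivR A k
    vtail t with fromTail k (y ⁻¹) le (supp-⁻¹ S) (polished-⁻¹ V) (⁻¹-moves {w = y} ne) t
    ... | A , E = invᴬ {w = y ⁻¹} A , λ {u} {u′} → EquivL⇒R {w = y ⁻¹} A (E (<-≤-trans desc yk≤k) (n<1+n _) room) {u} {u′}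
      where
      -- In the only other case 1 + y (1 + k) = k. Then y k lies strictly above k - 1 and is at most
      -- k, so y fixes k, against the hypothesis.
      room : y ⁻¹ · k ≢ suc (y · suc k) → 2 + y · suc k ≤ k
      room h with m≤n⇒m<n∨m≡n (<-≤-trans desc yk≤k)
      ... | inj₁ p = p
      ... | inj₂ p = ⊥-elim (h (trans (⁻¹-swap y (≤-antisym yk≤k (subst (_≤ y · k) p desc))) (sym p)))

dualisable : ∀ f → Dualisable f × EquivDualisable f
dualisable zero = (λ { zero w z≤n S _ →
    respᴬ {w = w₀ 0 0} {v = w} (λ i → trans (rev-out {0} {0} i (inj₂ z≤n)) (sym (fix S i (inj₂ z≤n)))) (leftW₀ 0 0) }) , λ _ _ ()
dualisable (suc f) with dualisable f
... | D , ED = dualisable-suc D ED , equivDualisable-suc D ED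

polished⇒antiRel : ∀ {m w} → Supp 0 m w → Polished w → AntiRel 0 m w
polished⇒antiRel {m} {w} = proj₁ (dualisable m) m w ≤-refl

-- Minimal inversions

least : ∀ {P : ℕ → Set} → Decidable P → ∀ n → P n → ∃ λ m → m ≤ n × P m × (∀ {k} → k < m → ¬ P k)
least P? zero p = zero , z≤n , p , λ ()
least {P} P? (suc n) p with P? zero
... | yes q = zero , z≤n , q , λ ()
... | no ¬q with least {λ k → P (suc k)} (λ k → P? (suc k)) n p
... | m , m≤n , q , f = suc m , s≤s m≤n , q , λ { {zero} _ → ¬q ; {suc k} (s≤s k<m) → f k<m }

greatest : ∀ {P : ℕ → Set} → Decidable P → ∀ n {p} → p ≤ n → P p →
           ∃ λ m → m ≤ n × P m × (∀ {k} → m < k → k ≤ n → ¬ P k)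
greatest P? n p≤n Pp with P? n
... | yes q = n , ≤-refl , q , λ m<k k≤n _ → <⇒≱ m<k k≤n
greatest P? zero z≤n Pp | no ¬q = ⊥-elim (¬q Pp)
greatest P? (suc n) p≤n Pp | no ¬q with m≤n⇒m<n∨m≡n p≤n
... | inj₂ refl = ⊥-elim (¬q Pp)
... | inj₁ (s≤s p≤n′) with greatest P? n p≤n′ Pp
... | m , m≤n , q , f = m , m≤n⇒m≤1+n m≤n , q , g
  where
  g : ∀ {k} → m < k → k ≤ suc n → ¬ _
  g m<k k≤ Pk with m≤n⇒m<n∨m≡n k≤
  ... | inj₂ refl = ¬q Pk
  ... | inj₁ (s≤s k≤n) = f m<k k≤n Pk

record MinInv (w : Perm) (p q : ℕ) : Set where
  constructor minInv
  field
    pos   : p < q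
    desc  : w · q < w · p
    empty : ∀ {x} → p < x → x < q → w · q < w · x → w · x < w · p → ⊥

Cross : Perm → ℕ → Set
Cross w j = ∃₂ λ p q → p ≤ j × j < q × w · q < w · p

-- The canonical minimal inversion across the cut j: q is the first position after j whose value drops below
-- the maximum over the first j positions, and p is the last position up to j with w p > w q.
record Canon (w : Perm) (j p q : ℕ) : Set where
  constructor canon
  field
    left  : p ≤ j
    right : j < q
    desc  : w · q < w · p
    lows  : ∀ {x} → p < x → x ≤ j → w · x < w · q
    highs : ∀ {y x} → j < y → y < q → x ≤ j → w · x < w · y

cross⇒canon : ∀ w {j} → Cross w j → ∃₂ λ p q → Canon w j p q
cross⇒canon w {j} (p₀ , q₀ , p₀≤j , j<q₀ , lt) =
  let drops? = λ q → (j <? q) ×-dec anyUpTo? (λ p → w · q <? w · p) (suc j)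
      q , _ , (j<q , p₁ , p₁≤j , lt₁) , first = least drops? q₀ (j<q₀ , p₀ , s≤s p₀≤j , lt)
      p , p≤j , lt₂ , last = greatest (λ p → w · q <? w · p) j (≤-pred p₁≤j) lt₁
      lows : ∀ {x} → p < x → x ≤ j → w · x < w · q
      lows p<x x≤j = [ (λ r → r) , (λ r → ⊥-elim (last p<x x≤j r)) ] (<-cases (inj≢ w (<⇒≢ (≤-<-trans x≤j j<q))))
      highs : ∀ {y x} → j < y → y < q → x ≤ j → w · x < w · y
      highs j<y y<q x≤j = [ (λ r → r) , (λ r → ⊥-elim (first y<q (j<y , _ , s≤s x≤j , r))) ]
                            (<-cases (inj≢ w (<⇒≢ (≤-<-trans x≤j j<y))))
  in p , q , canon p≤j j<q lt₂ lows highs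

canon⇒minInv : ∀ {w j p q} → Canon w j p q → MinInv w p q
canon⇒minInv {w} {j} {p} {q} (canon l r d lo hi) = minInv (≤-<-trans l r) d emp
  where
  emp : ∀ {x} → p < x → x < q → w · q < w · x → w · x < w · p → ⊥
  emp {x} p<x x<q s t with x ≤? j
  ... | yes x≤j = <-asym s (lo p<x x≤j)
  ... | no x≰j  = <-asym t (hi (≰⇒> x≰j) x<q l)

-- For cuts i < j the entry at 1 + i lies right of the first cut and left of or at the second. Hence
-- it exceeds w p by `highs` and is below w q by `lows`, although w q < w p.
canon-injective : ∀ {w i j p q} → Canon w i p q → Canon w j p q → i ≡ j
canon-injective {w} {i} {j} a b with <-cmp i j
... | tri≈ _ e _ = e
... | tri< i<j _ _ = ⊥-elim (<-asym (Canon.highs a (n<1+n i) (≤-<-trans i<j (Canon.right b)) (Canon.left a))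
        (<-trans (Canon.lows b (s≤s (Canon.left a)) i<j) (Canon.desc a)))
... | tri> _ _ j<i = ⊥-elim (<-asym (Canon.highs b (n<1+n j) (≤-<-trans j<i (Canon.right a)) (Canon.left b))
        (<-trans (Canon.lows a (s≤s (Canon.left b)) j<i) (Canon.desc b)))

-- Inversions that are never canonical: the entries 3..2 of a 3412, or 2..1 of a 4231.
Extra : Perm → ℕ → ℕ → Set
Extra w p q = (∃₂ λ c d → p < c × c < d × d < q × w · d < w · q × w · p < w · c)
            ⊎ (∃₂ λ o c → o < p × p < c × c < q × w · p < w · c × w · c < w · o)

-- The middle entry c violates `lows` if it stands left of the cut; if it stands right of it,
-- `highs` fails at d for 3412 and at c, compared with o, for 4231.
extra-not-canon : ∀ {w j p q} → Extra w p q → Canon w j p q → ⊥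
extra-not-canon {w} {j} (inj₁ (c , d , p<c , c<d , d<q , s , t)) (canon l r de lo hi) with c ≤? j
... | yes c≤j = <-asym (<-trans de t) (lo p<c c≤j)
... | no c≰j  = <-asym (<-trans s de) (hi (<-trans (≰⇒> c≰j) c<d) d<q l)
extra-not-canon {w} {j} (inj₂ (o , c , o<p , p<c , c<q , s , t)) (canon l r de lo hi) with c ≤? j
... | yes c≤j = <-asym (<-trans de s) (lo p<c c≤j)
... | no c≰j  = <-asym t (hi (≰⇒> c≰j) c<q (<⇒≤ (<-≤-trans o<p l)))

module Swapped (w : Perm) {p q : ℕ} (p<q : p < q) where

  v : Perm
  v = w ∘ₚ tr p q

  v-p : v · p ≡ w · q
  v-p = cong (w ·_) (trTo-l p q)

  v-q : v · q ≡ w · p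
  v-q = cong (w ·_) (trTo-r p q)

  v-o : ∀ {x} → x ≢ p → x ≢ q → v · x ≡ w · x
  v-o s t = cong (w ·_) (trTo-o p q s t)

  v-lt : ∀ {x} → x < p → v · x ≡ w · x
  v-lt r = v-o (<⇒≢ r) (<⇒≢ (<-trans r p<q))

  v-gt : ∀ {x} → q < x → v · x ≡ w · x
  v-gt r = v-o (λ e → <⇒≢ (<-trans p<q r) (sym e)) (λ e → <⇒≢ r (sym e))

  v-mid : ∀ {x} → p < x → x < q → v · x ≡ w · x
  v-mid r s = v-o (λ e → <⇒≢ r (sym e)) (<⇒≢ s)

  -- The three conditions keep the rectangle empty of the value that moved to p, of the value that
  -- moved to q, and of the entries that did not move.
  minInv-v : ∀ {s t A B} → v · s ≡ A → v · t ≡ B → s < t → B < A →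
             (s < p → p < t → B < w · q → w · q < A → ⊥) →
             (s < q → q < t → B < w · p → w · p < A → ⊥) →
             (∀ {x} → s < x → x < t → x ≢ p → x ≢ q → B < w · x → w · x < A → ⊥) → MinInv v s t
  minInv-v {s} {t} refl refl s<t B<A f g h = minInv s<t B<A emp
    where
    moved : ∀ {x y c} → x ≡ y → v · y ≡ c → v · x ≡ c
    moved e = trans (cong (v ·_) e)
    emp : ∀ {x} → s < x → x < t → v · t < v · x → v · x < v · s → ⊥
    emp {x} a b c d = cases (x ≟ p) (x ≟ q)
      where
      cases : Dec (x ≡ p) → Dec (x ≡ q) → ⊥
      cases (yes e) _       = f (subst (s <_) e a) (subst (_< t) e b) (subst (v · t <_) (moved e v-p) c) (subst (_< v · s) (moved e v-p) d)
      cases (no _)  (yes e) = g (subst (s <_) e a) (subst (_< t) e b) (subst (v · t <_) (moved e v-q) c) (subst (_< v · s) (moved e v-q) d)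
      cases (no i)  (no k)  = h a b i k (subst (v · t <_) (v-o i k) c) (subst (_< v · s) (v-o i k) d)

  cross-outside : ∀ {j} → j < p ⊎ q ≤ j → Cross w j → Cross v j
  cross-outside {j} (inj₁ j<p) (a , b , a≤j , j<b , d) = tr p q · a , tr p q · b
      , subst (_≤ j) (sym (trTo-o p q (<⇒≢ a<p) (<⇒≢ (<-trans a<p p<q)))) a≤j
      , j<tb , subst₂ _<_ (cong (w ·_) (sym (trTo-inv p q b))) (cong (w ·_) (sym (trTo-inv p q a))) d
    where
    a<p = ≤-<-trans a≤j j<p
    j<tb : j < tr p q · b
    j<tb with trTo p q b | trView p q b
    ... | _ | at-l = <-trans j<p p<q
    ... | _ | at-r = j<p
    ... | _ | off _ _ = j<b
  cross-outside {j} (inj₂ q≤j) (a , b , a≤j , j<b , d) = tr p q · a , tr p q · b , ta≤j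
      , subst (j <_) (sym (trTo-o p q (λ e → <⇒≢ (<-trans p<q q<b) (sym e)) (λ e → <⇒≢ q<b (sym e)))) j<b
      , subst₂ _<_ (cong (w ·_) (sym (trTo-inv p q b))) (cong (w ·_) (sym (trTo-inv p q a))) d
    where
    q<b = ≤-<-trans q≤j j<b
    ta≤j : tr p q · a ≤ j
    ta≤j with trTo p q a | trView p q a
    ... | _ | at-l = q≤j
    ... | _ | at-r = <⇒≤ (<-≤-trans p<q q≤j)
    ... | _ | off _ _ = a≤j

  -- At a cut outside [p, q) the swap stays on one side and destroys no crossing; every cut inside
  -- is crossed by the pair x, y.
  cross-keep : ∀ {x y} → x ≤ p → q ≤ y → v · y < v · x → ∀ {j} → Cross w j → Cross v j
  cross-keep {x} {y} x≤p q≤y lt {j} c with p ≤? j | j <? q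
  ... | yes p≤j | yes j<q = x , y , ≤-trans x≤p p≤j , <-≤-trans j<q q≤y , lt
  ... | no p≰j  | _       = cross-outside (inj₁ (≰⇒> p≰j)) c
  ... | yes _   | no j≮q  = cross-outside (inj₂ (≮⇒≥ j≮q)) c

  -- The entry at position j would lie inside the rectangle of the swapped inversion.
  lost-once : MinInv w p q → ∀ {i j} → i < j → Cross w i → ¬ Cross v i → Cross w j → ¬ Cross v j → ⊥
  lost-once m {i} {j} i<j ci ¬ci cj ¬cj with i <? p | j <? q
  ... | yes i<p | _      = ¬ci (cross-outside (inj₁ i<p) ci)
  ... | no _    | no j≮q = ¬cj (cross-outside (inj₂ (≮⇒≥ j≮q)) cj)
  ... | no i≮p  | yes j<q = MinInv.empty m p<j j<q above below
    where
    p<j = ≤-<-trans (≮⇒≥ i≮p) i<j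
    vj = v-mid p<j j<q
    above : w · q < w · j
    above with <-cases {w · q} {w · j} (inj≢ w (λ e → <⇒≢ j<q (sym e)))
    ... | inj₁ t = t
    ... | inj₂ t = ⊥-elim (¬ci (p , j , ≮⇒≥ i≮p , i<j , subst₂ _<_ (sym vj) (sym v-p) t))
    below : w · j < w · p
    below with <-cases {w · j} {w · p} (inj≢ w (λ e → <⇒≢ p<j (sym e)))
    ... | inj₁ t = t
    ... | inj₂ t = ⊥-elim (¬cj (j , q , ≤-refl , j<q , subst₂ _<_ (sym v-q) (sym vj) t))

between? : ∀ w p q → Dec (∃ λ x → x < q × p < x × w · q < w · x × w · x < w · p)
between? w p q = anyUpTo? (λ x → (p <? x) ×-dec (w · q <? w · x) ×-dec (w · x <? w · p)) q

closestʳ : ∀ w {p} q → p < q → w · q < w · p →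
           ∃ λ q′ → q′ ≤ q × w · q ≤ w · q′ × MinInv w p q′
closestʳ w {p} q = go q q ≤-refl
  where
  go : ∀ n q → q ≤ n → p < q → w · q < w · p → ∃ λ q′ → q′ ≤ q × w · q ≤ w · q′ × MinInv w p q′
  go zero zero _ () _
  go (suc n) q q≤n p<q d with between? w p q
  ... | no ¬b = q , ≤-refl , ≤-refl , minInv p<q d (λ a b c e → ¬b (_ , b , a , c , e))
  ... | yes (x , x<q , p<x , s , t) with go n x (≤-pred (≤-trans x<q q≤n)) p<x t
  ... | q′ , le , ge , m = q′ , ≤-trans le (<⇒≤ x<q) , ≤-trans (<⇒≤ s) ge , m

closestˡ : ∀ w p {q} → p < q → w · q < w · p →
           ∃ λ p′ → p ≤ p′ × w · p′ ≤ w · p × MinInv w p′ q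
closestˡ w p {q} = go q p (m≤m+n q p)
  where
  go : ∀ n p → q ≤ n + p → p < q → w · q < w · p → ∃ λ p′ → p ≤ p′ × w · p′ ≤ w · p × MinInv w p′ q
  go zero p q≤ p<q d = ⊥-elim (<⇒≱ p<q q≤)
  go (suc n) p q≤ p<q d with between? w p q
  ... | no ¬b = p , ≤-refl , ≤-refl , minInv p<q d (λ a b c e → ¬b (_ , b , a , c , e))
  ... | yes (x , x<q , p<x , s , t) with go n x (≤-trans q≤ (subst (_≤ n + x) (+-suc n p) (+-monoʳ-≤ n p<x))) x<q s
  ... | p′ , ge , le , m = p′ , ≤-trans (<⇒≤ p<x) ge , ≤-trans le (<⇒≤ t) , m

-- Patterns producing coatoms with many minimal inversions

P321 : Perm → ℕ → ℕ → ℕ → Set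
P321 w i j k = i < j × j < k × w · k < w · j × w · j < w · i

P4321 P3421 P4312 : Perm → ℕ → ℕ → ℕ → ℕ → Set
P4321 w i j k l = i < j × j < k × k < l × w · l < w · k × w · k < w · j × w · j < w · i
P3421 w i j k l = i < j × j < k × k < l × w · l < w · k × w · k < w · i × w · i < w · j
P4312 w i j k l = i < j × j < k × k < l × w · k < w · l × w · l < w · j × w · j < w · i

P34521 P54123 P45321 P54312 : Perm → ℕ → ℕ → ℕ → ℕ → ℕ → Set
P34521 w i j k l m = i < j × j < k × k < l × l < m × w · m < w · l × w · l < w · i × w · i < w · j × w · j < w · k
P54123 w i j k l m = i < j × j < k × k < l × l < m × w · k < w · l × w · l < w · m × w · m < w · j × w · j < w · i
P45321 w i j k l m = i < j × j < k × k < l × l < m × w · m < w · l × w · l < w · k × w · k < w · i × w · i < w · j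
P54312 w i j k l m = i < j × j < k × k < l × l < m × w · l < w · m × w · m < w · k × w · k < w · j × w · j < w · i

Avoid₄ : (ℕ → ℕ → ℕ → ℕ → Set) → Set
Avoid₄ P = ∀ {i j k l} → P i j k l → ⊥

Avoid₅ : (ℕ → ℕ → ℕ → ℕ → ℕ → Set) → Set
Avoid₅ P = ∀ {i j k l m} → P i j k l m → ⊥

record Smoothₚ (w : Perm) : Set where
  field
    a3412 : ∀ {i j k l} → i < j → j < k → k < l → w · k < w · l → w · l < w · i → w · i < w · j → ⊥
    a4231 : ∀ {i j k l} → i < j → j < k → k < l → w · l < w · j → w · j < w · k → w · k < w · i → ⊥

record FullCoatom (w : Perm) : Set where
  field
    p q  : ℕ
    mi   : MinInv w p q
    keep : ∀ {j} → Cross w j → Cross (w ∘ₚ tr p q) j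
  v : Perm
  v = w ∘ₚ tr p q

record OneExtra (w : Perm) : Set where
  field
    coatom : FullCoatom w
  open FullCoatom coatom public
  field
    {a b}  : ℕ
    mi₁    : MinInv v a b
    extra₁ : Extra v a b

record TwoExtra (w : Perm) : Set where
  field
    one : OneExtra w
  open OneExtra one public
  field
    {c d}    : ℕ
    mi₂      : MinInv v c d
    extra₂   : Extra v c d
    distinct : a ≢ c ⊎ b ≢ d

coatomBy : ∀ {w p q x y} → MinInv w p q → x ≤ p → q ≤ y → (w ∘ₚ tr p q) · y < (w ∘ₚ tr p q) · x → FullCoatom w
coatomBy {w} m r s t = record { p = _ ; q = _ ; mi = m ; keep = Swapped.cross-keep w (MinInv.pos m) r s t }

<⇒≢ʳ : ∀ {i j} → i < j → j ≢ i
<⇒≢ʳ p e = <⇒≢ p (sym e)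

apart : ∀ w {i j} → w · i < w · j → i ≢ j
apart w lt refl = <-irrefl refl lt

module Patterns {w : Perm} (Sm : Smoothₚ w) where

  open Smoothₚ Sm
  open MinInv

  -- After the swap of b and c′ the entry at c′ is the old middle one, still below that at a, so
  -- this pair crosses every cut that the swap could affect.
  coatom-321 : ∀ {a b c} → P321 w a b c → FullCoatom w
  coatom-321 {a} {b} {c} (a<b , b<c , cb , ba) with closestʳ w c b<c cb
  ... | c′ , _ , _ , m = coatomBy {x = a} {y = c′} m (<⇒≤ a<b) ≤-refl
          (subst₂ _<_ (sym v-q) (sym (v-lt a<b)) ba)
    where open Swapped w (pos m)

  -- Swapping the entries 3 and 2 turns 4321 into 4231, whose 2..1 is the extra inversion. Choosing
  -- c′ and then d′ closest makes it minimal; an entry spoiling this left of c′ would give a 4231 in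
  -- w.
  extra-4321 : ∀ {a b c d} → P4321 w a b c d → OneExtra w
  extra-4321 {a} {b} {c} {d} (a<b , b<c , c<d , dc , cb , ba) with closestʳ w c b<c cb
  ... | c′ , c′≤c , cc′ , m with closestʳ w d (≤-<-trans c′≤c c<d) (<-≤-trans dc cc′)
  ... | d′ , d′≤d , dd′ , m′ = record
    { coatom = coatomBy {x = a} {y = d′} m (<⇒≤ a<b) (<⇒≤ (pos m′))
        (subst₂ _<_ (sym (v-gt (pos m′))) (sym (v-lt a<b)) (<-trans (desc m′) (<-trans (desc m) ba)))
    ; mi₁ = minInv-v v-p (v-gt (pos m′)) (<-trans (pos m) (pos m′)) (desc m′)
        (λ s _ _ _ → <-irrefl refl s) (λ _ _ _ s → <-asym s (desc m)) out
    ; extra₁ = inj₂ (a , c′ , a<b , pos m , pos m′ , subst₂ _<_ (sym v-p) (sym v-q) (desc m) , subst₂ _<_ (sym v-q) (sym (v-lt a<b)) ba)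
    }
    where
    open Swapped w (pos m)
    out : ∀ {x} → b < x → x < d′ → x ≢ b → x ≢ c′ → w · d′ < w · x → w · x < w · c′ → ⊥
    out {x} b<x x<d′ _ x≢c′ s t with <-cases x≢c′
    ... | inj₁ x<c′ = a4231 b<x x<c′ (pos m′) s t (desc m)
    ... | inj₂ c′<x = empty m′ c′<x x<d′ s t

  -- Swapping 2 and 1 turns 3421 into 3412. The closest partner a′ of c still precedes b, for
  -- otherwise b, a′, c, d would form 4321.
  extra-3421 : Avoid₄ (P4321 w) → ∀ {a b c d} → P3421 w a b c d → OneExtra w
  extra-3421 av {a} {b} {c} {d} (a<b , b<c , c<d , dc , ca , ab) with closestˡ w a (<-trans a<b b<c) ca
  ... | a′ , a≤a′ , aa , m₁ with closestʳ w d c<d dc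
  ... | d′ , d′≤d , dd′ , m = record
    { coatom = coatomBy {x = a′} {y = d′} m (<⇒≤ (pos m₁)) ≤-refl (subst₂ _<_ (sym v-q) (sym (v-lt (pos m₁))) (desc m₁))
    ; mi₁ = minInv-v (v-lt (pos m₁)) v-q (<-trans (pos m₁) (pos m)) (desc m₁)
        (λ _ _ s _ → <-asym s (desc m)) (λ _ s _ _ → <-irrefl refl s) out
    ; extra₁ = inj₁ (b , c , a′<b , b<c , pos m , subst₂ _<_ (sym v-p) (sym v-q) (desc m)
        , subst₂ _<_ (sym (v-lt (pos m₁))) (sym (v-lt b<c)) a′b)
    }
    where
    open Swapped w (pos m)
    a′b : w · a′ < w · b
    a′b = ≤-<-trans aa ab
    a′<b : a′ < b
    a′<b with <-cases (apart w a′b)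
    ... | inj₁ s = s
    ... | inj₂ s = ⊥-elim (av (s , pos m₁ , c<d , dc , desc m₁ , a′b))
    out : ∀ {x} → a′ < x → x < d′ → x ≢ c → x ≢ d′ → w · c < w · x → w · x < w · a′ → ⊥
    out {x} a′<x x<d′ x≢c _ s t with <-cases x≢c
    ... | inj₁ x<c = empty m₁ a′<x x<c s t
    ... | inj₂ c<x = a4231 b<c c<x x<d′ (desc m) s (<-trans t a′b)

  -- Swapping 4 and 3 turns 4312 into 3412. The closest partner d′ of b still follows c, for
  -- otherwise a, b, d′, c would form 4321.
  extra-4312 : Avoid₄ (P4321 w) → ∀ {a b c d} → P4312 w a b c d → OneExtra w
  extra-4312 av {a} {b} {c} {d} (a<b , b<c , c<d , cd , db , ba) with closestʳ w d (<-trans b<c c<d) db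
  ... | d′ , d′≤d , dd′ , m₁ with closestˡ w a a<b ba
  ... | a′ , a≤a′ , aa , m = record
    { coatom = coatomBy {x = a′} {y = d′} m ≤-refl (<⇒≤ (pos m₁)) (subst₂ _<_ (sym (v-gt (pos m₁))) (sym v-p) (desc m₁))
    ; mi₁ = minInv-v v-p (v-gt (pos m₁)) (<-trans (pos m) (pos m₁)) (desc m₁)
        (λ s _ _ _ → <-irrefl refl s) (λ _ _ _ s → <-asym s (desc m)) out
    ; extra₁ = inj₁ (b , c , pos m , b<c , c<d′ , subst₂ _<_ (sym (v-gt b<c)) (sym (v-gt (pos m₁))) cd′
        , subst₂ _<_ (sym v-p) (sym v-q) (desc m))
    }
    where
    open Swapped w (pos m)
    cd′ : w · c < w · d′
    cd′ = <-≤-trans cd dd′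
    c<d′ : c < d′
    c<d′ with <-cases (apart w cd′)
    ... | inj₁ s = s
    ... | inj₂ s = ⊥-elim (av (a<b , pos m₁ , s , cd′ , desc m₁ , ba))
    out : ∀ {x} → a′ < x → x < d′ → x ≢ a′ → x ≢ b → w · d′ < w · x → w · x < w · b → ⊥
    out {x} a′<x x<d′ _ x≢b s t with <-cases x≢b
    ... | inj₁ x<b = a4231 a′<x x<b b<c (<-trans cd′ s) t (desc m)
    ... | inj₂ b<x = empty m₁ b<x x<d′ s t

  -- Swapping 3 and 2 gives 45231, which contains 3412 as 4523 and 4231 as 4231. The 3..2 of the
  -- former starts at a, so (a, c) must be minimal beforehand; `go` arranges this by moving a right
  -- or c left, which shortens c - a.
  extra-45321 : ∀ {a b c d e} → P45321 w a b c d e → TwoExtra w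
  extra-45321 {a} {b} {c} {d} {e} = go c c (m≤m+n c a)
    where
    build : ∀ {a b c d e} → MinInv w a c → P45321 w a b c d e → TwoExtra w
    build {a} {b} {c} {d} {e} m₀ (a<b , b<c , c<d , d<e , ed , dc , ca , ab) with closestʳ w d c<d dc
    ... | d′ , d′≤d , dd′ , m with closestʳ w e (≤-<-trans d′≤d d<e) (<-≤-trans ed dd′)
    ... | e′ , e′≤e , ee′ , m₂ = record
      { one = record
        { coatom = coatomBy {x = a} {y = e′} m (<⇒≤ (pos m₀)) (<⇒≤ (pos m₂))
            (subst₂ _<_ (sym (v-gt (pos m₂))) (sym (v-lt (pos m₀))) (<-trans (desc m₂) (<-trans (desc m) ca)))
        ; mi₁ = minInv-v (v-lt (pos m₀)) v-q (<-trans (pos m₀) (pos m)) ca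
            (λ _ _ s _ → <-asym s (desc m)) (λ _ s _ _ → <-irrefl refl s) out₁
        ; extra₁ = inj₁ (b , c , a<b , b<c , pos m , subst₂ _<_ (sym v-p) (sym v-q) (desc m)
            , subst₂ _<_ (sym (v-lt (pos m₀))) (sym (v-lt b<c)) ab)
        }
      ; mi₂ = minInv-v v-p (v-gt (pos m₂)) (<-trans (pos m) (pos m₂)) (desc m₂)
            (λ s _ _ _ → <-irrefl refl s) (λ _ _ _ s → <-asym s (desc m)) out₂
      ; extra₂ = inj₂ (a , d′ , pos m₀ , pos m , pos m₂ , subst₂ _<_ (sym v-p) (sym v-q) (desc m)
            , subst₂ _<_ (sym v-q) (sym (v-lt (pos m₀))) ca)
      ; distinct = inj₁ (<⇒≢ (pos m₀))
      }
      where
      open Swapped w (pos m)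
      out₁ : ∀ {x} → a < x → x < d′ → x ≢ c → x ≢ d′ → w · c < w · x → w · x < w · a → ⊥
      out₁ {x} a<x x<d′ x≢c _ s t with <-cases x≢c
      ... | inj₁ x<c = empty m₀ a<x x<c s t
      ... | inj₂ c<x = a4231 b<c c<x x<d′ (desc m) s (<-trans t ab)
      out₂ : ∀ {x} → c < x → x < e′ → x ≢ c → x ≢ d′ → w · e′ < w · x → w · x < w · d′ → ⊥
      out₂ {x} c<x x<e′ _ x≢d s t with <-cases x≢d
      ... | inj₁ x<d = a4231 c<x x<d (pos m₂) s t (desc m)
      ... | inj₂ d<x = empty m₂ d<x x<e′ s t
    go : ∀ n c {a b d e} → c ≤ n + a → P45321 w a b c d e → TwoExtra w
    go zero c c≤ (a<b , b<c , _) = ⊥-elim (<⇒≱ (<-trans a<b b<c) c≤)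
    go (suc n) c {a} {b} {d} {e} c≤ P@(a<b , b<c , c<d , d<e , ed , dc , ca , ab) with between? w a c
    ... | no ¬b = build (minInv (<-trans a<b b<c) ca (λ r s t u → ¬b (_ , s , r , t , u))) P
    ... | yes (x , x<c , a<x , s , t) with <-cases (apart w (<-trans t ab))
    ... | inj₁ x<b = go n c (≤-trans c≤ (subst (_≤ n + x) (+-suc n a) (+-monoʳ-≤ n a<x)))
                       (x<b , b<c , c<d , d<e , ed , dc , s , <-trans t ab)
    ... | inj₂ b<x = go n x (≤-pred (≤-trans x<c c≤)) (a<b , b<x , <-trans x<c c<d , d<e , ed , <-trans dc s , t , ab)

  -- Swapping 4 and 3 gives 53412, which contains 3412 and, as 5341, a 4231. Now (c, e) has to be
  -- minimal beforehand, and `go` shortens e - c.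
  extra-54312 : ∀ {a b c d e} → P54312 w a b c d e → TwoExtra w
  extra-54312 {a} {b} {c} {d} {e} = go e e (m≤m+n e c)
    where
    build : ∀ {a b c d e} → MinInv w c e → P54312 w a b c d e → TwoExtra w
    build {a} {b} {c} {d} {e} m₀ (a<b , b<c , c<d , d<e , de , ec , cb , ba) with closestʳ w d c<d (<-trans de ec)
    ... | d′ , d′≤d , dd′ , m₂ with closestˡ w b b<c cb
    ... | b′ , b≤b′ , bb′ , m = record
      { one = record
        { coatom = coatomBy {x = b′} {y = e} m ≤-refl (<⇒≤ (pos m₀)) (subst₂ _<_ (sym (v-gt (pos m₀))) (sym v-p) ec)
        ; mi₁ = minInv-v v-p (v-gt (pos m₀)) (<-trans (pos m) (pos m₀)) ec
            (λ s _ _ _ → <-irrefl refl s) (λ _ _ _ s → <-asym s (desc m)) out₁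
        ; extra₁ = inj₁ (c , d , pos m , c<d , d<e , subst₂ _<_ (sym (v-gt c<d)) (sym (v-gt (pos m₀))) de
            , subst₂ _<_ (sym v-p) (sym v-q) (desc m))
        }
      ; mi₂ = minInv-v v-p (v-gt (pos m₂)) (<-trans (pos m) (pos m₂)) (desc m₂)
            (λ s _ _ _ → <-irrefl refl s) (λ _ _ _ s → <-asym s (desc m)) out₂
      ; extra₂ = inj₂ (a , c , a<b′ , pos m , pos m₂ , subst₂ _<_ (sym v-p) (sym v-q) (desc m)
            , subst₂ _<_ (sym v-q) (sym (v-lt a<b′)) (≤-<-trans bb′ ba))
      ; distinct = inj₂ (<⇒≢ʳ (≤-<-trans d′≤d d<e))
      }
      where
      open Swapped w (pos m)
      a<b′ = <-≤-trans a<b b≤b′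
      d′e : w · d′ < w · e
      d′e with <-cases {w · d′} {w · e} (inj≢ w (<⇒≢ (≤-<-trans d′≤d d<e)))
      ... | inj₁ s = s
      ... | inj₂ s = ⊥-elim (empty m₀ (pos m₂) (≤-<-trans d′≤d d<e) s (desc m₂))
      out₁ : ∀ {x} → b′ < x → x < e → x ≢ b′ → x ≢ c → w · e < w · x → w · x < w · c → ⊥
      out₁ {x} b<x x<e _ x≢c s t with <-cases x≢c
      ... | inj₁ x<c = a4231 b<x x<c c<d (<-trans de s) t (desc m)
      ... | inj₂ c<x = empty m₀ c<x x<e s t
      out₂ : ∀ {x} → b′ < x → x < d′ → x ≢ b′ → x ≢ c → w · d′ < w · x → w · x < w · c → ⊥
      out₂ {x} b<x x<d _ x≢c s t with <-cases x≢c
      ... | inj₁ x<c = a4231 b<x x<c (pos m₂) s t (desc m)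
      ... | inj₂ c<x = empty m₂ c<x x<d s t
    go : ∀ n e {a b c d} → e ≤ n + c → P54312 w a b c d e → TwoExtra w
    go zero e e≤ (_ , _ , c<d , d<e , _) = ⊥-elim (<⇒≱ (<-trans c<d d<e) e≤)
    go (suc n) e {a} {b} {c} {d} e≤ P@(a<b , b<c , c<d , d<e , de , ec , cb , ba) with between? w c e
    ... | no ¬b = build (minInv (<-trans c<d d<e) ec (λ r s t u → ¬b (_ , s , r , t , u))) P
    ... | yes (x , x<e , c<x , s , t) with <-cases (apart w (<-trans de s))
    ... | inj₁ d<x = go n x (≤-pred (≤-trans x<e e≤)) (a<b , b<c , c<d , d<x , <-trans de s , t , cb , ba)
    ... | inj₂ x<d = go n e (≤-trans e≤ (subst (_≤ n + x) (+-suc n c) (+-monoʳ-≤ n c<x)))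
                       (a<b , <-trans b<c c<x , x<d , d<e , de , s , <-trans t cb , ba)

  -- Swapping 2 and 1 gives 34512, where both 3 and 4 form a 3..2 with the final entry. Minimality
  -- replaces a, b by partners a′, b′ closest to d; without 45321 these remain before b and c, so
  -- they are distinct and keep a larger entry to their right.
  extra-34521 : Avoid₅ (P45321 w) → ∀ {a b c d e} → P34521 w a b c d e → TwoExtra w
  extra-34521 av {a} {b} {c} {d} {e} (a<b , b<c , c<d , d<e , ed , da , ab , bc)
    with closestˡ w a (<-trans a<b (<-trans b<c c<d)) da
       | closestˡ w b (<-trans b<c c<d) (<-trans da ab)
       | closestʳ w e d<e ed
  ... | a′ , a≤a′ , aa′ , m₁ | b′ , b≤b′ , bb′ , m₂ | e′ , e′≤e , ee′ , m = record
    { one = record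
      { coatom = coatomBy {x = a′} {y = e′} m (<⇒≤ (pos m₁)) ≤-refl (subst₂ _<_ (sym v-q) (sym (v-lt (pos m₁))) (desc m₁))
      ; mi₁ = minInv-v (v-lt (pos m₁)) v-q (<-trans (pos m₁) (pos m)) (desc m₁)
          (λ _ _ s _ → <-asym s (desc m)) (λ _ s _ _ → <-irrefl refl s) (out m₁ (<-trans a′b bc))
      ; extra₁ = inj₁ (c , d , <-trans a′<b b<c , c<d , pos m , subst₂ _<_ (sym v-p) (sym v-q) (desc m)
          , subst₂ _<_ (sym (v-lt (pos m₁))) (sym (v-lt c<d)) (<-trans a′b bc))
      }
    ; mi₂ = minInv-v (v-lt (pos m₂)) v-q (<-trans (pos m₂) (pos m)) (desc m₂)
          (λ _ _ s _ → <-asym s (desc m)) (λ _ s _ _ → <-irrefl refl s) (out m₂ b′c)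
    ; extra₂ = inj₁ (c , d , b′<c , c<d , pos m , subst₂ _<_ (sym v-p) (sym v-q) (desc m)
          , subst₂ _<_ (sym (v-lt (pos m₂))) (sym (v-lt c<d)) b′c)
    ; distinct = inj₁ (<⇒≢ (<-≤-trans a′<b b≤b′))
    }
    where
    open Swapped w (pos m)
    a′b : w · a′ < w · b
    a′b = ≤-<-trans aa′ ab
    b′c : w · b′ < w · c
    b′c = ≤-<-trans bb′ bc
    a′<b : a′ < b
    a′<b with <-cases (apart w a′b) | m≤n⇒m<n∨m≡n aa′
    ... | inj₁ s | _ = s
    ... | inj₂ s | inj₁ t = ⊥-elim (av (a<b , s , pos m₁ , d<e , ed , desc m₁ , t , ab))
    ... | inj₂ s | inj₂ t = ⊥-elim (<-asym s (subst (_< b) (sym (inj w t)) a<b))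
    b′<c : b′ < c
    b′<c with <-cases (apart w b′c) | m≤n⇒m<n∨m≡n bb′
    ... | inj₁ s | _ = s
    ... | inj₂ s | inj₁ t = ⊥-elim (av (b<c , s , pos m₂ , d<e , ed , desc m₂ , t , bc))
    ... | inj₂ s | inj₂ t = ⊥-elim (<-asym s (subst (_< c) (sym (inj w t)) b<c))
    out : ∀ {z} → MinInv w z d → w · z < w · c → ∀ {x} → z < x → x < e′ → x ≢ d → x ≢ e′ → w · d < w · x → w · x < w · z → ⊥
    out m′ zc {x} z<x x<e x≢d _ s t with <-cases x≢d
    ... | inj₁ x<d = empty m′ z<x x<d s t
    ... | inj₂ d<x = a4231 c<d d<x x<e (desc m) s (<-trans t zc)

  -- Swapping 5 and 4 gives 45123, where 4 forms a 3..2 with both of the last entries. Avoiding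
  -- 54312 keeps the closest partners d′ and e′ of b in order after c.
  extra-54123 : Avoid₅ (P54312 w) → ∀ {a b c d e} → P54123 w a b c d e → TwoExtra w
  extra-54123 av {a} {b} {c} {d} {e} (a<b , b<c , c<d , d<e , cd , de , eb , ba)
    with closestʳ w d (<-trans b<c c<d) (<-trans de eb)
       | closestʳ w e (<-trans b<c (<-trans c<d d<e)) eb
       | closestˡ w a a<b ba
  ... | d′ , d′≤d , dd′ , m₁ | e′ , e′≤e , ee′ , m₂ | a′ , a≤a′ , aa′ , m = record
    { one = record
      { coatom = coatomBy {x = a′} {y = d′} m ≤-refl (<⇒≤ (pos m₁)) (subst₂ _<_ (sym (v-gt (pos m₁))) (sym v-p) (desc m₁))
      ; mi₁ = minInv-v v-p (v-gt (pos m₁)) (<-trans (pos m) (pos m₁)) (desc m₁)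
          (λ s _ _ _ → <-irrefl refl s) (λ _ _ _ s → <-asym s (desc m)) (out m₁ cd′)
      ; extra₁ = inj₁ (b , c , pos m , b<c , c<d′ , subst₂ _<_ (sym (v-gt b<c)) (sym (v-gt (pos m₁))) cd′
          , subst₂ _<_ (sym v-p) (sym v-q) (desc m))
      }
    ; mi₂ = minInv-v v-p (v-gt (pos m₂)) (<-trans (pos m) (pos m₂)) (desc m₂)
          (λ s _ _ _ → <-irrefl refl s) (λ _ _ _ s → <-asym s (desc m)) (out m₂ (<-trans cd′ d′e′))
    ; extra₂ = inj₁ (b , c , pos m , b<c , <-trans c<d′ d′<e′ , subst₂ _<_ (sym (v-gt b<c)) (sym (v-gt (pos m₂))) (<-trans cd′ d′e′)
          , subst₂ _<_ (sym v-p) (sym v-q) (desc m))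
    ; distinct = inj₂ (<⇒≢ d′<e′)
    }
    where
    open Swapped w (pos m)
    cd′ : w · c < w · d′
    cd′ = <-≤-trans cd dd′
    c<d′ : c < d′
    c<d′ with <-cases (apart w cd′) | m≤n⇒m<n∨m≡n dd′
    ... | inj₁ s | _ = s
    ... | inj₂ s | inj₁ t = ⊥-elim (av (a<b , pos m₁ , s , c<d , cd , t , desc m₁ , ba))
    ... | inj₂ s | inj₂ t = ⊥-elim (<-asym s (subst (c <_) (inj w t) c<d))
    d′≢e : d′ ≢ e
    d′≢e = <⇒≢ (≤-<-trans d′≤d d<e)
    d′e : w · d′ < w · e
    d′e with <-cases (inj≢ w d′≢e) | m≤n⇒m<n∨m≡n dd′ | m≤n⇒m<n∨m≡n d′≤d
    ... | inj₁ s | _ | _ = s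
    ... | inj₂ s | inj₂ t | _ = ⊥-elim (<-asym s (subst (_< w · e) t de))
    ... | inj₂ s | inj₁ t | inj₁ u = ⊥-elim (av (a<b , pos m₁ , u , d<e , de , s , desc m₁ , ba))
    ... | inj₂ s | inj₁ t | inj₂ u = ⊥-elim (<-irrefl (cong (w ·_) (sym u)) t)
    d′e′ : w · d′ < w · e′
    d′e′ = <-≤-trans d′e ee′
    d′<e′ : d′ < e′
    d′<e′ with <-cases (apart w d′e′) | m≤n⇒m<n∨m≡n ee′
    ... | inj₁ s | _ = s
    ... | inj₂ s | inj₁ t = ⊥-elim (av (a<b , pos m₂ , s , ≤-<-trans d′≤d d<e , d′e , t , desc m₂ , ba))
    ... | inj₂ s | inj₂ t = ⊥-elim (<-asym s (subst (d′ <_) (inj w t) (≤-<-trans d′≤d d<e)))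
    out : ∀ {z} → MinInv w b z → w · c < w · z → ∀ {x} → a′ < x → x < z → x ≢ a′ → x ≢ b → w · z < w · x → w · x < w · b → ⊥
    out m′ cz {x} a<x x<z _ x≢b s t with <-cases x≢b
    ... | inj₁ x<b = a4231 a<x x<b b<c (<-trans cz s) t (desc m)
    ... | inj₂ b<x = empty m′ b<x x<z s t

-- Bounded search for the patterns

any₄? : ∀ {P : ℕ → ℕ → ℕ → ℕ → Set} → (∀ i j k l → Dec (P i j k l)) → ∀ n →
        Dec (∃ λ i → i < n × ∃ λ j → j < n × ∃ λ k → k < n × ∃ λ l → l < n × P i j k l)
any₄? P? n = anyUpTo? (λ i → anyUpTo? (λ j → anyUpTo? (λ k → anyUpTo? (λ l → P? i j k l) n) n) n) n

module Search {n w} (S : Supp 0 n w) where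

  private
    bound : ∀ {i j} → i < j → w · j < w · i → j < n
    bound p q = proj₂ (supp-inversion S p q)

  find-321 : (∃ λ i → ∃ λ j → ∃ λ k → P321 w i j k) ⊎ (∀ {i j k} → P321 w i j k → ⊥)
  find-321 with anyUpTo? (λ i → anyUpTo? (λ j → anyUpTo? (λ k →
                  (i <? j) ×-dec (j <? k) ×-dec (w · k <? w · j) ×-dec (w · j <? w · i)) n) n) n
  ... | yes (i , _ , j , _ , k , _ , p) = inj₁ (i , j , k , p)
  ... | no ¬p = inj₂ λ { {i} {j} {k} P@(a , b , s , t) →
          ¬p (i , <-trans a (<-trans b (bound b s)) , j , <-trans b (bound b s) , k , bound b s , P) }

  private
    up₄ : ∀ {P : ℕ → ℕ → ℕ → ℕ → Set} → (∀ i j k l → Dec (P i j k l)) →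
          (∀ {i j k l} → P i j k l → i < j × j < k × k < l × l < n) →
          (∃ λ i → ∃ λ j → ∃ λ k → ∃ λ l → P i j k l) ⊎ Avoid₄ P
    up₄ P? inc with any₄? P? n
    ... | yes (i , _ , j , _ , k , _ , l , _ , p) = inj₁ (i , j , k , l , p)
    ... | no ¬p = inj₂ λ {i} {j} {k} {l} P → let (a , b , c , d) = inc P in
            ¬p (i , <-trans a (<-trans b (<-trans c d)) , j , <-trans b (<-trans c d) , k , <-trans c d , l , d , P)

    up₅ : ∀ {P : ℕ → ℕ → ℕ → ℕ → ℕ → Set} → (∀ i j k l m → Dec (P i j k l m)) →
          (∀ {i j k l m} → P i j k l m → i < j × j < k × k < l × l < m × m < n) →
          (∃ λ i → ∃ λ j → ∃ λ k → ∃ λ l → ∃ λ m → P i j k l m) ⊎ Avoid₅ P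
    up₅ P? inc with anyUpTo? (λ i → any₄? (P? i) n) n
    ... | yes (i , _ , j , _ , k , _ , l , _ , m , _ , p) = inj₁ (i , j , k , l , m , p)
    ... | no ¬p = inj₂ λ {i} {j} {k} {l} {m} P → let (a , b , c , d , e) = inc P in
            ¬p (i , <-trans a (<-trans b (<-trans c (<-trans d e))) , j , <-trans b (<-trans c (<-trans d e))
               , k , <-trans c (<-trans d e) , l , <-trans d e , m , e , P)

  find-4321 : (∃ λ i → ∃ λ j → ∃ λ k → ∃ λ l → P4321 w i j k l) ⊎ Avoid₄ (P4321 w)
  find-4321 = up₄ (λ i j k l → (i <? j) ×-dec (j <? k) ×-dec (k <? l) ×-dec
      (w · l <? w · k) ×-dec (w · k <? w · j) ×-dec (w · j <? w · i))
    λ (a , b , c , s , t , u) → a , b , c , bound c s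

  find-3421 : (∃ λ i → ∃ λ j → ∃ λ k → ∃ λ l → P3421 w i j k l) ⊎ Avoid₄ (P3421 w)
  find-3421 = up₄ (λ i j k l → (i <? j) ×-dec (j <? k) ×-dec (k <? l) ×-dec
      (w · l <? w · k) ×-dec (w · k <? w · i) ×-dec (w · i <? w · j))
    λ (a , b , c , s , t , u) → a , b , c , bound c s

  find-4312 : (∃ λ i → ∃ λ j → ∃ λ k → ∃ λ l → P4312 w i j k l) ⊎ Avoid₄ (P4312 w)
  find-4312 = up₄ (λ i j k l → (i <? j) ×-dec (j <? k) ×-dec (k <? l) ×-dec
      (w · k <? w · l) ×-dec (w · l <? w · j) ×-dec (w · j <? w · i))
    λ (a , b , c , s , t , u) → a , b , c , bound (<-trans b c) t

  private
    Found₅ : (ℕ → ℕ → ℕ → ℕ → ℕ → Set) → Set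
    Found₅ P = (∃ λ i → ∃ λ j → ∃ λ k → ∃ λ l → ∃ λ m → P i j k l m) ⊎ Avoid₅ P

  find-34521 : Found₅ (P34521 w)
  find-34521 = up₅ (λ i j k l m → (i <? j) ×-dec (j <? k) ×-dec (k <? l) ×-dec (l <? m) ×-dec
      (w · m <? w · l) ×-dec (w · l <? w · i) ×-dec (w · i <? w · j) ×-dec (w · j <? w · k))
    λ (a , b , c , d , s , t , u , x) → a , b , c , d , bound d s

  find-54123 : Found₅ (P54123 w)
  find-54123 = up₅ (λ i j k l m → (i <? j) ×-dec (j <? k) ×-dec (k <? l) ×-dec (l <? m) ×-dec
      (w · k <? w · l) ×-dec (w · l <? w · m) ×-dec (w · m <? w · j) ×-dec (w · j <? w · i))
    λ (a , b , c , d , s , t , u , x) → a , b , c , d , bound (<-trans b (<-trans c d)) u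

  find-45321 : Found₅ (P45321 w)
  find-45321 = up₅ (λ i j k l m → (i <? j) ×-dec (j <? k) ×-dec (k <? l) ×-dec (l <? m) ×-dec
      (w · m <? w · l) ×-dec (w · l <? w · k) ×-dec (w · k <? w · i) ×-dec (w · i <? w · j))
    λ (a , b , c , d , s , t , u , x) → a , b , c , d , bound d s

  find-54312 : Found₅ (P54312 w)
  find-54312 = up₅ (λ i j k l m → (i <? j) ×-dec (j <? k) ×-dec (k <? l) ×-dec (l <? m) ×-dec
      (w · l <? w · m) ×-dec (w · m <? w · k) ×-dec (w · k <? w · j) ×-dec (w · j <? w · i))
    λ (a , b , c , d , s , t , u , x) → a , b , c , d , bound (<-trans c d) t

polished-or-twoExtra : ∀ {n w} → Supp 0 n w → Smoothₚ w → Polished w ⊎ TwoExtra w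
polished-or-twoExtra {n} {w} S Sm with Search.find-45321 S | Search.find-54312 S
... | inj₁ (_ , _ , _ , _ , _ , p) | _ = inj₂ (Patterns.extra-45321 Sm p)
... | inj₂ _ | inj₁ (_ , _ , _ , _ , _ , p) = inj₂ (Patterns.extra-54312 Sm p)
... | inj₂ f | inj₂ g with Search.find-34521 S | Search.find-54123 S
... | inj₁ (_ , _ , _ , _ , _ , p) | _ = inj₂ (Patterns.extra-34521 Sm f p)
... | inj₂ _ | inj₁ (_ , _ , _ , _ , _ , p) = inj₂ (Patterns.extra-54123 Sm g p)
... | inj₂ h | inj₂ k = inj₁ record
  { no3412  = a3412
  ; no4231  = a4231
  ; no34521 = λ p q r s t u x y → h (p , q , r , s , t , u , x , y)
  ; no54123 = λ p q r s t u x y → k (p , q , r , s , t , u , x , y)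
  ; no45321 = λ p q r s t u x y → f (p , q , r , s , t , u , x , y)
  ; no54312 = λ p q r s t u x y → g (p , q , r , s , t , u , x , y)
  }
  where open Smoothₚ Sm

-- Large and small entries across a cut

-- As many large values sit in the first k positions as small values after them.
balance : ∀ {n w k y} → Supp 0 n w → y < k → k ≤ w · y → ∃ λ q → k ≤ q × w · q < k
balance {n} {w} {k} {y} S y<k k≤wy with anyUpTo? (λ q → (k ≤? q) ×-dec (w · q <? k)) n
... | yes (q , _ , p) = q , p
... | no ¬p = ⊥-elim (<-irrefl refl (Finₚ.injective⇒≤ {f = g} g-inj))
  where
  low : ∀ {v} → v < k → w ⁻¹ · v < k
  low {v} v<k with w ⁻¹ · v <? k | w ⁻¹ · v <? n
  ... | yes p | _     = p
  ... | no p  | yes q = ⊥-elim (¬p (_ , q , ≮⇒≥ p , subst (_< k) (sym (to-from w v)) v<k))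
  ... | no p  | no q  = subst (_< k) (sym (trans (sym (fix S _ (inj₂ (≮⇒≥ q)))) (to-from w v))) v<k
  g : Fin (suc k) → Fin k
  g Fin.zero    = fromℕ< y<k
  g (Fin.suc i) = fromℕ< (low (Finₚ.toℕ<n i))
  clash : ∀ i → y ≢ w ⁻¹ · toℕ i
  clash i e = <⇒≱ (Finₚ.toℕ<n i) (subst (k ≤_) (trans (cong (w ·_) e) (to-from w (toℕ i))) k≤wy)
  g-inj : ∀ {i j} → g i ≡ g j → i ≡ j
  g-inj {Fin.zero}  {Fin.zero}  _ = refl
  g-inj {Fin.zero}  {Fin.suc j} e = ⊥-elim (clash j (Finₚ.fromℕ<-injective _ _ y<k (low (Finₚ.toℕ<n j)) e))
  g-inj {Fin.suc i} {Fin.zero}  e = ⊥-elim (clash i (Finₚ.fromℕ<-injective _ _ y<k (low (Finₚ.toℕ<n i)) (sym e)))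
  g-inj {Fin.suc i} {Fin.suc j} e = cong Fin.suc (Finₚ.toℕ-injective (inj (w ⁻¹)
    (Finₚ.fromℕ<-injective _ _ (low (Finₚ.toℕ<n i)) (low (Finₚ.toℕ<n j)) e)))

-- Swapping the entries at x and q uses up one large and one small value; `balance`, applied to the
-- remaining large value at y, finds the second small one.
balance₂ : ∀ {n w k x y q} → Supp 0 n w → x ≢ y → x < k → y < k → k ≤ w · x → k ≤ w · y → k ≤ q → w · q < k →
           ∃ λ q′ → q′ ≢ q × k ≤ q′ × w · q′ < k
balance₂ {n} {w} {k} {x} {y} {q} S x≢y x<k y<k k≤wx k≤wy k≤q wq<k
  with balance {n} {w ∘ₚ tr x q} {k} {y} S′ y<k (subst (k ≤_) (cong (w ·_) (sym (trTo-o x q (λ e → x≢y (sym e)) (<⇒≢ (<-≤-trans y<k k≤q))))) k≤wy)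
  where
  q<n : q < n
  q<n with q <? n
  ... | yes p = p
  ... | no p  = ⊥-elim (<⇒≱ wq<k (subst (k ≤_) (sym (fix S q (inj₂ (≮⇒≥ p)))) k≤q))
  S′ : Supp 0 n (w ∘ₚ tr x q)
  S′ = supp-∘ {u = w} {v = tr x q} S (supp-tr z≤n z≤n (<-trans (<-≤-trans x<k k≤q) q<n) q<n)
... | q′ , k≤q′ , lt = q′ , (λ e → <⇒≱ (subst (λ t → w · t < k) (trTo-r x q) (subst (λ t → w · trTo x q t < k) e lt)) k≤wx) , k≤q′
    , subst (λ t → w · t < k) (trTo-o x q (λ e → <⇒≱ x<k (subst (k ≤_) e k≤q′))
        (λ e → <⇒≱ (subst (λ t → w · t < k) (trTo-r x q) (subst (λ t → w · trTo x q t < k) e lt)) k≤wx)) lt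

balance₂′ : ∀ {n w k x y p} → Supp 0 n w → x ≢ y → k ≤ x → k ≤ y → w · x < k → w · y < k → p < k → k ≤ w · p →
            ∃ λ p′ → p′ ≢ p × p′ < k × k ≤ w · p′
balance₂′ {n} {w} {k} {x} {y} {p} S x≢y k≤x k≤y wx< wy< p<k k≤wp
  with balance₂ {n} {w ⁻¹} {k} {w · x} {w · y} {w · p} (supp-⁻¹ S) (inj≢ w x≢y) wx< wy<
         (subst (k ≤_) (sym (from-to w x)) k≤x) (subst (k ≤_) (sym (from-to w y)) k≤y) k≤wp (subst (_< k) (sym (from-to w p)) p<k)
... | q , q≢ , k≤q , lt = w ⁻¹ · q , (λ e → q≢ (trans (sym (to-from w q)) (cong (w ·_) e))) , lt , subst (k ≤_) (sym (to-from w q)) k≤q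

-- Both s_m s_{m+1} and s_{m+1} s_m lie below w.
Double : Perm → ℕ → Set
Double w m = (∃ λ p → p ≤ m × 2 + m ≤ w · p) × (∃ λ q → 2 + m ≤ q × w · q ≤ m)

module Doubles {n w} (S : Supp 0 n w) (Sm : Smoothₚ w) where

  open Smoothₚ Sm

  sorted : ∀ {P : ℕ → Set} {x y} → x ≢ y → P x → P y →
           ∃₂ λ z t → z < t × P z × P t × (w · z < w · t ⊎ w · t < w · z)
  sorted {x = x} {y} x≢y Px Py with <-cases x≢y
  ... | inj₁ p = x , y , p , Px , Py , <-cases (inj≢ w (<⇒≢ p))
  ... | inj₂ p = y , x , p , Py , Px , <-cases (inj≢ w (<⇒≢ p))

  -- If the entry at 1 + m lies between those at p and q, it is the middle of a 321. If not, it is a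
  -- second large or a second small entry at a cut beside it, and `balance₂` or `balance₂′` provides
  -- a pair on the opposite side; a decreasing pair completes a 321, an increasing one a 3412.
  double⇒321 : ∀ {m} → Double w m → ∃ λ i → ∃ λ j → ∃ λ k → P321 w i j k
  double⇒321 {m} ((p , p≤m , mwp) , (q , mq , wqm)) = cases (<-cases (inj≢ w (<⇒≢ (s≤s p≤m)))) (<-cases (inj≢ w (<⇒≢ mq)))
    where
    p<1+m : p < suc m
    p<1+m = s≤s p≤m
    cases : w · p < w · suc m ⊎ w · suc m < w · p → w · suc m < w · q ⊎ w · q < w · suc m → ∃ λ i → ∃ λ j → ∃ λ k → P321 w i j k
    cases (inj₂ c<p) (inj₂ q<c) = p , suc m , q , p<1+m , mq , q<c , c<p
    cases (inj₁ p<c) _ with balance₂ {x = p} {y = suc m} S (<⇒≢ p<1+m) (m≤n⇒m≤1+n p<1+m) (n<1+n _) mwp (≤-trans mwp (<⇒≤ p<c)) mq (s≤s (m≤n⇒m≤1+n wqm))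
    ... | q₂ , ne , mq₂ , wq₂ with sorted {λ t → 2 + m ≤ t × w · t < 2 + m} ne (mq₂ , wq₂) (mq , s≤s (m≤n⇒m≤1+n wqm))
    ... | z , t , z<t , (mz , wz) , (mt , wt) , inj₂ lt = p , z , t , <-≤-trans (m≤n⇒m≤1+n p<1+m) mz , z<t , lt , <-≤-trans wz mwp
    ... | z , t , z<t , (mz , wz) , (mt , wt) , inj₁ lt = ⊥-elim (a3412 p<1+m mz z<t lt (<-≤-trans wt mwp) p<c)
    cases (inj₂ c<p) (inj₁ c<q) with balance₂′ {x = suc m} {y = q} S (<⇒≢ mq) ≤-refl (<⇒≤ mq) (s≤s (<⇒≤ (<-≤-trans c<q wqm))) (s≤s wqm) p<1+m (<⇒≤ mwp)
    ... | p₂ , ne , p₂< , mwp₂ with sorted {λ t → t < suc m × suc m ≤ w · t} ne (p₂< , mwp₂) (p<1+m , <⇒≤ mwp)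
    ... | z , t , z<t , (z< , wz) , (t< , wt) , inj₂ lt = z , t , suc m , z<t , t< , <-≤-trans (<-≤-trans c<q wqm) (<⇒≤ wt) , lt
    ... | z , t , z<t , (z< , wz) , (t< , wt) , inj₁ lt = ⊥-elim (a3412 z<t t< mq c<q (≤-<-trans wqm wz) lt)

  Four : Set
  Four = (∃ λ i → ∃ λ j → ∃ λ k → ∃ λ l → P4321 w i j k l)
       ⊎ (∃ λ i → ∃ λ j → ∃ λ k → ∃ λ l → P3421 w i j k l)
       ⊎ (∃ λ i → ∃ λ j → ∃ λ k → ∃ λ l → P4312 w i j k l)

  -- Two large entries before the cut and two small ones after it form one of four patterns,
  -- according to the order within each pair, and smoothness rules out 3412.
  quad : ∀ {k p x q y} → p ≢ x → q ≢ y → (p < k × k ≤ w · p) → (x < k × k ≤ w · x) →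
         (k ≤ q × w · q < k) → (k ≤ y × w · y < k) → Four
  quad {k} p≢x q≢y Pp Px Qq Qy
    with sorted {λ t → t < k × k ≤ w · t} p≢x Pp Px | sorted {λ t → k ≤ t × w · t < k} q≢y Qq Qy
  ... | a , b , a<b , (a< , wa) , (b< , wb) , l₁ | c , d , c<d , (c≥ , wc) , (d≥ , wd) , l₂ = go l₁ l₂
    where
    b<c = <-≤-trans b< c≥
    go : w · a < w · b ⊎ w · b < w · a → w · c < w · d ⊎ w · d < w · c → Four
    go (inj₁ ab) (inj₁ cd) = ⊥-elim (a3412 a<b b<c c<d cd (<-≤-trans wd wa) ab)
    go (inj₂ ba) (inj₂ dc) = inj₁ (a , b , c , d , a<b , b<c , c<d , dc , <-≤-trans wc wb , ba)
    go (inj₁ ab) (inj₂ dc) = inj₂ (inj₁ (a , b , c , d , a<b , b<c , c<d , dc , <-≤-trans wc wa , ab))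
    go (inj₂ ba) (inj₁ cd) = inj₂ (inj₂ (a , b , c , d , a<b , b<c , c<d , cd , <-≤-trans wd wb , ba))

  doubles⇒four : ∀ {m} → Double w m → Double w (suc m) → Four
  doubles⇒four {m} ((p , p≤m , mwp) , (q , mq , wqm)) ((p′ , p′≤ , mwp′) , (q′ , mq′ , wq′≤)) = start (p ≟ p′) (q ≟ q′)
    where
    p< : p < 2 + m
    p< = s≤s (m≤n⇒m≤1+n p≤m)
    wq< : w · q < 2 + m
    wq< = s≤s (m≤n⇒m≤1+n wqm)
    twoHigh : ∀ {x} → p ≢ x → x < 2 + m → 2 + m ≤ w · x → Four
    twoHigh ne x< wx with balance₂ S ne p< x< mwp wx mq wq<
    ... | q₂ , ne₂ , mq₂ , wq₂ = quad ne (λ e → ne₂ (sym e)) (p< , mwp) (x< , wx) (mq , wq<) (mq₂ , wq₂)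
    twoLow : ∀ {y} → q ≢ y → 2 + m ≤ y → w · y < 2 + m → Four
    twoLow ne y≥ wy with balance₂′ S ne mq y≥ wq< wy p< mwp
    ... | p₂ , ne₂ , p₂< , wp₂ = quad (λ e → ne₂ (sym e)) ne (p< , mwp) (p₂< , wp₂) (mq , wq<) (y≥ , wy)
    start : Dec (p ≡ p′) → Dec (q ≡ q′) → Four
    start (no ne) _ = twoHigh ne (s≤s p′≤) (<⇒≤ mwp′)
    start (yes _) (no ne) = twoLow ne (<⇒≤ mq′) (s≤s wq′≤)
    -- With p and q shared, the entries at 1 + m and 2 + m decide. Unless one of them is a second
    -- large or small entry at the cut 2 + m, they increase. They cannot both lie between the
    -- entries at p and q, as this would be a 4231, and one that falls outside yields the missing
    -- pair at the cut 1 + m or 3 + m.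
    start (yes refl) (yes refl) with 2 + m ≤? w · suc m | w · (2 + m) <? 2 + m
    ... | yes s | _ = twoHigh (<⇒≢ (s≤s p≤m)) (n<1+n _) s
    ... | no _  | yes s = twoLow (λ e → <⇒≢ mq′ (sym e)) ≤-refl s
    ... | no s  | no t = finish (<-cases (inj≢ w (<⇒≢ mq))) (<-cases (inj≢ w (<⇒≢ p<)))
      where
      i<i₁ : w · suc m < w · (2 + m)
      i<i₁ = <-≤-trans (≰⇒> s) (≮⇒≥ t)
      finish : w · suc m < w · q ⊎ w · q < w · suc m → w · p < w · (2 + m) ⊎ w · (2 + m) < w · p → Four
      finish (inj₂ qi) (inj₂ ip) = ⊥-elim (a4231 (s≤s p≤m) (n<1+n _) mq′ qi i<i₁ ip)
      finish (inj₁ iq) _ with balance₂′ {x = suc m} {y = q} S (<⇒≢ mq) ≤-refl (<⇒≤ mq) (s≤s (<⇒≤ (<-≤-trans iq wqm))) (s≤s wqm) (s≤s p≤m) (<⇒≤ mwp)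
      ... | p₂ , ne , p₂< , wp₂ with sorted {λ t → t < suc m × suc m ≤ w · t} ne (p₂< , wp₂) (s≤s p≤m , <⇒≤ mwp)
      ... | z , t , z<t , (z< , wz) , (t< , wt) , inj₂ lt = inj₂ (inj₂ (z , t , suc m , q , z<t , t< , mq , iq , ≤-<-trans wqm wt , lt))
      ... | z , t , z<t , (z< , wz) , (t< , wt) , inj₁ lt = ⊥-elim (a3412 z<t t< mq iq (≤-<-trans wqm wz) lt)
      finish (inj₂ _) (inj₁ pi) with balance₂ {x = p} {y = 2 + m} S (<⇒≢ p<) (m≤n⇒m≤1+n p<) (n<1+n _) mwp′ (≤-trans mwp′ (<⇒≤ pi)) mq′ (s≤s (m≤n⇒m≤1+n (m≤n⇒m≤1+n wqm)))
      ... | q₂ , ne , mq₂ , wq₂ with sorted {λ t → 3 + m ≤ t × w · t < 3 + m} ne (mq₂ , wq₂) (mq′ , s≤s (m≤n⇒m≤1+n (m≤n⇒m≤1+n wqm)))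
      ... | z , t , z<t , (mz , wz) , (mt , wt) , inj₂ lt = inj₂ (inj₁ (p , 2 + m , z , t , p< , mz , z<t , lt , <-≤-trans wz mwp′ , pi))
      ... | z , t , z<t , (mz , wz) , (mt , wt) , inj₁ lt = ⊥-elim (a3412 p< mz z<t lt (<-≤-trans wt mwp′) pi)

-- At most two neighbours of i can be double, at the adjacent indices i - 1 and i. The cases
-- correspond to two, one and no such indices; the existence of a larger pattern is tested instead
-- of the count, as it yields the coatom directly.
extras-match-doubles : ∀ {n w} → Supp 0 n w → Smoothₚ w →
  OneExtra w ⊎ (FullCoatom w × (∀ m → Double w m → Double w (suc m) → ⊥)) ⊎ (∀ m → Double w m → ⊥)
extras-match-doubles S Sm with Search.find-4321 S
... | inj₁ (_ , _ , _ , _ , p) = inj₁ (Patterns.extra-4321 Sm p)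
... | inj₂ f with Search.find-3421 S | Search.find-4312 S
... | inj₁ (_ , _ , _ , _ , p) | _ = inj₁ (Patterns.extra-3421 Sm f p)
... | inj₂ _ | inj₁ (_ , _ , _ , _ , p) = inj₁ (Patterns.extra-4312 Sm f p)
... | inj₂ g | inj₂ h with Search.find-321 S
... | inj₂ k = inj₂ (inj₂ λ m d → let (_ , _ , _ , p) = Doubles.double⇒321 S Sm d in k p)
... | inj₁ (_ , _ , _ , p) = inj₂ (inj₁ (Patterns.coatom-321 Sm p , λ m d d′ →
    [ (λ (_ , _ , _ , _ , p) → f p) , [ (λ (_ , _ , _ , _ , p) → g p) , (λ (_ , _ , _ , _ , p) → h p) ] ]
      (Doubles.doubles⇒four S Sm d d′)))

-- The length of a word after a swap

Σₙ : ∀ {n} → (Fin n → ℕ) → ℕ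
Σₙ f = Vec.sum (tabulate f)

Σₙ-cong : ∀ {n} {f g : Fin n → ℕ} → (∀ i → f i ≡ g i) → Σₙ f ≡ Σₙ g
Σₙ-cong h = cong Vec.sum (Vecₚ.tabulate-cong h)

Σₙ-mono : ∀ {n} {f g : Fin n → ℕ} → (∀ i → f i ≤ g i) → Σₙ f ≤ Σₙ g
Σₙ-mono {zero}  h = z≤n
Σₙ-mono {suc n} h = +-mono-≤ (h Fin.zero) (Σₙ-mono (h ∘ Fin.suc))

Σₙ-+ : ∀ {n} (f g : Fin n → ℕ) → Σₙ (λ i → f i + g i) ≡ Σₙ f + Σₙ g
Σₙ-+ {zero}  f g = refl
Σₙ-+ {suc n} f g = trans (cong (f Fin.zero + g Fin.zero +_) (Σₙ-+ (f ∘ Fin.suc) (g ∘ Fin.suc)))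
  (solve 4 (λ a b c d → (a :+ b) :+ (c :+ d) := (a :+ c) :+ (b :+ d)) refl
     (f Fin.zero) (g Fin.zero) (Σₙ (f ∘ Fin.suc)) (Σₙ (g ∘ Fin.suc)))
  where open +-*-Solver

mask : ∀ {n} → Fin n → (Fin n → ℕ) → Fin n → ℕ
mask i f k = if does (k Fin.≟ i) then 0 else f k

mask-at : ∀ {n} (i : Fin n) f → mask i f i ≡ 0
mask-at i f rewrite dec-true (i Fin.≟ i) refl = refl

mask-off : ∀ {n} {i k : Fin n} f → k ≢ i → mask i f k ≡ f k
mask-off {i = i} {k} f k≢i rewrite dec-false (k Fin.≟ i) k≢i = refl

Σₙ-pick : ∀ {n} (i : Fin n) (f : Fin n → ℕ) → Σₙ f ≡ f i + Σₙ (mask i f)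
Σₙ-pick {suc n} Fin.zero f = cong (f Fin.zero +_) (Σₙ-cong λ k → sym (mask-off {i = Fin.zero} {Fin.suc k} f λ ()))
Σₙ-pick {suc n} (Fin.suc i) f = trans (cong₂ _+_ (sym (mask-off {i = Fin.suc i} {Fin.zero} f λ ()))
    (trans (Σₙ-pick i (f ∘ Fin.suc)) (cong (f (Fin.suc i) +_) (Σₙ-cong λ k → lemma k (k Fin.≟ i)))))
  (solve 3 (λ a b c → a :+ (b :+ c) := b :+ (a :+ c)) refl (mask (Fin.suc i) f Fin.zero) (f (Fin.suc i)) _)
  where
  open +-*-Solver
  lemma : ∀ k → Dec (k ≡ i) → mask i (f ∘ Fin.suc) k ≡ mask (Fin.suc i) f (Fin.suc k)
  lemma k (yes refl) = trans (mask-at k (f ∘ Fin.suc)) (sym (mask-at (Fin.suc k) f))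
  lemma k (no k≢i)   = trans (mask-off (f ∘ Fin.suc) k≢i) (sym (mask-off f (k≢i ∘ Finₚ.suc-injective)))

module TwoOut {n} {i j : Fin n} (i≢j : i ≢ j) where

  rest : (Fin n → ℕ) → ℕ
  rest f = Σₙ (mask j (mask i f))

  split : ∀ f → Σₙ f ≡ (f i + f j) + rest f
  split f = trans (Σₙ-pick i f) (trans (cong (f i +_) (trans (Σₙ-pick j (mask i f)) (cong (_+ rest f) (mask-off f (i≢j ∘ sym)))))
    (sym (+-assoc (f i) (f j) (rest f))))

  mask²-cases : ∀ (Q : ℕ → ℕ → Set) f g k → Q 0 0 → (k ≢ i → k ≢ j → Q (f k) (g k)) →
                Q (mask j (mask i f) k) (mask j (mask i g) k)
  mask²-cases Q f g k z h with k Fin.≟ j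
  ... | yes _ = z
  ... | no k≢j with k Fin.≟ i
  ... | yes _ = z
  ... | no k≢i = h k≢i k≢j

  rest-mono : ∀ {f g} → (∀ k → k ≢ i → k ≢ j → f k ≤ g k) → rest f ≤ rest g
  rest-mono {f} {g} h = Σₙ-mono λ k → mask²-cases _≤_ f g k z≤n (h k)

  rest-cong : ∀ {f g} → (∀ k → k ≢ i → k ≢ j → f k ≡ g k) → rest f ≡ rest g
  rest-cong {f} {g} h = Σₙ-cong λ k → mask²-cases _≡_ f g k refl (h k)

  rest-+ : ∀ f g → rest (λ k → f k + g k) ≡ rest f + rest g
  rest-+ f g = trans (Σₙ-cong λ k → masked k) (Σₙ-+ (mask j (mask i f)) (mask j (mask i g)))
    where
    masked : ∀ k → mask j (mask i (λ k → f k + g k)) k ≡ mask j (mask i f) k + mask j (mask i g) k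
    masked k with k Fin.≟ j
    ... | yes _ = refl
    ... | no _ with k Fin.≟ i
    ... | yes _ = refl
    ... | no _  = refl

  core : (Fin n → Fin n → ℕ) → ℕ
  core G = (G i i + G i j) + (G j i + G j j)

  arms : (Fin n → Fin n → ℕ) → Fin n → ℕ
  arms G k = (G i k + G j k) + (G k i + G k j)

  -- The cells of the square are sorted by how many of their two indices belong to {i, j}: both,
  -- one, or none. A swap of i and j leaves the inversions of the last kind alone.
  split² : ∀ G → Σₙ (λ p → Σₙ (G p)) ≡ core G + (rest (arms G) + rest (λ p → rest (G p)))
  split² G = trans (split (λ p → Σₙ (G p)))
    (trans (cong₂ _+_ (cong₂ _+_ (split (G i)) (split (G j)))
       (trans (rest-cong (λ p _ _ → split (G p))) (rest-+ (λ p → G p i + G p j) (λ p → rest (G p)))))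
    (trans (solve 6 (λ a b c d e f → ((a :+ b) :+ (c :+ d)) :+ (e :+ f) := (a :+ c) :+ (((b :+ d) :+ e) :+ f)) refl
              (G i i + G i j) (rest (G i)) (G j i + G j j) (rest (G j)) (rest (λ p → G p i + G p j)) (rest (λ p → rest (G p))))
      (cong (λ t → core G + (t + rest (λ p → rest (G p))))
        (trans (cong (_+ rest (λ p → G p i + G p j)) (sym (rest-+ (G i) (G j)))) (sym (rest-+ (λ k → G i k + G j k) (λ p → G p i + G p j)))))))
    where open +-*-Solver

lt? : ∀ {n} → Fin n → Fin n → ℕ
lt? x y = if does (x Fin.<? y) then 1 else 0

lt?-yes : ∀ {n} {x y : Fin n} → x Fin.< y → lt? x y ≡ 1
lt?-yes {x = x} {y} p rewrite dec-true (x Fin.<? y) p = refl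

lt?-no : ∀ {n} {x y : Fin n} → ¬ x Fin.< y → lt? x y ≡ 0
lt?-no {x = x} {y} p rewrite dec-false (x Fin.<? y) p = refl

lt?-mono : ∀ {n} {x y x′ y′ : Fin n} → (x Fin.< y → x′ Fin.< y′) → lt? x y ≤ lt? x′ y′
lt?-mono {x = x} {y} {x′} {y′} h = go (x Fin.<? y)
  where
  go : Dec (x Fin.< y) → lt? x y ≤ lt? x′ y′
  go (yes p) = ≤-reflexive (trans (lt?-yes p) (sym (lt?-yes (h p))))
  go (no ¬p) = subst (_≤ lt? x′ y′) (sym (lt?-no ¬p)) z≤n

inv? : ∀ {n} → Word n → Fin n → Fin n → ℕ
inv? w p q = if does (p Fin.<? q) ∧ does (lookup w q Fin.<? lookup w p) then 1 else 0

inv?-lt : ∀ {n} (w : Word n) {p q} → p Fin.< q → inv? w p q ≡ lt? (lookup w q) (lookup w p)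
inv?-lt w {p} {q} r rewrite dec-true (p Fin.<? q) r = refl

inv?-≥ : ∀ {n} (w : Word n) {p q} → ¬ p Fin.< q → inv? w p q ≡ 0
inv?-≥ w {p} {q} r rewrite dec-false (p Fin.<? q) r = refl

swapPos-l : ∀ {n} (w : Word n) {i j} → i ≢ j → lookup (swapPos w i j) i ≡ lookup w j
swapPos-l w {i} {j} i≢j = trans (Vecₚ.lookup∘update′ i≢j (w Vec.[ i ]≔ lookup w j) (lookup w i)) (Vecₚ.lookup∘update i w (lookup w j))

swapPos-r : ∀ {n} (w : Word n) i j → lookup (swapPos w i j) j ≡ lookup w i
swapPos-r w i j = Vecₚ.lookup∘update j (w Vec.[ i ]≔ lookup w j) (lookup w i)

swapPos-o : ∀ {n} (w : Word n) {i j k} → k ≢ i → k ≢ j → lookup (swapPos w i j) k ≡ lookup w k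
swapPos-o w {i} {j} k≢i k≢j = trans (Vecₚ.lookup∘update′ k≢j (w Vec.[ i ]≔ lookup w j) (lookup w i)) (Vecₚ.lookup∘update′ k≢i w (lookup w j))

module SwapLen {n} (u : Word n) {i j : Fin n} (i<j : i Fin.< j) (up : lookup u i Fin.< lookup u j) where

  i≢j : i ≢ j
  i≢j refl = <-irrefl refl i<j

  open TwoOut i≢j

  v : Word n
  v = swapPos u i j

  vi : lookup v i ≡ lookup u j
  vi = swapPos-l u i≢j

  vj : lookup v j ≡ lookup u i
  vj = swapPos-r u i j

  inner : rest (λ p → rest (inv? v p)) ≡ rest (λ p → rest (inv? u p))
  inner = rest-cong λ p p≢i p≢j → rest-cong λ q q≢i q≢j →
    cong₂ (λ x y → if does (p Fin.<? q) ∧ does (x Fin.<? y) then 1 else 0) (swapPos-o u q≢i q≢j) (swapPos-o u p≢i p≢j)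

  core-u : core (inv? u) ≡ 0
  core-u = cong₂ _+_ (cong₂ _+_ (inv?-≥ u {i} {i} (<-irrefl refl)) (trans (inv?-lt u i<j) (lt?-no (<-asym up))))
                     (cong₂ _+_ (inv?-≥ u (<-asym i<j)) (inv?-≥ u {j} {j} (<-irrefl refl)))

  core-v : core (inv? v) ≡ 1
  core-v = cong₂ _+_ (cong₂ _+_ (inv?-≥ v {i} {i} (<-irrefl refl)) (trans (inv?-lt v i<j) (trans (cong₂ lt? vj vi) (lt?-yes up))))
                     (cong₂ _+_ (inv?-≥ v (<-asym i<j)) (inv?-≥ v {j} {j} (<-irrefl refl)))

  arms-mid : ∀ (w : Word n) {k} → i Fin.< k → k Fin.< j →
             arms (inv? w) k ≡ lt? (lookup w k) (lookup w i) + lt? (lookup w j) (lookup w k)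
  arms-mid w {k} p q = cong₂ _+_
    (trans (cong₂ _+_ (inv?-lt w p) (inv?-≥ w (<-asym q))) (+-identityʳ _))
    (cong₂ _+_ (inv?-≥ w (<-asym p)) (inv?-lt w q))

  arms-lo : ∀ (w : Word n) {k} → k Fin.< i →
            arms (inv? w) k ≡ lt? (lookup w i) (lookup w k) + lt? (lookup w j) (lookup w k)
  arms-lo w {k} p = cong₂ _+_ (cong₂ _+_ (inv?-≥ w (<-asym p)) (inv?-≥ w (<-asym (<-trans p i<j))))
                              (cong₂ _+_ (inv?-lt w p) (inv?-lt w (<-trans p i<j)))

  arms-hi : ∀ (w : Word n) {k} → j Fin.< k →
            arms (inv? w) k ≡ lt? (lookup w k) (lookup w i) + lt? (lookup w k) (lookup w j)
  arms-hi w {k} p = trans (cong₂ _+_ (cong₂ _+_ (inv?-lt w (<-trans i<j p)) (inv?-lt w p))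
                              (cong₂ _+_ (inv?-≥ w (<-asym (<-trans i<j p))) (inv?-≥ w (<-asym p)))) (+-identityʳ _)

  data Place (k : Fin n) : Set where
    lo  : k Fin.< i → Place k
    mid : i Fin.< k → k Fin.< j → Place k
    hi  : j Fin.< k → Place k

  place : ∀ k → k ≢ i → k ≢ j → Place k
  place k k≢i k≢j with Finₚ.<-cmp k i | Finₚ.<-cmp k j
  ... | tri< p _ _ | _          = lo p
  ... | tri≈ _ p _ | _          = ⊥-elim (k≢i p)
  ... | tri> _ _ _ | tri> _ _ q = hi q
  ... | tri> _ _ _ | tri≈ _ q _ = ⊥-elim (k≢j q)
  ... | tri> _ _ p | tri< q _ _ = mid p q

  -- For k outside the interval from i to j the swap merely exchanges two summands, so only the k in
  -- between matter. `Q` is later ≤, for the growth of the length, and ≡, for covers.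
  arms-cmp : ∀ (Q : ℕ → ℕ → Set) → (∀ x → Q x x) →
             (∀ k → i Fin.< k → k Fin.< j → Q (lt? (lookup u k) (lookup u i) + lt? (lookup u j) (lookup u k))
                                              (lt? (lookup u k) (lookup u j) + lt? (lookup u i) (lookup u k))) →
             ∀ k → k ≢ i → k ≢ j → Q (arms (inv? u) k) (arms (inv? v) k)
  arms-cmp Q r m k k≢i k≢j with place k k≢i k≢j | swapPos-o u k≢i k≢j
  ... | lo p | vk = subst₂ Q (sym (arms-lo u p)) (sym (trans (arms-lo v p) (trans (cong₂ _+_ (cong₂ lt? vi vk) (cong₂ lt? vj vk)) (+-comm (lt? (lookup u j) (lookup u k)) _)))) (r _)
  ... | hi p | vk = subst₂ Q (sym (arms-hi u p)) (sym (trans (arms-hi v p) (trans (cong₂ _+_ (cong₂ lt? vk vi) (cong₂ lt? vk vj)) (+-comm (lt? (lookup u k) (lookup u j)) _)))) (r _)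
  ... | mid p q | vk = subst₂ Q (sym (arms-mid u p q)) (sym (trans (arms-mid v p q) (cong₂ _+_ (cong₂ lt? vk vi) (cong₂ lt? vj vk)))) (m k p q)

  len-u : len u ≡ rest (arms (inv? u)) + rest (λ p → rest (inv? u p))
  len-u = trans (split² (inv? u)) (cong (_+ (rest (arms (inv? u)) + rest (λ p → rest (inv? u p)))) core-u)

  len-v : len v ≡ suc (rest (arms (inv? v)) + rest (λ p → rest (inv? u p)))
  len-v = trans (split² (inv? v)) (cong₂ _+_ core-v (cong (rest (arms (inv? v)) +_) inner))

  len-< : len u < len v
  len-< = subst₂ _<_ (sym len-u) (sym len-v) (s≤s (+-monoˡ-≤ (rest (λ p → rest (inv? u p))) (rest-mono (arms-cmp _≤_ (λ _ → ≤-refl)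
    λ k _ _ → +-mono-≤ (lt?-mono {y = lookup u i} {y′ = lookup u j} (λ p → <-trans p up)) (lt?-mono {x = lookup u j} {y = lookup u k} {y′ = lookup u k} (<-trans up))))))

  len-suc : (∀ k → i Fin.< k → k Fin.< j → lookup u i Fin.< lookup u k → lookup u k Fin.< lookup u j → ⊥) →
            (∀ k → k ≢ i → lookup u k ≢ lookup u i) → (∀ k → k ≢ j → lookup u k ≢ lookup u j) → len v ≡ suc (len u)
  len-suc empty ≢i ≢j = trans len-v (cong suc (trans (cong (_+ rest (λ p → rest (inv? u p))) (sym (rest-cong (arms-cmp _≡_ (λ _ → refl) same)))) (sym len-u)))
    where
    same : ∀ k → i Fin.< k → k Fin.< j → lt? (lookup u k) (lookup u i) + lt? (lookup u j) (lookup u k)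
                                        ≡ lt? (lookup u k) (lookup u j) + lt? (lookup u i) (lookup u k)
    same k p q with Finₚ.<-cmp (lookup u k) (lookup u i) | Finₚ.<-cmp (lookup u k) (lookup u j)
    ... | tri≈ _ e _ | _ = ⊥-elim (≢i k (λ { refl → <-irrefl refl p }) e)
    ... | _ | tri≈ _ e _ = ⊥-elim (≢j k (λ { refl → <-irrefl refl q }) e)
    ... | tri< a _ _ | _ = cong₂ _+_ (trans (lt?-yes a) (sym (lt?-yes (<-trans a up))))
                                     (trans (lt?-no (<-asym (<-trans a up))) (sym (lt?-no (<-asym a))))
    ... | tri> _ _ a | tri> _ _ b = cong₂ _+_ (trans (lt?-no (<-asym a)) (sym (lt?-no (<-asym b)))) (trans (lt?-yes b) (sym (lt?-yes a)))
    ... | tri> _ _ a | tri< b _ _ = ⊥-elim (empty k p q a b)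

-- Bruhat order on words

record Rep {n} (w : Word n) (u : Perm) : Set where
  constructor rep
  field
    at      : ∀ i → u · toℕ i ≡ toℕ (lookup w i)
    support : Supp 0 n u

open Rep

word-ext : ∀ {n} {u v : Word n} → (∀ i → lookup u i ≡ lookup v i) → u ≡ v
word-ext {u = u} {v} h = trans (sym (Vecₚ.tabulate∘lookup u)) (trans (Vecₚ.tabulate-cong h) (Vecₚ.tabulate∘lookup v))

module _ {n : ℕ} where

  extend : (Fin n → Fin n) → ℕ → ℕ
  extend f i with i <? n
  ... | yes p = toℕ (f (fromℕ< p))
  ... | no _  = i

  extend-in : ∀ f (i : Fin n) → extend f (toℕ i) ≡ toℕ (f i)
  extend-in f i with toℕ i <? n
  ... | yes p = cong (toℕ ∘ f) (Finₚ.fromℕ<-toℕ i p)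
  ... | no p  = ⊥-elim (p (Finₚ.toℕ<n i))

  extend-out : ∀ f {i} → n ≤ i → extend f i ≡ i
  extend-out f {i} n≤i with i <? n
  ... | yes p = ⊥-elim (<⇒≱ p n≤i)
  ... | no _  = refl

  extend-inv : ∀ f g → (∀ i → g (f i) ≡ i) → ∀ i → extend g (extend f i) ≡ i
  extend-inv f g h i = go (i <? n)
    where
    go : Dec (i < n) → extend g (extend f i) ≡ i
    go (yes p) = subst (λ k → extend g (extend f k) ≡ k) (Finₚ.toℕ-fromℕ< p)
      (trans (cong (extend g) (extend-in f (fromℕ< p))) (trans (extend-in g _) (cong toℕ (h _))))
    go (no p)  = trans (cong (extend g) (extend-out f (≮⇒≥ p))) (extend-out g (≮⇒≥ p))

  onto : ∀ (w : Word n) → IsPerm w → ∀ j → ∃ λ i → lookup w i ≡ j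
  onto w p j with Finₚ.any? (λ i → lookup w i Fin.≟ j)
  ... | yes r = r
  ... | no ¬r = ⊥-elim (absurd w p j ¬r)
    where
    absurd : ∀ {m} (w : Vec (Fin m) m) → (∀ i j → lookup w i ≡ lookup w j → i ≡ j) → ∀ j → ¬ (∃ λ i → lookup w i ≡ j) → ⊥
    absurd {suc m} w p j ¬r = <-irrefl refl (Finₚ.injective⇒≤ {f = λ i → Fin.punchOut {i = j} {j = lookup w i} (λ e → ¬r (i , sym e))}
      λ {a} {b} e → p a b (Finₚ.punchOut-injective (λ e → ¬r (a , sym e)) (λ e → ¬r (b , sym e)) e))

  rep-of : ∀ {w : Word n} → IsPerm w → Σ Perm (Rep w)
  rep-of {w} p = record
    { to = extend (lookup w) ; from = extend back
    ; from-to = extend-inv (lookup w) back (λ i → p _ _ (proj₂ (onto w p (lookup w i))))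
    ; to-from = extend-inv back (lookup w) (λ i → proj₂ (onto w p i))
    } , rep (extend-in (lookup w)) (supp λ { i (inj₂ le) → extend-out (lookup w) le })
    where
    back : Fin n → Fin n
    back i = proj₁ (onto w p i)

  word-of : ∀ {u} → Supp 0 n u → Σ (Word n) λ w → Rep w u
  word-of {u} S = tabulate (λ i → fromℕ< (supp-hi S (Finₚ.toℕ<n i)))
    , rep (λ i → sym (trans (cong toℕ (Vecₚ.lookup∘tabulate _ i)) (Finₚ.toℕ-fromℕ< _))) S

  rep⇒isPerm : ∀ {w : Word n} {u} → Rep w u → IsPerm w
  rep⇒isPerm {u = u} r i j e = Finₚ.toℕ-injective (inj u (trans (at r i) (trans (cong toℕ e) (sym (at r j)))))

  rep-unique : ∀ {w : Word n} {u v} → Rep w u → Rep w v → u ≈ v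
  rep-unique {u = u} {v} r s i with i <? n
  ... | no p  = trans (fix (support r) i (inj₂ (≮⇒≥ p))) (sym (fix (support s) i (inj₂ (≮⇒≥ p))))
  ... | yes p = subst (λ k → u · k ≡ v · k) (Finₚ.toℕ-fromℕ< p) (trans (at r (fromℕ< p)) (sym (at s (fromℕ< p))))

  rep-≡ : ∀ {w w′ : Word n} {u u′} → Rep w u → Rep w′ u′ → u ≈ u′ → w ≡ w′
  rep-≡ r s e = word-ext λ i → Finₚ.toℕ-injective (trans (sym (at r i)) (trans (e _) (at s i)))

  rep-e : Rep {n} e idₚ
  rep-e = rep (λ i → sym (cong toℕ (Vecₚ.lookup∘tabulate id i))) (supp λ _ _ → refl)

  rep-swap : ∀ {w : Word n} {u} → Rep w u → ∀ {i j} → i ≢ j → Rep (swapPos w i j) (u ∘ₚ tr (toℕ i) (toℕ j))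
  rep-swap {w} {u} r {i} {j} i≢j = rep vals
    (supp-∘ {u = u} {v = tr (toℕ i) (toℕ j)} (support r) (supp-tr z≤n z≤n (Finₚ.toℕ<n i) (Finₚ.toℕ<n j)))
    where
    vals : ∀ k → u · (tr (toℕ i) (toℕ j) · toℕ k) ≡ toℕ (lookup (swapPos w i j) k)
    vals k with k Fin.≟ i | k Fin.≟ j
    ... | _ | yes refl = trans (cong (u ·_) (trTo-r (toℕ i) (toℕ k))) (trans (at r i) (cong toℕ (sym (swapPos-r w i k))))
    ... | yes refl | no _ = trans (cong (u ·_) (trTo-l (toℕ k) (toℕ j))) (trans (at r j) (cong toℕ (sym (swapPos-l w i≢j))))
    ... | no a | no b = trans (cong (u ·_) (trTo-o (toℕ i) (toℕ j) (a ∘ Finₚ.toℕ-injective) (b ∘ Finₚ.toℕ-injective)))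
                          (trans (at r k) (cong toℕ (sym (swapPos-o w a b))))

  lt-at : ∀ {w : Word n} {u i j} → Rep w u → u · toℕ i < u · toℕ j → lookup w i Fin.< lookup w j
  lt-at {i = i} {j} r = subst₂ _<_ (at r i) (at r j)

  at-lt : ∀ {w : Word n} {u i j} → Rep w u → lookup w i Fin.< lookup w j → u · toℕ i < u · toℕ j
  at-lt {i = i} {j} r = subst₂ _<_ (sym (at r i)) (sym (at r j))

  swapPos² : ∀ (w : Word n) {i j} → i ≢ j → swapPos (swapPos w i j) i j ≡ w
  swapPos² w {i} {j} i≢j = word-ext vals
    where
    vals : ∀ k → lookup (swapPos (swapPos w i j) i j) k ≡ lookup w k
    vals k with k Fin.≟ i | k Fin.≟ j
    ... | _ | yes refl = trans (swapPos-r (swapPos w i k) i k) (swapPos-l w i≢j)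
    ... | yes refl | no _ = trans (swapPos-l (swapPos w k j) i≢j) (swapPos-r w k j)
    ... | no a | no b = trans (swapPos-o (swapPos w i j) a b) (swapPos-o w a b)

  -- Permutations are propagated downwards by undoing the swap. The local condition u i < u j
  -- follows from the growth of the length, since the opposite inequality would make the swap
  -- shorten u.
  step-below : ∀ {u v : Word n} {y} → Rep v y → BStep u v → ∃ λ x → Rep u x × x ⇝ y
  step-below {u} {v} {y} r (i , j , i<j , refl , lt) = y ∘ₚ tr (toℕ i) (toℕ j) , Ru , ⇝-swap y i<j down
    where
    i≢j : i ≢ j
    i≢j refl = <-irrefl refl i<j
    Ru : Rep u (y ∘ₚ tr (toℕ i) (toℕ j))
    Ru = subst (λ w → Rep w _) (swapPos² u i≢j) (rep-swap r i≢j)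
    down : y · toℕ j < y · toℕ i
    down with <-cases (inj≢ y (λ e → i≢j (Finₚ.toℕ-injective e)))
    ... | inj₂ p = p
    ... | inj₁ p = ⊥-elim (<-asym lt (subst (λ w → len (swapPos u i j) < len w) (swapPos² u i≢j) (SwapLen.len-< (swapPos u i j) i<j (lt-at r p))))

  ⇝⇒BStep : ∀ {u v : Word n} {x y} → Rep u x → Rep v y → x ⇝ y → BStep u v
  ⇝⇒BStep {u} {v} {x} {y} r s (i , j , i<j , lt , e) =
    I , J , I<J , v≡ , subst (λ w → len u < len w) (sym v≡) (SwapLen.len-< u I<J (lt-at r (subst₂ (λ a b → x · a < x · b) (sym tI) (sym tJ) lt)))
    where
    j<n : j < n
    j<n = proj₂ (step-supp′ (support s))
      where
      step-supp′ : Supp 0 n y → 0 ≤ i × j < n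
      step-supp′ S = supp-inversion S i<j (subst₂ _<_ (sym (trans (e j) (cong (x ·_) (trTo-r i j)))) (sym (trans (e i) (cong (x ·_) (trTo-l i j)))) lt)
    i<n = <-trans i<j j<n
    I = fromℕ< i<n
    J = fromℕ< j<n
    tI = Finₚ.toℕ-fromℕ< i<n
    tJ = Finₚ.toℕ-fromℕ< j<n
    I<J : I Fin.< J
    I<J = subst₂ _<_ (sym tI) (sym tJ) i<j
    v≡ : v ≡ swapPos u I J
    v≡ = rep-≡ s (rep-swap r (λ q → <-irrefl (cong toℕ q) I<J)) (λ k → trans (e k) (cong₂ (λ a b → x · trTo a b k) (sym tI) (sym tJ)))

  len-mono : ∀ {u v : Word n} → u ≤B v → u ≡ v ⊎ len u < len v
  len-mono ε = inj₁ refl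
  len-mono ((_ , _ , _ , _ , lt) ◅ s) with len-mono s
  ... | inj₁ refl = inj₂ lt
  ... | inj₂ p    = inj₂ (<-trans lt p)

  len-mono-≤ : ∀ {u v : Word n} → u ≤B v → len u ≤ len v
  len-mono-≤ s = [ (λ p → ≤-reflexive (cong len p)) , <⇒≤ ] (len-mono s)

  rep-below : ∀ {u v : Word n} {y} → u ≤B v → Rep v y → Σ Perm (Rep u)
  rep-below ε r = _ , r
  rep-below (s ◅ t) r = let (_ , r′) = rep-below t r ; (x , q , _) = step-below r′ s in x , q

  monotone⇒id : ∀ {y} → (∀ {i j} → i < j → y · i < y · j) → y ≈ idₚ
  monotone⇒id {y} mono i = ≤-antisym (subst (y · i ≤_) (from-to y i) (grow (y ⁻¹) mono⁻¹ (y · i))) (grow y mono i)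
    where
    grow : ∀ y → (∀ {i j} → i < j → y · i < y · j) → ∀ i → i ≤ y · i
    grow y m zero = z≤n
    grow y m (suc i) = ≤-<-trans (grow y m i) (m (n<1+n i))
    mono⁻¹ : ∀ {i j} → i < j → y ⁻¹ · i < y ⁻¹ · j
    mono⁻¹ {i} {j} i<j with <-cases (inj≢ (y ⁻¹) (<⇒≢ i<j))
    ... | inj₁ p = p
    ... | inj₂ p = ⊥-elim (<-asym i<j (subst₂ _<_ (to-from y j) (to-from y i) (mono p)))

  descend : ∀ {w : Word n} {y} → Rep w y → w ≡ e ⊎ (∃₂ λ z x → Rep z x × BStep z w)
  descend {w} {y} r with anyUpTo? (λ j → anyUpTo? (λ i → y · j <? y · i) j) n
  ... | no ¬p = inj₁ (rep-≡ r rep-e (monotone⇒id {y} mono))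
    where
    mono : ∀ {i j} → i < j → y · i < y · j
    mono {i} {j} i<j with <-cases (inj≢ y (<⇒≢ i<j))
    ... | inj₁ p = p
    ... | inj₂ p = ⊥-elim (¬p (j , proj₂ (supp-inversion (support r) i<j p) , i , i<j , p))
  ... | yes (j , _ , i , i<j , p) = inj₂ (proj₁ z , y ∘ₚ tr i j , proj₂ z
        , ⇝⇒BStep {x = y ∘ₚ tr i j} {y = y} (proj₂ z) r (⇝-swap y i<j p))
    where
    j<n : j < n
    j<n = proj₂ (supp-inversion (support r) i<j p)
    z : Σ (Word n) λ z → Rep z (y ∘ₚ tr i j)
    z = word-of (supp-∘ {u = y} {v = tr i j} (support r) (supp-tr z≤n z≤n (<-trans i<j j<n) j<n))

  e-least : ∀ {w : Word n} {y} → Rep w y → e ≤B w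
  e-least {w} = go (len w) ≤-refl
    where
    go : ∀ k {w : Word n} {y} → len w ≤ k → Rep w y → e ≤B w
    go k le r with descend r
    ... | inj₁ refl = ε
    go zero le r | inj₂ (z , x , rz , s@(_ , _ , _ , _ , lt)) = ⊥-elim (<⇒≱ lt (≤-trans le z≤n))
    go (suc k) le r | inj₂ (z , x , rz , s@(_ , _ , _ , _ , lt)) = go k {z} {x} (≤-pred (<-≤-trans lt le)) rz ◅◅ (s ◅ ε)

  minInv⇒covers : ∀ {u v : Word n} {y p q} → Rep v y → MinInv y p q → Rep u (y ∘ₚ tr p q) → Covers u v × len v ≡ suc (len u)
  minInv⇒covers {u} {v} {y} {p} {q} r m s = (step ◅ ε , u≢v , between) , len≡
    where
    open MinInv m
    x = y ∘ₚ tr p q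
    step : BStep u v
    step = ⇝⇒BStep s r (⇝-swap y pos desc)
    q<n = proj₂ (supp-inversion (support r) pos desc)
    p<n = <-trans pos q<n
    P = fromℕ< p<n
    Q = fromℕ< q<n
    tP = Finₚ.toℕ-fromℕ< p<n
    tQ = Finₚ.toℕ-fromℕ< q<n
    P<Q : P Fin.< Q
    P<Q = subst₂ _<_ (sym tP) (sym tQ) pos
    P≢Q : P ≢ Q
    P≢Q e = <-irrefl (cong toℕ e) P<Q
    u≡ : u ≡ swapPos v P Q
    u≡ = rep-≡ s (rep-swap r P≢Q) (λ k → cong₂ (λ a b → y · trTo a b k) (sym tP) (sym tQ))
    v≡ : v ≡ swapPos u P Q
    v≡ = sym (trans (cong (λ t → swapPos t P Q) u≡) (swapPos² v P≢Q))
    perm = rep⇒isPerm s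
    xp : x · toℕ P ≡ y · q
    xp = cong (y ·_) (trans (cong (trTo p q) tP) (trTo-l p q))
    xq : x · toℕ Q ≡ y · p
    xq = cong (y ·_) (trans (cong (trTo p q) tQ) (trTo-r p q))
    up : lookup u P Fin.< lookup u Q
    up = lt-at s (subst₂ _<_ (sym xp) (sym xq) desc)
    len≡ : len v ≡ suc (len u)
    len≡ = trans (cong len v≡) (SwapLen.len-suc u P<Q up none
        (λ k k≢ e → k≢ (perm _ _ e)) (λ k k≢ e → k≢ (perm _ _ e)))
      where
      none : ∀ k → P Fin.< k → k Fin.< Q → lookup u P Fin.< lookup u k → lookup u k Fin.< lookup u Q → ⊥
      none k a b c d = empty p<k k<q (subst₂ _<_ xp xk (at-lt s c)) (subst₂ _<_ xk xq (at-lt s d))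
        where
        p<k = subst (_< toℕ k) tP a
        k<q = subst (toℕ k <_) tQ b
        xk : x · toℕ k ≡ y · toℕ k
        xk = cong (y ·_) (trTo-o p q (λ e → <⇒≢ p<k (sym e)) (<⇒≢ k<q))
    u≢v : u ≢ v
    u≢v e = <⇒≢ (subst (len u <_) (sym len≡) (n<1+n _)) (cong len e)
    between : ∀ z → u ≤B z → z ≤B v → z ≡ u ⊎ z ≡ v
    between z a b with len-mono a | len-mono b
    ... | inj₁ e | _ = inj₁ (sym e)
    ... | inj₂ _ | inj₁ e = inj₂ e
    ... | inj₂ c | inj₂ d = ⊥-elim (<-irrefl refl (<-≤-trans c (≤-pred (subst (len z <_) len≡ d))))

  covers⇒step : ∀ {u v : Word n} → Covers u v → BStep u v
  covers⇒step (ε , ne , _) = ⊥-elim (ne refl)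
  covers⇒step (_◅_ {j = y} s t , ne , f) with f y (s ◅ ε) t
  ... | inj₁ refl = ⊥-elim (<-irrefl refl (proj₂ (proj₂ (proj₂ (proj₂ s)))))
  ... | inj₂ refl = s

  covers⇒minInv : ∀ {u v : Word n} {y} → Rep v y → Covers u v → ∃₂ λ p q → MinInv y p q × Rep u (y ∘ₚ tr p q)
  covers⇒minInv {u} {v} {y} r c@(_ , _ , f) with covers⇒step c
  ... | s with step-below r s
  ... | x , rx , st with ⇝-lower {x} {y} st
  ... | p , q , p<q , lt , eq = p , q , minInv p<q lt none , ru
    where
    ru : Rep u (y ∘ₚ tr p q)
    ru = rep (λ i → trans (sym (eq _)) (at rx i)) (supp-≈ {u = x} {v = y ∘ₚ tr p q} eq (support rx))
    q<n = proj₂ (supp-inversion (support r) p<q lt)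
    -- y = (.. C .. B .. A ..) reaches its swap (.. A .. B .. C ..) through (.. B .. C .. A ..), (.. B .. A .. C ..)
    none : ∀ {k} → p < k → k < q → y · q < y · k → y · k < y · p → ⊥
    none {k} p<k k<q a b = contra (word-of S₁) (word-of S₂)
      where
      p<n = <-trans p<q q<n
      k<n = <-trans k<q q<n
      y₁ = y ∘ₚ tr p k
      y₂ = y₁ ∘ₚ tr p q
      S₁ : Supp 0 n y₁
      S₁ = supp-∘ {u = y} {v = tr p k} (support r) (supp-tr z≤n z≤n p<n k<n)
      S₂ : Supp 0 n y₂
      S₂ = supp-∘ {u = y₁} {v = tr p q} S₁ (supp-tr z≤n z≤n p<n q<n)
      p≢k = <⇒≢ p<k
      k≢q = <⇒≢ k<q
      p≢q = <⇒≢ p<q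
      y₁p : y₁ · p ≡ y · k
      y₁p = cong (y ·_) (trTo-l p k)
      y₁q : y₁ · q ≡ y · q
      y₁q = cong (y ·_) (trTo-o p k (λ e → p≢q (sym e)) (λ e → k≢q (sym e)))
      y₁k : y₁ · k ≡ y · p
      y₁k = cong (y ·_) (trTo-r p k)
      y₂k : y₂ · k ≡ y · p
      y₂k = trans (cong (y₁ ·_) (trTo-o p q (λ e → p≢k (sym e)) k≢q)) y₁k
      y₂q : y₂ · q ≡ y · k
      y₂q = trans (cong (y₁ ·_) (trTo-r p q)) y₁p
      step₁ : y₁ ⇝ y
      step₁ = ⇝-swap y p<k b
      step₂ : y₂ ⇝ y₁
      step₂ = ⇝-swap y₁ p<q (subst₂ _<_ (sym y₁q) (sym y₁p) a)
      same : x ≈ y₂ ∘ₚ tr k q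
      same i = trans (eq i) (go (i ≟ p) (i ≟ k) (i ≟ q))
        where
        go : Dec (i ≡ p) → Dec (i ≡ k) → Dec (i ≡ q) → y · trTo p q i ≡ y₂ · trTo k q i
        go (yes refl) _ _ = trans (cong (y ·_) (trTo-l p q)) (sym (trans (cong (y₂ ·_) (trTo-o k q p≢k p≢q))
            (trans (cong (y₁ ·_) (trTo-l p q)) y₁q)))
        go (no _) (yes refl) _ = trans (cong (y ·_) (trTo-o p q (λ e → p≢k (sym e)) k≢q))
            (sym (trans (cong (y₂ ·_) (trTo-l k q)) y₂q))
        go (no _) (no _) (yes refl) = trans (cong (y ·_) (trTo-r p q)) (sym (trans (cong (y₂ ·_) (trTo-r k q)) y₂k))
        go (no a) (no b) (no c) = cong (y ·_) (trans (trTo-o p q a c) (sym (trans (cong (λ t → trTo p k (trTo p q t)) (trTo-o k q b c))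
            (trans (cong (trTo p k) (trTo-o p q a c)) (trTo-o p k a b)))))
      step₃ : x ⇝ y₂
      step₃ = ⇝-resp {u = y₂ ∘ₚ tr k q} {v = y₂} {u₁ = x} {v₁ = y₂} (λ i → sym (same i)) (λ _ → refl)
                (⇝-swap y₂ k<q (subst₂ _<_ (sym y₂q) (sym y₂k) b))
      contra : (Σ (Word n) λ z → Rep z y₁) → (Σ (Word n) λ z → Rep z y₂) → ⊥
      contra (z₁ , r₁) (z₂ , r₂) = no-room (f z₁ (s₃ ◅ s₂ ◅ ε) (s₁ ◅ ε))
        where
        s₁ = ⇝⇒BStep r₁ r step₁
        s₂ = ⇝⇒BStep r₂ r₁ step₂
        s₃ = ⇝⇒BStep rx r₂ step₃
        ℓ : ∀ {a b : Word n} → BStep a b → len a < len b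
        ℓ (_ , _ , _ , _ , l) = l
        no-room : z₁ ≡ u ⊎ z₁ ≡ v → ⊥
        no-room (inj₁ q) = <⇒≢ (<-trans (ℓ s₃) (ℓ s₂)) (sym (cong len q))
        no-room (inj₂ q) = <⇒≢ (ℓ s₁) (cong len q)

  covers⇒len : ∀ {u v : Word n} {y} → Rep v y → Covers u v → len v ≡ suc (len u)
  covers⇒len r c = let (_ , _ , m , s) = covers⇒minInv r c in proj₂ (minInv⇒covers r m s)

  ≤-len-suc⇒covers : ∀ {u v : Word n} → u ≤B v → len v ≡ suc (len u) → Covers u v
  ≤-len-suc⇒covers {u} {v} s l = s , (λ e → <⇒≢ (subst (len u <_) (sym l) (n<1+n _)) (cong len e)) , between
    where
    between : ∀ z → u ≤B z → z ≤B v → z ≡ u ⊎ z ≡ v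
    between z a b with len-mono a | len-mono b
    ... | inj₁ e | _ = inj₁ (sym e)
    ... | inj₂ _ | inj₁ e = inj₂ e
    ... | inj₂ c | inj₂ d = ⊥-elim (<-irrefl refl (<-≤-trans c (≤-pred (subst (len z <_) l d))))

  -- Each step raises the length, so a chain from u to w has at most len w - len u steps; k bounds
  -- this number.
  _≤B?_ : ∀ (u w : Word n) → Dec (u ≤B w)
  u ≤B? w = go (len w) u (m≤m+n (len w) (len u))
    where
    go : ∀ k u → len w ≤ k + len u → Dec (u ≤B w)
    go k u le with Vecₚ.≡-dec Fin._≟_ u w
    ... | yes refl = yes ε
    go zero u le | no ne = no λ s → [ ne , (λ lt → <⇒≱ lt le) ] (len-mono s)
    go (suc k) u le | no ne with Finₚ.any? (λ i → Finₚ.any? (λ j → next i j))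
      where
      next : ∀ i j → Dec (Σ (i Fin.< j) λ _ → Σ (len u < len (swapPos u i j)) λ _ → swapPos u i j ≤B w)
      next i j with i Fin.<? j | len u <? len (swapPos u i j)
      ... | no p  | _     = no (p ∘ proj₁)
      ... | yes _ | no q  = no (q ∘ proj₁ ∘ proj₂)
      ... | yes p | yes q with go k (swapPos u i j) (≤-trans le (subst (_≤ k + len (swapPos u i j)) (+-suc k (len u)) (+-monoʳ-≤ k q)))
      ... | yes s = yes (p , q , s)
      ... | no s  = no (s ∘ proj₂ ∘ proj₂)
    ... | yes (i , j , p , q , s) = yes ((i , j , p , refl , q) ◅ s)
    ... | no ¬s = no λ { ε → ne refl ; ((i , j , p , refl , q) ◅ s) → ¬s (i , j , p , q , s) }

-- Degrees

Σₙ-zero : ∀ {n} {f : Fin n → ℕ} → (∀ i → f i ≡ 0) → Σₙ f ≡ 0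
Σₙ-zero {zero}  h = refl
Σₙ-zero {suc n} h = cong₂ _+_ (h Fin.zero) (Σₙ-zero (h ∘ Fin.suc))

len-e : ∀ {n} → len (e {n}) ≡ 0
len-e {n} = Σₙ-zero λ p → Σₙ-zero λ q → zeros p q (p Fin.<? q)
  where
  zeros : ∀ p q → Dec (p Fin.< q) → inv? (e {n}) p q ≡ 0
  zeros p q (no p≮q)  = inv?-≥ e p≮q
  zeros p q (yes p<q) = trans (inv?-lt e p<q)
    (lt?-no λ r → <-asym p<q (subst₂ Fin._<_ (Vecₚ.lookup∘tabulate id q) (Vecₚ.lookup∘tabulate id p) r))

-- Self-dual intervals of words

module DualFromRel {n} {w : Word n} {W} (rw : Rep w W) (A : AntiRel 0 n W) where

  RW : Word n → Word n → Set
  RW u u′ = ∃₂ λ x x′ → Rep u x × Rep u′ x′ × AntiRel.R A x x′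

  RW-sym : ∀ {u u′} → RW u u′ → RW u′ u
  RW-sym (x , x′ , r , r′ , q) = x′ , x , r′ , r , AntiRel.R-sym A q

  RW-fun : ∀ {u u′ u″} → RW u u′ → RW u u″ → u′ ≡ u″
  RW-fun (x , x′ , r , r′ , q) (y , y′ , s , s′ , t) = rep-≡ r′ s′ (AntiRel.R-fun A q t (rep-unique r s))

  RW-down : ∀ {u v v′} → u ≤B v → RW v v′ → ∃ λ u′ → RW u u′ × v′ ≤B u′
  RW-down ε q = _ , q , ε
  RW-down {u} (_◅_ {j = m} s t) q with RW-down t q
  ... | m′ , (y , y′ , r , r′ , q′) , le with step-below r s
  ... | x , rx , st with AntiRel.R-down A q′ st
  ... | x′ , q″ , st′ with word-of (AntiRel.R-supp A (AntiRel.R-sym A q″))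
  ... | u′ , ru′ = u′ , (x , x′ , rx , ru′ , q″) , le ◅◅ (⇝⇒BStep r′ ru′ st′ ◅ ε)

  top : RW w e
  top = W , idₚ , rw , rep-e , AntiRel.R-sym A (AntiRel.R-start A)

  -- The decision is an argument so that `dual-RW` can be proved for any decision at once. Outside
  -- the interval u itself is a default value.
  dual′ : ∀ u → Dec (u ≤B w) → Word n
  dual′ u (yes p) = proj₁ (RW-down p top)
  dual′ u (no _)  = u

  dual : Word n → Word n
  dual u = dual′ u (u ≤B? w)

  dual-RW : ∀ {u} → u ≤B w → RW u (dual u)
  dual-RW {u} p = go (u ≤B? w)
    where
    go : (d : Dec (u ≤B w)) → RW u (dual′ u d)
    go (yes q) = proj₁ (proj₂ (RW-down q top))
    go (no ¬p) = ⊥-elim (¬p p)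

  e≤ : ∀ {u u′} → RW u u′ → e ≤B u′
  e≤ (_ , _ , _ , r′ , _) = e-least r′

  dual-anti : ∀ {x y} → x ≤B y → y ≤B w → dual y ≤B dual x
  dual-anti {x} {y} p q with RW-down p (dual-RW q)
  ... | x′ , r , le = subst (dual y ≤B_) (RW-fun r (dual-RW (p ◅◅ q))) le

  -- The relation reverses e ≤ u, so the partner of u lies below the partner of e, which is w.
  dual-≤w : ∀ {u} → u ≤B w → dual u ≤B w
  dual-≤w {u} p with RW-down (e-least (proj₂ (rep-below p rw))) (dual-RW p)
  ... | e′ , r , le = subst (dual u ≤B_) (RW-fun r (RW-sym top)) le

  dual-invol : ∀ {u} → u ≤B w → dual (dual u) ≡ u
  dual-invol p = RW-fun (dual-RW (dual-≤w p)) (RW-sym (dual-RW p))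

  selfDual : SelfDual w
  selfDual = dual , dual , interval , interval , (λ x p → dual-invol (proj₂ p)) , (λ x p → dual-invol (proj₂ p))
    , λ x y p q → (λ le → dual-anti le (proj₂ q))
                , λ le → subst₂ _≤B_ (dual-invol (proj₂ p)) (dual-invol (proj₂ q)) (dual-anti le (dual-≤w (proj₂ p)))
    where
    interval : ∀ x → InI w x → InI w (dual x)
    interval x p = e≤ (dual-RW (proj₂ p)) , dual-≤w (proj₂ p)

selfDual⇒coatoms≤atoms : ∀ {n} {w : Word n} {W a b} → Rep w W →
  IsMaxOver (InP w 1) (UDeg w) a → IsMaxOver (InP w (len w ∸ 1)) (DDeg w) b → SelfDual w → b ≤ a
selfDual⇒coatoms≤atoms {n} {w} {W} {a} {b} rw ((u , (u∈ , lu) , _) , maxa) ((v , (v∈ , lv) , (h , h-inj , h∈ , h-onto)) , _)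
  (f , g , fI , gI , gf , fg , ord) = maxa (f v) b (fI v v∈ , len-fv) (f ∘ h , fh-inj , fh∈ , fh-onto)
  where
  anti : ∀ {x y} → InI w x → InI w y → x ≤B y → f y ≤B f x
  anti p q = proj₁ (ord _ _ p q)
  anti⁻ : ∀ {x y} → InI w x → InI w y → f y ≤B f x → x ≤B y
  anti⁻ p q = proj₂ (ord _ _ p q)
  w∈ : InI w w
  w∈ = e-least rw , ε
  e∈ : InI w e
  e∈ = ε , e-least rw
  f-inj : ∀ {x y} → InI w x → InI w y → f x ≡ f y → x ≡ y
  f-inj p q eq = trans (sym (gf _ p)) (trans (cong g eq) (gf _ q))
  fw≡e : f w ≡ e
  fw≡e with len-mono (subst (f w ≤B_) (fg e e∈) (anti (gI e e∈) w∈ (proj₂ (gI e e∈))))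
  ... | inj₁ q = q
  ... | inj₂ q = ⊥-elim (<⇒≱ (subst (len (f w) <_) (len-e {n}) q) z≤n)
  -- The atom u forces len w to be positive, so the truncated subtraction in the rank of v is a true
  -- predecessor.
  len-w : len w ≡ suc (len v)
  len-w = sym (trans (cong suc lv) (m+[n∸m]≡n (≤-trans (≤-reflexive (sym lu)) (len-mono-≤ (proj₂ u∈)))))
  covers-f : ∀ {z v} → InI w z → InI w v → Covers z v → Covers (f v) (f z)
  covers-f {z} {v} p q (le , ne , btw) = anti p q le , (λ eq → ne (sym (f-inj q p eq))) , between
    where
    between : ∀ t → f v ≤B t → t ≤B f z → t ≡ f v ⊎ t ≡ f z
    between t s₁ s₂ = [ (λ eq → inj₂ (trans (sym ft) (cong f eq))) , (λ eq → inj₁ (trans (sym ft) (cong f eq))) ]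
        (btw (g t) (anti⁻ p (gI t t∈) (subst (_≤B f z) (sym ft) s₂)) (anti⁻ (gI t t∈) q (subst (f v ≤B_) (sym ft) s₁)))
      where
      t∈ : InI w t
      t∈ = proj₁ (fI v q) ◅◅ s₁ , s₂ ◅◅ proj₂ (fI z p)
      ft : f (g t) ≡ t
      ft = fg t t∈
  covers-f⁻ : ∀ {z v} → InI w z → InI w v → Covers (f v) (f z) → Covers z v
  covers-f⁻ {z} {v} p q (le , ne , btw) = anti⁻ p q le , (λ eq → ne (cong f (sym eq))) , between
    where
    between : ∀ t → z ≤B t → t ≤B v → t ≡ z ⊎ t ≡ v
    between t s₁ s₂ = [ (λ eq → inj₂ (f-inj t∈ q eq)) , (λ eq → inj₁ (f-inj t∈ p eq)) ] (btw (f t) (anti t∈ q s₂) (anti p t∈ s₁))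
      where
      t∈ : InI w t
      t∈ = proj₁ p ◅◅ s₁ , s₂ ◅◅ proj₂ q
  len-fv : len (f v) ≡ 1
  len-fv = trans (covers⇒len (proj₂ (rep-below (proj₂ (fI v v∈)) rw))
      (subst (λ t → Covers t (f v)) fw≡e (covers-f v∈ w∈ (≤-len-suc⇒covers (proj₂ v∈) len-w)))) (cong suc (len-e {n}))
  fh-inj : ∀ i j → f (h i) ≡ f (h j) → i ≡ j
  fh-inj i j eq = h-inj i j (f-inj (proj₁ (h∈ i)) (proj₁ (h∈ j)) eq)
  fh∈ : ∀ i → InI w (f (h i)) × Covers (f v) (f (h i))
  fh∈ i = fI _ (proj₁ (h∈ i)) , covers-f (proj₁ (h∈ i)) v∈ (proj₂ (h∈ i))
  fh-onto : ∀ x → InI w x × Covers (f v) x → ∃ λ i → f (h i) ≡ x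
  fh-onto x (x∈ , c) with h-onto (g x) (gI x x∈ , covers-f⁻ (gI x x∈) v∈ (subst (Covers (f v)) (sym (fg x x∈)) c))
  ... | i , eq = i , trans (cong f eq) (fg x x∈)

-- Counting down-degrees by minimal inversions

enumerate : ∀ {N} {P : Fin N → Set} → (∀ i → Dec (P i)) → ∃ λ k → HasSize P k
enumerate {zero} P? = 0 , (λ ()) , (λ ()) , (λ ()) , λ ()
enumerate {suc N} {P} P? with enumerate {N} {P ∘ Fin.suc} (P? ∘ Fin.suc) | P? Fin.zero
... | k , f , f-inj , f∈ , f-onto | no ¬p = k , Fin.suc ∘ f , (λ i j eq → f-inj i j (Finₚ.suc-injective eq)) , f∈ , onto′
  where
  onto′ : ∀ x → P x → ∃ λ i → Fin.suc (f i) ≡ x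
  onto′ Fin.zero q = ⊥-elim (¬p q)
  onto′ (Fin.suc x) q = let (i , eq) = f-onto x q in i , cong Fin.suc eq
... | k , f , f-inj , f∈ , f-onto | yes p = suc k , f′ , inj′ , ∈′ , onto′
  where
  f′ : Fin (suc k) → Fin (suc N)
  f′ Fin.zero = Fin.zero
  f′ (Fin.suc i) = Fin.suc (f i)
  inj′ : ∀ i j → f′ i ≡ f′ j → i ≡ j
  inj′ Fin.zero Fin.zero _ = refl
  inj′ (Fin.suc i) (Fin.suc j) eq = cong Fin.suc (f-inj i j (Finₚ.suc-injective eq))
  ∈′ : ∀ i → P (f′ i)
  ∈′ Fin.zero = p
  ∈′ (Fin.suc i) = f∈ i
  onto′ : ∀ x → P x → ∃ λ i → f′ i ≡ x
  onto′ Fin.zero q = Fin.zero , refl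
  onto′ (Fin.suc x) q = let (i , eq) = f-onto x q in Fin.suc i , cong Fin.suc eq

minInv? : ∀ w p q → Dec (MinInv w p q)
minInv? w p q with p <? q | w · q <? w · p | between? w p q
... | no a  | _     | _     = no (a ∘ MinInv.pos)
... | yes _ | no b  | _     = no (b ∘ MinInv.desc)
... | yes a | yes b | no c  = yes (minInv a b λ s t u x → c (_ , t , s , u , x))
... | yes _ | yes _ | yes (x , x<q , p<x , s , t) = no λ m → MinInv.empty m p<x x<q s t

-- A pair of positions is coded as a single element of Fin (n * n), which makes the minimal
-- inversions a decidable subset of a finite type.
src dst : ∀ n → Fin (n * n) → Fin n
src n x = proj₁ (Fin.remQuot {n} n x)
dst n x = proj₂ (Fin.remQuot {n} n x)

Edge : ∀ n → Perm → Fin (n * n) → Set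
Edge n y x = MinInv y (toℕ (src n x)) (toℕ (dst n x))

-- The hypothesis on the maximal down-degree applies only to an actual `DDeg`. Hence all minimal
-- inversions are enumerated: `ddeg` turns the enumeration into a degree, and `count` bounds every
-- injective family by it.
module CoverCount {n} {w v : Word n} {y} (rv : Rep v y) (v≤w : v ≤B w) {k} (f : Fin k → Fin (n * n))
  (f-inj : ∀ i j → f i ≡ f j → i ≡ j) (f∈ : ∀ i → Edge n y (f i)) (f-onto : ∀ x → Edge n y x → ∃ λ i → f i ≡ x) where

  record Code (p q : ℕ) : Set where
    constructor mkCode
    field
      x  : Fin (n * n)
      ed : Edge n y x
      ep : toℕ (src n x) ≡ p
      eq : toℕ (dst n x) ≡ q

  code : ∀ {p q} → MinInv y p q → Code p q
  code {p} {q} m = mkCode (Fin.combine P Q) (subst₂ (MinInv y) (sym ep) (sym eq) m) ep eq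
    where
    q<n = proj₂ (supp-inversion (support rv) (MinInv.pos m) (MinInv.desc m))
    p<n = <-trans (MinInv.pos m) q<n
    P = fromℕ< p<n
    Q = fromℕ< q<n
    ep : toℕ (src n (Fin.combine P Q)) ≡ p
    ep = trans (cong (toℕ ∘ proj₁) (Finₚ.remQuot-combine P Q)) (Finₚ.toℕ-fromℕ< p<n)
    eq : toℕ (dst n (Fin.combine P Q)) ≡ q
    eq = trans (cong (toℕ ∘ proj₂) (Finₚ.remQuot-combine P Q)) (Finₚ.toℕ-fromℕ< q<n)

  lower : Fin (n * n) → Word n
  lower x = swapPos v (src n x) (dst n x)

  lower-rep : ∀ x → Edge n y x → Rep (lower x) (y ∘ₚ tr (toℕ (src n x)) (toℕ (dst n x)))
  lower-rep x m = rep-swap rv {src n x} {dst n x} (λ e → <-irrefl (cong toℕ e) (MinInv.pos m))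

  ddeg : DDeg w v k
  ddeg = lower ∘ f , inj′ , (λ i → ∈′ {f i} (f∈ i)) , onto′
    where
    ∈′ : ∀ {x} → Edge n y x → InI w (lower x) × Covers (lower x) v
    ∈′ {x} m = (e-least (lower-rep x m) , proj₁ c ◅◅ v≤w) , c
      where
      c : Covers (lower x) v
      c = proj₁ (minInv⇒covers {u = lower x} {v = v} {y = y} rv m (lower-rep x m))
    inj′ : ∀ i j → lower (f i) ≡ lower (f j) → i ≡ j
    inj′ i j eq = f-inj i j (trans (sym (Finₚ.combine-remQuot {n} n (f i)))
        (trans (cong₂ Fin.combine (Finₚ.toℕ-injective (proj₁ pq)) (Finₚ.toℕ-injective (proj₂ pq))) (Finₚ.combine-remQuot {n} n (f j))))
      where
      Pᵢ = toℕ (src n (f i))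
      Qᵢ = toℕ (dst n (f i))
      Pⱼ = toℕ (src n (f j))
      Qⱼ = toℕ (dst n (f j))
      same-rep : Rep (lower (f j)) (y ∘ₚ tr Pᵢ Qᵢ)
      same-rep = subst (λ z → Rep z (y ∘ₚ tr Pᵢ Qᵢ)) eq (lower-rep (f i) (f∈ i))
      pq : Pᵢ ≡ Pⱼ × Qᵢ ≡ Qⱼ
      pq = tr-unique (MinInv.pos (f∈ i)) (MinInv.pos (f∈ j))
             (λ t → inj y (rep-unique {u = y ∘ₚ tr Pᵢ Qᵢ} {v = y ∘ₚ tr Pⱼ Qⱼ} same-rep (lower-rep (f j) (f∈ j)) t))
    onto′ : ∀ z → InI w z × Covers z v → ∃ λ i → lower (f i) ≡ z
    onto′ z (_ , c) = found (covers⇒minInv rv c)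
      where
      found : (∃₂ λ p q → MinInv y p q × Rep z (y ∘ₚ tr p q)) → ∃ λ i → lower (f i) ≡ z
      found (p , q , m , rz) =
        let mkCode x ex ep eq = code m
            i , fi = f-onto x ex
        in i , trans (cong lower fi) (rep-≡ {w = lower x} {u = y ∘ₚ tr (toℕ (src n x)) (toℕ (dst n x))} {u′ = y ∘ₚ tr p q} (lower-rep x ex) rz
             (λ t → cong₂ (λ a b → y · trTo a b t) ep eq))

  count : ∀ {m} (h : Fin m → ℕ × ℕ) → (∀ {i j} → h i ≡ h j → i ≡ j) → (∀ i → MinInv y (proj₁ (h i)) (proj₂ (h i))) → m ≤ k
  count {m} h h-inj h∈ = Finₚ.injective⇒≤ {f = g} g-inj
    where
    module C i = Code (code (h∈ i))
    g : Fin m → Fin k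
    g i = proj₁ (f-onto (C.x i) (C.ed i))
    g-code : ∀ i → f (g i) ≡ C.x i
    g-code i = proj₂ (f-onto (C.x i) (C.ed i))
    g-inj : ∀ {i j} → g i ≡ g j → i ≡ j
    g-inj {i} {j} eq = h-inj (cong₂ _,_
        (trans (sym (C.ep i)) (trans (cong (λ x → toℕ (src n x)) same) (C.ep j)))
        (trans (sym (C.eq i)) (trans (cong (λ x → toℕ (dst n x)) same) (C.eq j))))
      where
      same : C.x i ≡ C.x j
      same = trans (sym (g-code i)) (trans (cong f eq) (g-code j))

-- The covers of an atom below w

-- These are the rank conditions of Bruhat order with threshold one; they suffice because the
-- elements compared with w have length at most two.
High Low : Perm → ℕ → ℕ → Set
High w j t = ∃ λ p → p ≤ j × t ≤ w · p
Low  w j t = ∃ λ q → j ≤ q × w · q ≤ t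

-- A Bruhat step moves the larger of two entries to the left, so a large entry among the first
-- positions is kept or replaced by a larger one.
step-high : ∀ {x y j t} → x ⇝ y → High x j t → High y j t
step-high {x} {y} {j} {t} (a , b , a<b , lt , eq) (p , p≤j , t≤) = go (p ≟ a) (p ≟ b)
  where
  ya : y · a ≡ x · b
  ya = trans (eq a) (cong (x ·_) (trTo-l a b))
  go : Dec (p ≡ a) → Dec (p ≡ b) → High y j t
  go (yes e) _ = a , subst (_≤ j) e p≤j , subst (t ≤_) (sym ya) (≤-trans (subst (λ k → t ≤ x · k) e t≤) (<⇒≤ lt))
  go (no _) (yes e) = a , ≤-trans (<⇒≤ a<b) (subst (_≤ j) e p≤j) , subst (t ≤_) (sym ya) (subst (λ k → t ≤ x · k) e t≤)
  go (no c) (no d) = p , p≤j , subst (t ≤_) (sym (trans (eq p) (cong (x ·_) (trTo-o a b c d)))) t≤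

step-low : ∀ {x y j t} → x ⇝ y → Low x j t → Low y j t
step-low {x} {y} {j} {t} (a , b , a<b , lt , eq) (q , j≤q , ≤t) = go (q ≟ a) (q ≟ b)
  where
  yb : y · b ≡ x · a
  yb = trans (eq b) (cong (x ·_) (trTo-r a b))
  go : Dec (q ≡ a) → Dec (q ≡ b) → Low y j t
  go (yes e) _ = b , ≤-trans (subst (j ≤_) e j≤q) (<⇒≤ a<b) , subst (_≤ t) (sym yb) (subst (λ k → x · k ≤ t) e ≤t)
  go (no _) (yes e) = b , subst (j ≤_) e j≤q , subst (_≤ t) (sym yb) (≤-trans (<⇒≤ lt) (subst (λ k → x · k ≤ t) e ≤t))
  go (no c) (no d) = q , j≤q , subst (_≤ t) (sym (trans (eq q) (cong (x ·_) (trTo-o a b c d)))) ≤t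

≤B-lift : ∀ {n} (P : Perm → Set) → (∀ x y → x ≈ y → P x → P y) → (∀ x y → x ⇝ y → P x → P y) →
          ∀ {u v : Word n} {x y} → u ≤B v → Rep u x → Rep v y → P x → P y
≤B-lift P resp step {x = x} {y} ε ru rv p = resp x y (rep-unique ru rv) p
≤B-lift P resp step {x = x} (s ◅ t) ru rv p =
  let z , rz = rep-below t rv
      x′ , rx′ , st = step-below rz s
  in ≤B-lift P resp step t rz rv (step x′ z st (resp x x′ (rep-unique ru rx′) p))

≤B-high : ∀ {n} {u v : Word n} {x y} j t → u ≤B v → Rep u x → Rep v y → High x j t → High y j t
≤B-high j t = ≤B-lift (λ w → High w j t)
  (λ x y e (p , a , b) → p , a , subst (t ≤_) (e p) b) (λ x y → step-high {x} {y})

≤B-low : ∀ {n} {u v : Word n} {x y} j t → u ≤B v → Rep u x → Rep v y → Low x j t → Low y j t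
≤B-low j t = ≤B-lift (λ w → Low w j t)
  (λ x y e (q , a , b) → q , a , subst (_≤ t) (e q) b) (λ x y → step-low {x} {y})

high⇒cross : ∀ {n w j} → Supp 0 n w → High w j (suc j) → Cross w j
high⇒cross {w = w} S (p , p≤j , j<wp) with balance {w = w} S (s≤s p≤j) j<wp
... | q , j<q , wq≤j = p , q , p≤j , j<q , <-≤-trans wq≤j j<wp

-- If p and q were not adjacent, the fixed entry at 1 + p would lie inside the rectangle of the
-- inversion.
adjacent-swap : ∀ {x p q} → MinInv x p q → x ≈ tr p q → x ≈ tr p (suc p)
adjacent-swap {x} {p} {q} m undo t = trans (undo t) (cong (λ b → trTo p b t) q≡)
  where
  open MinInv m
  q≡ : q ≡ suc p
  q≡ with m≤n⇒m<n∨m≡n pos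
  ... | inj₂ e = sym e
  ... | inj₁ 1+p<q = ⊥-elim (empty (n<1+n p) 1+p<q
          (subst₂ _<_ (sym (trans (undo q) (trTo-r p q))) (sym mid) (n<1+n p))
          (subst₂ _<_ (sym mid) (sym (trans (undo p) (trTo-l p q))) 1+p<q))
    where
    mid : x · suc p ≡ suc p
    mid = trans (undo (suc p)) (trTo-o p q (λ e → <⇒≢ (n<1+n p) (sym e)) (<⇒≢ 1+p<q))

atom⇒adjacent : ∀ {n} {u : Word n} {x} → Rep u x → len u ≡ 1 → ∃ λ i → x ≈ tr i (suc i)
atom⇒adjacent {n} {u} {x} r l = go (covers⇒minInv r (≤-len-suc⇒covers {u = e} {v = u} (e-least r) (trans l (cong suc (sym (len-e {n}))))))
  where
  go : (∃₂ λ p q → MinInv x p q × Rep (e {n}) (x ∘ₚ tr p q)) → ∃ λ i → x ≈ tr i (suc i)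
  go (p , q , m , re) = p , adjacent-swap {x} m
    (λ t → trans (cong (x ·_) (sym (trTo-inv p q t))) (rep-unique {u = x ∘ₚ tr p q} {v = idₚ} re rep-e (trTo p q t)))

-- Labels for the covers of s_i below w: the letter j of the other simple reflection, or, when both s_i s_j and
-- s_j s_i lie below w, a separate mark for one of them (j = i - 1 on the left, j = i + 1 on the right).
data Tag : Set where
  far : ℕ → Tag
  leftᵗ rightᵗ : Tag

data Valid (w : Perm) (i : ℕ) : Tag → Set where
  vfar : ∀ {j} → j ≢ i → Cross w j → Valid w i (far j)
  vR   : Double w i → Valid w i rightᵗ
  vL   : ∀ {k} → suc k ≡ i → Double w k → Valid w i leftᵗ

-- Here k < l is the inversion whose removal leads from the cover to s_i. Each neighbouring letter
-- has two possible covers: an adjacent swap, and the swap of i, 2 + i for the letter 1 + i or of i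
-- - 1, 1 + i for the letter i - 1. The distant swap receives the mark if w also satisfies the
-- condition that the adjacent one needs, and the plain label otherwise.
data Tagged (w : Perm) (i : ℕ) : ℕ → ℕ → Tag → Set where
  adj    : ∀ {k} → (k ≡ suc i → Low w (2 + i) i) → (suc k ≡ i → High w k (2 + k)) → Tagged w i k (suc k) (far k)
  right₊ : Tagged w i i (2 + i) rightᵗ
  right₀ : ¬ Low w (2 + i) i → Tagged w i i (2 + i) (far (suc i))
  left₊  : ∀ {k} → suc k ≡ i → Tagged w i k (2 + k) leftᵗ
  left₀  : ∀ {k} → suc k ≡ i → ¬ High w k (2 + k) → Tagged w i k (2 + k) (far k)

-- The two covers of one neighbour never share a label, since `adj` carries the very condition whose
-- failure permits the plain label for the distant swap.
tagged-injective : ∀ {w i k l k′ l′ t} → Tagged w i k l t → Tagged w i k′ l′ t → k ≡ k′ × l ≡ l′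
tagged-injective (adj f g)    (adj _ _)     = refl , refl
tagged-injective (adj f g)    (right₀ ¬q)   = ⊥-elim (¬q (f refl))
tagged-injective (adj f g)    (left₀ e ¬p)  = ⊥-elim (¬p (g e))
tagged-injective right₊       right₊        = refl , refl
tagged-injective (right₀ ¬q)  (adj f g)     = ⊥-elim (¬q (f refl))
tagged-injective (right₀ _)   (right₀ _)    = refl , refl
tagged-injective (right₀ _)   (left₀ e _)   = ⊥-elim (<⇒≢ (m≤n⇒m≤1+n (n<1+n _)) (sym e))
tagged-injective (left₊ refl) (left₊ refl)  = refl , refl
tagged-injective (left₀ e ¬p) (adj f g)     = ⊥-elim (¬p (g e))
tagged-injective (left₀ e _)  (right₀ _)    = ⊥-elim (<⇒≢ (m≤n⇒m≤1+n (n<1+n _)) (sym e))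
tagged-injective (left₀ _ _)  (left₀ _ _)   = refl , refl

data CoverShape (i : ℕ) : ℕ → ℕ → Set where
  adjacent : ∀ {k} → k ≢ i → CoverShape i k (suc k)
  right    : CoverShape i i (2 + i)
  left     : ∀ {k} → suc k ≡ i → CoverShape i k (2 + k)

-- If k and l are not adjacent, the entry at 1 + k lies in the forbidden rectangle unless s_i moves
-- it. When it is moved, the entry at 2 + k obstructs any larger l.
coverShape : ∀ {i k l} → k < l → trTo i (suc i) k < trTo i (suc i) l →
             (∀ {m} → k < m → m < l → trTo i (suc i) k < trTo i (suc i) m → trTo i (suc i) m < trTo i (suc i) l → ⊥) →
             CoverShape i k l
coverShape {i} {k} {l} k<l up none = [ gap (k ≟ i) (suc k ≟ i) , tight ] (m≤n⇒m<n∨m≡n k<l)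
  where
  fixed : ∀ {t} → i < t → suc i < t → trTo i (suc i) t ≡ t
  fixed p q = trTo-o i (suc i) (λ e → <⇒≢ p (sym e)) (λ e → <⇒≢ q (sym e))
  tight : suc k ≡ l → CoverShape i k l
  tight refl = adjacent λ { refl → <-asym (n<1+n i) (subst₂ _<_ (trTo-l i (suc i)) (trTo-r i (suc i)) up) }
  gap : Dec (k ≡ i) → Dec (suc k ≡ i) → suc k < l → CoverShape i k l
  gap (yes refl) _ 1+k<l = [ wide , (λ { refl → right }) ] (m≤n⇒m<n∨m≡n 1+k<l)
    where
    at₂ : trTo i (suc i) (2 + i) ≡ 2 + i
    at₂ = fixed (m≤n⇒m≤1+n (n<1+n i)) (n<1+n (suc i))
    wide : 2 + k < l → CoverShape i k l
    wide 2+k<l = ⊥-elim (none (m≤n⇒m≤1+n (n<1+n k)) 2+k<l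
      (subst₂ _<_ (sym (trTo-l i (suc i))) (sym at₂) (n<1+n (suc i)))
      (subst₂ _<_ (sym at₂) (sym (fixed (<-trans (n<1+n i) 1+k<l) 1+k<l)) 2+k<l))
  gap (no k≢i) (yes refl) 1+k<l = [ wide , (λ { refl → left refl }) ] (m≤n⇒m<n∨m≡n 1+k<l)
    where
    wide : 2 + k < l → CoverShape i k l
    wide 2+k<l = ⊥-elim (none (m≤n⇒m≤1+n (n<1+n k)) 2+k<l
      (subst₂ _<_ (sym (trTo-o (suc k) (2 + k) (<⇒≢ (n<1+n k)) (<⇒≢ (m≤n⇒m≤1+n (n<1+n k))))) (sym (trTo-r (suc k) (2 + k))) (n<1+n k))
      (subst₂ _<_ (sym (trTo-r (suc k) (2 + k))) (sym (fixed 1+k<l 2+k<l)) 1+k<l))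
  gap (no k≢i) (no 1+k≢i) 1+k<l =
    ⊥-elim (none (n<1+n k) 1+k<l (subst (trTo i (suc i) k <_) (sym mid) low) (subst (_< trTo i (suc i) l) (sym mid) high))
    where
    mid : trTo i (suc i) (suc k) ≡ suc k
    mid = trTo-o i (suc i) 1+k≢i (k≢i ∘ suc-injective)
    low : trTo i (suc i) k < suc k
    low with trTo i (suc i) k | trView i (suc i) k
    ... | _ | at-l    = ⊥-elim (k≢i refl)
    ... | _ | at-r    = m≤n⇒m≤1+n (n<1+n i)
    ... | _ | off _ _ = n<1+n k
    high : suc k < trTo i (suc i) l
    high with trTo i (suc i) l | trView i (suc i) l
    ... | _ | at-l    = m≤n⇒m≤1+n 1+k<l
    ... | _ | at-r    = ≤∧≢⇒< (≤-pred 1+k<l) 1+k≢i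
    ... | _ | off _ _ = 1+k<l

low? : ∀ {n w} → Supp 0 n w → ∀ i → Dec (Low w (2 + i) i)
low? {n} {w} S i with anyUpTo? (λ q → (2 + i ≤? q) ×-dec (w · q ≤? i)) n
... | yes (q , _ , p) = yes (q , p)
... | no ¬p = no λ (q , a , b) → ¬p (q , bound q a b , a , b)
  where
  bound : ∀ q → 2 + i ≤ q → w · q ≤ i → q < n
  bound q a b with q <? n
  ... | yes t = t
  ... | no t  = ⊥-elim (<⇒≱ (<-trans (n<1+n i) a) (subst (_≤ i) (fix S q (inj₂ (≮⇒≥ t))) b))

high? : ∀ w j t → Dec (High w j t)
high? w j t with anyUpTo? (λ p → t ≤? w · p) (suc j)
... | yes (p , a , b) = yes (p , ≤-pred a , b)
... | no ¬p = no λ (p , a , b) → ¬p (p , s≤s a , b)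

cross? : ∀ {n w} → Supp 0 n w → ∀ j → Dec (Cross w j)
cross? {n} {w} S j with anyUpTo? (λ p → anyUpTo? (λ q → (j <? q) ×-dec (w · q <? w · p)) n) (suc j)
... | yes (p , a , q , _ , b , c) = yes (p , q , ≤-pred a , b , c)
... | no ¬p = no λ (p , q , a , b , c) → ¬p (p , s≤s a , q , proj₂ (supp-inversion S (≤-<-trans a b) c) , b , c)

tag-cover : ∀ {n} {u v w : Word n} {x y W i} → Rep u x → x ≈ tr i (suc i) → Rep w W → Rep v y → v ≤B w →
            ∀ {k l} → MinInv y k l → Rep u (y ∘ₚ tr k l) → ∃ λ t → Tagged W i k l t × Valid W i t
tag-cover {n} {u} {v} {w} {x} {y} {W} {i} ru x≈ rw rv v≤w {k} {l} m ru′ = shape (coverShape pos up none)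
  where
  open MinInv m
  S = support rw
  σ = trTo i (suc i)
  y≈ : ∀ t → y · t ≡ σ (trTo k l t)
  y≈ t = trans (cong (y ·_) (sym (trTo-inv k l t))) (trans (rep-unique {u = y ∘ₚ tr k l} {v = x} ru′ ru (trTo k l t)) (x≈ _))
  yk : y · k ≡ σ l
  yk = trans (y≈ k) (cong σ (trTo-l k l))
  yl : y · l ≡ σ k
  yl = trans (y≈ l) (cong σ (trTo-r k l))
  up : σ k < σ l
  up = subst₂ _<_ yl yk desc
  none : ∀ {m} → k < m → m < l → σ k < σ m → σ m < σ l → ⊥
  none {m} a b c d = empty a b (subst₂ _<_ (sym yl) (sym ym) c) (subst₂ _<_ (sym ym) (sym yk) d)
    where
    ym : y · m ≡ σ m
    ym = trans (y≈ m) (cong σ (trTo-o k l (λ e → <⇒≢ a (sym e)) (<⇒≢ b)))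
  highᵂ : ∀ {j t} → High y j t → High W j t
  highᵂ {j} {t} = ≤B-high j t v≤w rv rw
  lowᵂ : ∀ {j t} → Low y j t → Low W j t
  lowᵂ {j} {t} = ≤B-low j t v≤w rv rw
  σ-2+i : σ (2 + i) ≡ 2 + i
  σ-2+i = trTo-o i (suc i) (λ e → <⇒≢ (m≤n⇒m≤1+n (n<1+n i)) (sym e)) (λ e → <⇒≢ (n<1+n (suc i)) (sym e))
  shape : CoverShape i k l → ∃ λ t → Tagged W i k l t × Valid W i t
  shape (adjacent k≢i) = far k
      , adj (λ { refl → lowᵂ (suc k , ≤-refl , ≤-reflexive (trans yl (trTo-r i (suc i)))) })
            (λ { refl → highᵂ (k , ≤-refl , ≤-reflexive (sym (trans yk (trTo-l i (suc i))))) })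
      , vfar k≢i (high⇒cross S (highᵂ (k , ≤-refl , subst (suc k ≤_) (sym yk) grow)))
    where
    grow : suc k ≤ σ (suc k)
    grow with trTo i (suc i) (suc k) | trView i (suc i) (suc k)
    ... | _ | at-l    = n≤1+n _
    ... | _ | at-r    = ⊥-elim (k≢i refl)
    ... | _ | off _ _ = ≤-refl
  shape right with low? S i
  ... | yes q = rightᵗ , right₊ , vR (highᵂ (i , ≤-refl , ≤-reflexive (sym (trans yk σ-2+i))) , q)
  ... | no ¬q = far (suc i) , right₀ ¬q
      , vfar (λ e → <⇒≢ (n<1+n i) (sym e)) (high⇒cross S (highᵂ (i , n≤1+n i , ≤-reflexive (sym (trans yk σ-2+i)))))
  shape (left refl) with high? W k (2 + k)
  ... | yes p = leftᵗ , left₊ refl , vL refl (p , lowᵂ (2 + k , ≤-refl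
        , ≤-reflexive (trans yl (trTo-o (suc k) (2 + k) (<⇒≢ (n<1+n k)) (<⇒≢ (m≤n⇒m≤1+n (n<1+n k)))))))
  ... | no ¬p = far k , left₀ refl ¬p
      , vfar (<⇒≢ (n<1+n k)) (high⇒cross S (highᵂ (k , ≤-refl , ≤-reflexive (sym (trans yk (trTo-r (suc k) (2 + k)))))))

-- Matching labels with minimal inversions of a coatom

-- Distinct minimal inversions of y for the distinct labels of the covers of s_i below w.
record Assignment (w y : Perm) (i : ℕ) : Set₁ where
  field
    Edges     : Tag → ℕ → ℕ → Set
    total     : ∀ {t} → Valid w i t → ∃₂ (Edges t)
    minimal   : ∀ {t a b} → Edges t a b → MinInv y a b
    separated : ∀ {t t′ a b} → Valid w i t → Valid w i t′ → Edges t a b → Edges t′ a b → t ≡ t′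

open Assignment

Unused : ∀ {w y i} → Assignment w y i → Set
Unused {w} {y} {i} A = ∃₂ λ a b → MinInv y a b × (∀ {t} → Valid w i t → Edges A t a b → ⊥)

module _ {w : Perm} {i : ℕ} (ci : Cross w i) where

  -- At most one of the two marks is valid, so both may point to the canonical inversion at the cut
  -- i, which no `far` label uses.
  assign-full : (F : FullCoatom w) → (∀ m → Double w m → Double w (suc m) → ⊥) → Assignment w (FullCoatom.v F) i
  assign-full F no-both = record { Edges = E ; total = tot ; minimal = λ {t} → mini t ; separated = sep }
    where
    open FullCoatom F
    E : Tag → ℕ → ℕ → Set
    E (far j) = Canon v j
    E leftᵗ   = Canon v i
    E rightᵗ  = Canon v i
    tot : ∀ {t} → Valid w i t → ∃₂ (E t)
    tot (vfar _ c) = cross⇒canon v (keep c)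
    tot (vR _)     = cross⇒canon v (keep ci)
    tot (vL _ _)   = cross⇒canon v (keep ci)
    mini : ∀ t {a b} → E t a b → MinInv v a b
    mini (far j) = canon⇒minInv
    mini leftᵗ       = canon⇒minInv
    mini rightᵗ       = canon⇒minInv
    sep : ∀ {t t′ a b} → Valid w i t → Valid w i t′ → E t a b → E t′ a b → t ≡ t′
    sep (vfar _ _)   (vfar _ _)   x y = cong far (canon-injective x y)
    sep (vfar ne _)  (vR _)       x y = ⊥-elim (ne (canon-injective x y))
    sep (vfar ne _)  (vL _ _)     x y = ⊥-elim (ne (canon-injective x y))
    sep (vR _)       (vfar ne _)  x y = ⊥-elim (ne (canon-injective y x))
    sep (vL _ _)     (vfar ne _)  x y = ⊥-elim (ne (canon-injective y x))
    sep (vR _)       (vR _)       _ _ = refl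
    sep (vL _ _)     (vL _ _)     _ _ = refl
    sep (vR d)       (vL refl d′) _ _ = ⊥-elim (no-both _ d′ d)
    sep (vL refl d′) (vR d)       _ _ = ⊥-elim (no-both _ d′ d)

  -- Both marks may be valid now: the free cut i serves one of them and the extra inversion the
  -- other, with no clash because the latter is never canonical.
  assign-one : (F : OneExtra w) → Assignment w (OneExtra.v F) i
  assign-one F = record { Edges = E ; total = tot ; minimal = λ {t} → mini t ; separated = sep }
    where
    open OneExtra F
    E : Tag → ℕ → ℕ → Set
    E (far j) = Canon v j
    E leftᵗ c d = c ≡ a × d ≡ b
    E rightᵗ  = Canon v i
    tot : ∀ {t} → Valid w i t → ∃₂ (E t)
    tot (vfar _ c) = cross⇒canon v (keep c)
    tot (vR _)     = cross⇒canon v (keep ci)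
    tot (vL _ _)   = a , b , refl , refl
    mini : ∀ t {c d} → E t c d → MinInv v c d
    mini (far j) = canon⇒minInv
    mini leftᵗ (refl , refl) = mi₁
    mini rightᵗ       = canon⇒minInv
    sep : ∀ {t t′ c d} → Valid w i t → Valid w i t′ → E t c d → E t′ c d → t ≡ t′
    sep (vfar _ _)  (vfar _ _)  x y = cong far (canon-injective x y)
    sep (vfar ne _) (vR _)      x y = ⊥-elim (ne (canon-injective x y))
    sep (vR _)      (vfar ne _) x y = ⊥-elim (ne (canon-injective y x))
    sep (vfar _ _)  (vL _ _)    x (refl , refl) = ⊥-elim (extra-not-canon extra₁ x)
    sep (vL _ _)    (vfar _ _)  (refl , refl) y = ⊥-elim (extra-not-canon extra₁ y)
    sep (vR _)      (vL _ _)    x (refl , refl) = ⊥-elim (extra-not-canon extra₁ x)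
    sep (vL _ _)    (vR _)      (refl , refl) y = ⊥-elim (extra-not-canon extra₁ y)
    sep (vR _)      (vR _)      _ _ = refl
    sep (vL _ _)    (vL _ _)    _ _ = refl

  -- Both marks are served by extra inversions, which leaves the canonical inversion at the cut i
  -- over as a spare.
  assign-two : (F : TwoExtra w) → Σ (Assignment w (TwoExtra.v F) i) Unused
  assign-two F = A , unused (cross⇒canon v (keep ci))
    where
    open TwoExtra F
    E : Tag → ℕ → ℕ → Set
    E (far j)  = Canon v j
    E leftᵗ a′ b′  = a′ ≡ a × b′ ≡ b
    E rightᵗ c′ d′ = c′ ≡ c × d′ ≡ d
    clash : ∀ {x y} → x ≡ a × y ≡ b → x ≡ c × y ≡ d → ⊥
    clash (refl , refl) (p , q) = [ (λ ne → ne p) , (λ ne → ne q) ] distinct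
    tot : ∀ {t} → Valid w i t → ∃₂ (E t)
    tot (vfar _ c) = cross⇒canon v (keep c)
    tot (vR _)     = c , d , refl , refl
    tot (vL _ _)   = a , b , refl , refl
    mini : ∀ t {c d} → E t c d → MinInv v c d
    mini (far j) = canon⇒minInv
    mini leftᵗ (refl , refl) = mi₁
    mini rightᵗ (refl , refl) = mi₂
    sep : ∀ {t t′ c d} → Valid w i t → Valid w i t′ → E t c d → E t′ c d → t ≡ t′
    sep (vfar _ _)  (vfar _ _)  x y = cong far (canon-injective x y)
    sep (vfar _ _)  (vR _)      x (refl , refl) = ⊥-elim (extra-not-canon extra₂ x)
    sep (vR _)      (vfar _ _)  (refl , refl) y = ⊥-elim (extra-not-canon extra₂ y)
    sep (vfar _ _)  (vL _ _)    x (refl , refl) = ⊥-elim (extra-not-canon extra₁ x)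
    sep (vL _ _)    (vfar _ _)  (refl , refl) y = ⊥-elim (extra-not-canon extra₁ y)
    sep (vR _)      (vL _ _)    x y = ⊥-elim (clash y x)
    sep (vL _ _)    (vR _)      x y = ⊥-elim (clash x y)
    sep (vR _)      (vR _)      _ _ = refl
    sep (vL _ _)    (vL _ _)    _ _ = refl
    A : Assignment w v i
    A = record { Edges = E ; total = tot ; minimal = λ {t} → mini t ; separated = sep }
    free : ∀ {x y} → Canon v i x y → ∀ {t} → Valid w i t → E t x y → ⊥
    free cn (vfar ne _) z             = ne (canon-injective z cn)
    free cn (vR _)      (refl , refl) = extra-not-canon extra₂ cn
    free cn (vL _ _)    (refl , refl) = extra-not-canon extra₁ cn
    unused : (∃₂ λ x y → Canon v i x y) → Unused A
    unused (x , y , cn) = x , y , canon⇒minInv cn , free cn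

  -- The coatom that removes the canonical inversion at i loses at most one crossing j; the edge at i replaces it.
  assign-none : ∀ {n} → Supp 0 n w → (∀ m → Double w m → ⊥) →
                ∃₂ λ p q → MinInv w p q × Assignment w (w ∘ₚ tr p q) i
  assign-none {n} S no-double with cross⇒canon w ci
  ... | p , q , cn = p , q , m , record { Edges = E ; total = tot ; minimal = λ {t} → mini t ; separated = sep }
    where
    m = canon⇒minInv cn
    open Swapped w (MinInv.pos m)
    Sv : Supp 0 n v
    Sv = swap-supp {x = w} S (MinInv.pos m) (MinInv.desc m)
    E : Tag → ℕ → ℕ → Set
    E (far j) a b = Canon v j a b ⊎ (¬ Cross v j × Canon v i a b)
    E leftᵗ _ _  = ⊥
    E rightᵗ _ _ = ⊥
    twice : ∀ {j k} → j ≢ k → Cross w j → ¬ Cross v j → Cross w k → ¬ Cross v k → ⊥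
    twice ne cj ¬cj ck ¬ck = [ (λ lt → lost-once m lt cj ¬cj ck ¬ck) , (λ lt → lost-once m lt ck ¬ck cj ¬cj) ] (<-cases ne)
    tot : ∀ {t} → Valid w i t → ∃₂ (E t)
    tot (vR d)   = ⊥-elim (no-double _ d)
    tot (vL _ d) = ⊥-elim (no-double _ d)
    tot (vfar {j} ne c) with cross? {w = v} Sv j | cross? {w = v} Sv i
    ... | yes cv | _      = let (a , b , x) = cross⇒canon v cv in a , b , inj₁ x
    ... | no ¬cv | yes cv = let (a , b , x) = cross⇒canon v cv in a , b , inj₂ (¬cv , x)
    ... | no ¬cv | no ¬ci = ⊥-elim (twice ne c ¬cv ci ¬ci)
    mini : ∀ t {a b} → E t a b → MinInv v a b
    mini (far j) = [ canon⇒minInv , (λ (_ , x) → canon⇒minInv x) ]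
    sep : ∀ {t t′ a b} → Valid w i t → Valid w i t′ → E t a b → E t′ a b → t ≡ t′
    sep (vR d)   _ _ _ = ⊥-elim (no-double _ d)
    sep (vL _ d) _ _ _ = ⊥-elim (no-double _ d)
    sep _ (vR d)   _ _ = ⊥-elim (no-double _ d)
    sep _ (vL _ d) _ _ = ⊥-elim (no-double _ d)
    sep (vfar _ _) (vfar _ _) (inj₁ x) (inj₁ y) = cong far (canon-injective x y)
    sep (vfar ne _) (vfar _ _) (inj₁ x) (inj₂ (_ , y)) = ⊥-elim (ne (canon-injective x y))
    sep (vfar _ _) (vfar ne _) (inj₂ (_ , x)) (inj₁ y) = ⊥-elim (ne (canon-injective y x))
    sep (vfar {j} _ cj) (vfar {k} _ ck) (inj₂ (¬cj , _)) (inj₂ (¬ck , _)) with j ≟ k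
    ... | yes e = cong far e
    ... | no ne = ⊥-elim (twice ne cj ¬cj ck ¬ck)

module Bounds {n} {w : Word n} {W} (rw : Rep w W) {a b} {u : Word n} {x i} (ru : Rep u x) (x≈ : x ≈ tr i (suc i))
  (udeg : UDeg w u a) (maxb : ∀ v k → InP w (len w ∸ 1) v → DDeg w v k → k ≤ b) where

  h : Fin a → Word n
  h = proj₁ udeg

  record Label (c : Fin a) : Set where
    field
      {k l} : ℕ
      {y}   : Perm
      ry    : Rep (h c) y
      ru′   : Rep u (y ∘ₚ tr k l)
      {t}   : Tag
      tag   : Tagged W i k l t
      valid : Valid W i t

  label : ∀ c → Label c
  label c = go (proj₂ (rep-below (proj₂ hc∈) rw))
    where
    hc∈ = proj₁ (proj₁ (proj₂ (proj₂ udeg)) c)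
    cov = proj₂ (proj₁ (proj₂ (proj₂ udeg)) c)
    go : ∀ {y} → Rep (h c) y → Label c
    go {y} ry = go′ (covers⇒minInv ry cov)
      where
      go′ : (∃₂ λ p q → MinInv y p q × Rep u (y ∘ₚ tr p q)) → Label c
      go′ (p , q , m , ru′) = let (t , tag , valid) = tag-cover ru x≈ rw ry (proj₂ hc∈) m ru′ in
        record { ry = ry ; ru′ = ru′ ; tag = tag ; valid = valid }

  label-injective : ∀ {c d} → Label.t (label c) ≡ Label.t (label d) → c ≡ d
  label-injective {c} {d} eq = proj₁ (proj₂ udeg) c d (rep-≡ (A.ry) (B.ry) same)
    where
    module A = Label (label c)
    module B = Label (label d)
    kl : A.k ≡ B.k × A.l ≡ B.l
    kl = tagged-injective (subst (Tagged W i A.k A.l) eq A.tag) B.tag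
    same : A.y ≈ B.y
    same s = trans (cong (A.y ·_) (sym (trTo-inv A.k A.l s))) (trans (rep-unique {u = A.y ∘ₚ tr A.k A.l} {v = B.y ∘ₚ tr B.k B.l} A.ru′ B.ru′ (trTo A.k A.l s))
      (cong (B.y ·_) (trans (cong₂ (λ k l → trTo k l (trTo A.k A.l s)) (sym (proj₁ kl)) (sym (proj₂ kl))) (trTo-inv A.k A.l s))))

  module _ {p q} (m : MinInv W p q) (A : Assignment W (W ∘ₚ tr p q) i) where

    private
      coatom : Σ (Word n) λ v → Rep v (W ∘ₚ tr p q)
      coatom = word-of (swap-supp {x = W} (support rw) (MinInv.pos m) (MinInv.desc m))
      v = proj₁ coatom
      rv = proj₂ coatom
      covers : Covers v w × len w ≡ suc (len v)
      covers = minInv⇒covers {u = v} {v = w} {y = W} rw m rv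

      edge : ∀ c → ∃₂ (Edges A (Label.t (label c)))
      edge c = total A (Label.valid (label c))

      from-edges : ∀ {k} (g : Fin k → ℕ × ℕ) → (∀ {c d} → g c ≡ g d → c ≡ d) →
                   (∀ c → MinInv (W ∘ₚ tr p q) (proj₁ (g c)) (proj₂ (g c))) → k ≤ b
      from-edges g g-inj g∈ with enumerate (λ x → minInv? (W ∘ₚ tr p q) (toℕ (src n x)) (toℕ (dst n x)))
      ... | N , f , f-inj , f∈ , f-onto = ≤-trans (C.count g g-inj g∈)
          (maxb v N ((e-least rv , proj₁ (proj₁ covers)) , sym (cong (_∸ 1) (proj₂ covers))) C.ddeg)
        where module C = CoverCount rv (proj₁ (proj₁ covers)) f f-inj f∈ f-onto

      g₀ : Fin a → ℕ × ℕ
      g₀ c = proj₁ (edge c) , proj₁ (proj₂ (edge c))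

      g₀-inj : ∀ {c d} → g₀ c ≡ g₀ d → c ≡ d
      g₀-inj {c} {d} eq = label-injective (separated A (Label.valid (label c)) (Label.valid (label d))
        (subst₂ (Edges A _) (cong proj₁ eq) (cong proj₂ eq) (proj₂ (proj₂ (edge c)))) (proj₂ (proj₂ (edge d))))

      g₀∈ : ∀ c → MinInv (W ∘ₚ tr p q) (proj₁ (g₀ c)) (proj₂ (g₀ c))
      g₀∈ c = minimal A (proj₂ (proj₂ (edge c)))

    a≤b : a ≤ b
    a≤b = from-edges g₀ g₀-inj g₀∈

    a<b : Unused A → a < b
    a<b (r , s , mrs , free) = from-edges g₁ g₁-inj g₁∈
      where
      g₁ : Fin (suc a) → ℕ × ℕ
      g₁ Fin.zero    = r , s
      g₁ (Fin.suc c) = g₀ c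
      taken : ∀ c → (r , s) ≡ g₀ c → ⊥
      taken c eq = free (Label.valid (label c))
        (subst₂ (Edges A _) (cong proj₁ (sym eq)) (cong proj₂ (sym eq)) (proj₂ (proj₂ (edge c))))
      g₁-inj : ∀ {c d} → g₁ c ≡ g₁ d → c ≡ d
      g₁-inj {Fin.zero}  {Fin.zero}  _  = refl
      g₁-inj {Fin.zero}  {Fin.suc d} eq = ⊥-elim (taken d eq)
      g₁-inj {Fin.suc c} {Fin.zero}  eq = ⊥-elim (taken c (sym eq))
      g₁-inj {Fin.suc c} {Fin.suc d} eq = cong Fin.suc (g₀-inj eq)
      g₁∈ : ∀ c → MinInv (W ∘ₚ tr p q) (proj₁ (g₁ c)) (proj₂ (g₁ c))
      g₁∈ Fin.zero    = mrs
      g₁∈ (Fin.suc c) = g₀∈ c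

-- Pattern occurrences in words and in permutations of ℕ

chain₄ : ∀ {n} {x₀ x₁ x₂ x₃ : Fin n} → x₀ Fin.< x₁ → x₁ Fin.< x₂ → x₂ Fin.< x₃ →
         ∀ (a b : Fin 4) → a Fin.< b → lookup (x₀ ∷ x₁ ∷ x₂ ∷ x₃ ∷ []) a Fin.< lookup (x₀ ∷ x₁ ∷ x₂ ∷ x₃ ∷ []) b
chain₄ p q r Fin.zero (Fin.suc Fin.zero) _ = p
chain₄ p q r Fin.zero (Fin.suc (Fin.suc Fin.zero)) _ = <-trans p q
chain₄ p q r Fin.zero (Fin.suc (Fin.suc (Fin.suc Fin.zero))) _ = <-trans p (<-trans q r)
chain₄ p q r (Fin.suc Fin.zero) (Fin.suc (Fin.suc Fin.zero)) _ = q
chain₄ p q r (Fin.suc Fin.zero) (Fin.suc (Fin.suc (Fin.suc Fin.zero))) _ = <-trans q r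
chain₄ p q r (Fin.suc (Fin.suc Fin.zero)) (Fin.suc (Fin.suc (Fin.suc Fin.zero))) _ = r
chain₄ p q r Fin.zero Fin.zero ()
chain₄ p q r (Fin.suc Fin.zero) Fin.zero ()
chain₄ p q r (Fin.suc Fin.zero) (Fin.suc Fin.zero) (s≤s ())
chain₄ p q r (Fin.suc (Fin.suc Fin.zero)) Fin.zero ()
chain₄ p q r (Fin.suc (Fin.suc Fin.zero)) (Fin.suc Fin.zero) (s≤s ())
chain₄ p q r (Fin.suc (Fin.suc Fin.zero)) (Fin.suc (Fin.suc Fin.zero)) (s≤s (s≤s ()))
chain₄ p q r (Fin.suc (Fin.suc (Fin.suc Fin.zero))) Fin.zero ()
chain₄ p q r (Fin.suc (Fin.suc (Fin.suc Fin.zero))) (Fin.suc Fin.zero) (s≤s ())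
chain₄ p q r (Fin.suc (Fin.suc (Fin.suc Fin.zero))) (Fin.suc (Fin.suc Fin.zero)) (s≤s (s≤s ()))
chain₄ p q r (Fin.suc (Fin.suc (Fin.suc Fin.zero))) (Fin.suc (Fin.suc (Fin.suc Fin.zero))) (s≤s (s≤s (s≤s ())))

reflects : ∀ {m n} (g : Fin m → Fin n) → (∀ a b → a Fin.< b → g a Fin.< g b) → ∀ a b → g a Fin.< g b → a Fin.< b
reflects g mono a b lt with Finₚ.<-cmp a b
... | tri< p _ _    = p
... | tri≈ _ refl _ = ⊥-elim (<-irrefl refl lt)
... | tri> _ _ p    = ⊥-elim (<-asym lt (mono b a p))

-- vals lists the four values of the occurrence in increasing order.
no-occurrence : ∀ {n} (w : Word n) (π : Word 4) → Avoids w π → ∀ {I J K M} → I Fin.< J → J Fin.< K → K Fin.< M →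
  ∀ {v₀ v₁ v₂ v₃} → v₀ Fin.< v₁ → v₁ Fin.< v₂ → v₂ Fin.< v₃ →
  (∀ a → lookup w (lookup (I ∷ J ∷ K ∷ M ∷ []) a) ≡ lookup (v₀ ∷ v₁ ∷ v₂ ∷ v₃ ∷ []) (lookup π a)) → ⊥
no-occurrence w π av {I} {J} {K} {M} p q r {v₀} {v₁} {v₂} {v₃} x y z same = av (lookup (I ∷ J ∷ K ∷ M ∷ []) , chain₄ p q r , λ a b →
  (λ lt → reflects vals (chain₄ x y z) (lookup π a) (lookup π b) (subst₂ Fin._<_ (same a) (same b) lt))
  , λ lt → subst₂ Fin._<_ (sym (same a)) (sym (same b)) (chain₄ x y z (lookup π a) (lookup π b) lt))
  where
  vals : Fin 4 → _
  vals = lookup (v₀ ∷ v₁ ∷ v₂ ∷ v₃ ∷ [])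

smooth⇒smoothₚ : ∀ {n} {w : Word n} {W} → Rep w W → Smooth w → Smoothₚ W
smooth⇒smoothₚ {n} {w} {W} rw (av₁ , av₂) = record
  { a3412 = λ {i} {j} {k} {l} p q r x y z →
      let l<n = proj₂ (supp-inversion (support rw) (<-trans p (<-trans q r)) y)
          k<n = <-trans r l<n ; j<n = <-trans q k<n ; i<n = <-trans p j<n in
      no-occurrence w p3412 av₁ (fin i<n j<n p) (fin j<n k<n q) (fin k<n l<n r)
        (val k<n l<n x) (val l<n i<n y) (val i<n j<n z)
        λ { Fin.zero → refl ; (Fin.suc Fin.zero) → refl ; (Fin.suc (Fin.suc Fin.zero)) → refl
          ; (Fin.suc (Fin.suc (Fin.suc Fin.zero))) → refl }
  ; a4231 = λ {i} {j} {k} {l} p q r x y z →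
      let l<n = proj₂ (supp-inversion (support rw) (<-trans q r) x)
          k<n = <-trans r l<n ; j<n = <-trans q k<n ; i<n = <-trans p j<n in
      no-occurrence w p4231 av₂ (fin i<n j<n p) (fin j<n k<n q) (fin k<n l<n r)
        (val l<n j<n x) (val j<n k<n y) (val k<n i<n z)
        λ { Fin.zero → refl ; (Fin.suc Fin.zero) → refl ; (Fin.suc (Fin.suc Fin.zero)) → refl
          ; (Fin.suc (Fin.suc (Fin.suc Fin.zero))) → refl }
  }
  where
  fin : ∀ {i j} (i<n : i < n) (j<n : j < n) → i < j → fromℕ< i<n Fin.< fromℕ< j<n
  fin i<n j<n = subst₂ _<_ (sym (Finₚ.toℕ-fromℕ< i<n)) (sym (Finₚ.toℕ-fromℕ< j<n))
  at′ : ∀ {i} (i<n : i < n) → W · i ≡ toℕ (lookup w (fromℕ< i<n))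
  at′ i<n = trans (cong (W ·_) (sym (Finₚ.toℕ-fromℕ< i<n))) (at rw (fromℕ< i<n))
  val : ∀ {i j} (i<n : i < n) (j<n : j < n) → W · i < W · j → lookup w (fromℕ< i<n) Fin.< lookup w (fromℕ< j<n)
  val i<n j<n = subst₂ _<_ (at′ i<n) (at′ j<n)

theorem1p3 : ∀ (n : ℕ) (w : Word n) → IsPerm w → Smooth w →
    ∀ (a b : ℕ) →
    IsMaxOver (InP w 1) (UDeg w) a →
    IsMaxOver (InP w (len w ∸ 1)) (DDeg w) b →
    (a ≤ b) × ((a ≡ b) ⇔ SelfDual w)
theorem1p3 n w perm smooth a b up@((u , (u∈ , lu) , udeg) , _) down@(_ , maxb) = a≤b , mk⇔ to from
  where
  W : Perm
  W = proj₁ (rep-of perm)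
  rw : Rep w W
  rw = proj₂ (rep-of perm)
  Sm : Smoothₚ W
  Sm = smooth⇒smoothₚ rw smooth
  x : Perm
  x = proj₁ (rep-below (proj₂ u∈) rw)
  ru : Rep u x
  ru = proj₂ (rep-below (proj₂ u∈) rw)
  i : ℕ
  i = proj₁ (atom⇒adjacent ru lu)
  x≈ : x ≈ tr i (suc i)
  x≈ = proj₂ (atom⇒adjacent ru lu)
  -- The atom s_i lies below w, so the cut i is crossed; this crossing supplies the canonical
  -- inversion left free by the other letters.
  ci : Cross W i
  ci = high⇒cross (support rw) (≤B-high i (suc i) (proj₂ u∈) ru rw
         (i , ≤-refl , ≤-reflexive (sym (trans (x≈ i) (trTo-l i (suc i))))))
  module B = Bounds rw ru x≈ udeg maxb
  a≤b : a ≤ b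
  a≤b = [ (λ F → B.a≤b (OneExtra.mi F) (assign-one ci F))
        , [ (λ (F , no-both) → B.a≤b (FullCoatom.mi F) (assign-full ci F no-both))
          , (λ no-double → let (_ , _ , m , A) = assign-none ci (support rw) no-double in B.a≤b m A) ] ]
        (extras-match-doubles (support rw) Sm)
  to : a ≡ b → SelfDual w
  to eq = [ (λ V → DualFromRel.selfDual rw (polished⇒antiRel (support rw) V))
          , (λ F → let (A , unused) = assign-two ci F in ⊥-elim (<⇒≢ (B.a<b (TwoExtra.mi F) A unused) eq)) ]
          (polished-or-twoExtra (support rw) Sm)
  from : SelfDual w → a ≡ b
  from d = ≤-antisym a≤b (selfDual⇒coatoms≤atoms rw up down d)
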